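{- Let $q$ be an odd prime power. Then $$(q-1)\left(h(q,z)-\frac{1}{2}h(q^2,z^2)\right)\in z-\frac{z^2}{q}+2z^3\mathbb{Z}_2[[z]].$$
   Context: For a number $Q$, $h(Q,z)=\log f(Q,z)\in\mathbb{Q}[[z]]$, where $f(Q,z)=\sum_{n\geq0}\frac{(-1)^nz^n}{Q^{\binom{n}{2}}(Q;Q)_n}$ and $(Q;Q)_n=\prod_{i=1}^n(1-Q^i)$. $\mathbb{Z}_2$ denotes the $2$-adic integers. -}

module Defs where

open import Data.Nat as ℕ using (ℕ; zero; suc; _∸_)
open import Data.Nat.Combinatorics using (_C_)
open import Data.Nat.Divisibility using (_∣_)
open import Data.Integer as ℤ using (+_; +0; +[1+_]; -[1+_])
open import Data.Rational as ℚ using (ℚ; mkℚ; _+_; _*_; _-_; -_; 0ℚ; 1ℚ; 1/_; _/_)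
open import Relation.Nullary using (¬_)

PowerSeries : Set
PowerSeries = ℕ → ℚ

sumTo : ℕ → (ℕ → ℚ) → ℚ
sumTo zero    f = f 0
sumTo (suc n) f = sumTo n f + f (suc n)

prodFrom1 : ℕ → (ℕ → ℚ) → ℚ
prodFrom1 zero    f = 1ℚ
prodFrom1 (suc n) f = prodFrom1 n f * f (suc n)

_^ℚ_ : ℚ → ℕ → ℚ
x ^ℚ zero  = 1ℚ
x ^ℚ suc n = x * (x ^ℚ n)

-- Total reciprocal (0 ↦ 0); only ever applied to nonzero arguments below.
inv : ℚ → ℚ
inv p@(mkℚ +[1+ n ] d c) = 1/ p
inv p@(mkℚ -[1+ n ] d c) = 1/ p
inv (mkℚ +0 d c)         = 0ℚ

_⊛_ : PowerSeries → PowerSeries → PowerSeries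
(f ⊛ g) n = sumTo n (λ i → f i * g (n ∸ i))

onePS : PowerSeries
onePS zero    = 1ℚ
onePS (suc _) = 0ℚ

powPS : PowerSeries → ℕ → PowerSeries
powPS f zero    = onePS
powPS f (suc k) = f ⊛ powPS f k

dropConst : PowerSeries → PowerSeries
dropConst f zero    = 0ℚ
dropConst f (suc n) = f (suc n)

-- log f for a power series with constant term 1:
--   log (1 + g) = Σ_{k ≥ 1} (-1)^(k+1) g^k / k ,  g = f - 1.
-- Since g^k has no terms of degree < k, the coefficient of z^n only
-- involves k = 1 .. n (a finite sum).
logPS : PowerSeries → PowerSeries
logPS f zero    = 0ℚ
logPS f (suc n) =
  sumTo n (λ j → ((- 1ℚ) ^ℚ j) * (+ 1 / suc j) * powPS (dropConst f) (suc j) (suc n))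

qPoch : ℚ → ℕ → ℚ
qPoch Q n = prodFrom1 n (λ i → 1ℚ - Q ^ℚ i)

fSeries : ℚ → PowerSeries
fSeries Q n = ((- 1ℚ) ^ℚ n) * inv ((Q ^ℚ (n C 2)) * qPoch Q n)

hSeries : ℚ → PowerSeries
hSeries Q = logPS (fSeries Q)

-- substitution z ↦ z² : (subSq g) n = g (n/2) if n even, 0 otherwise
subSq : PowerSeries → PowerSeries
subSq g zero          = g 0
subSq g (suc zero)    = 0ℚ
subSq g (suc (suc n)) = subSq (λ m → g (suc m)) n

InZ₂ : ℚ → Set
InZ₂ r = ¬ (2 ∣ ℚ.denominatorℕ r)

open import Data.Nat.Primality using (Prime)
open import Data.Product using (Σ; _×_)
open import Relation.Binary.PropositionalEquality using (_≡_)

IsOddPrimePower : ℕ → Set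
IsOddPrimePower q = Σ ℕ λ p → Σ ℕ λ k → Prime p × ¬ (2 ∣ p) × 1 ℕ.≤ k × q ≡ p ℕ.^ k

lhsSeries : ℕ → PowerSeries
lhsSeries q n =
  (Q - 1ℚ) * (hSeries Q n - ℚ.½ * subSq (hSeries (Q * Q)) n)
  where Q = + q / 1

{-# OPTIONS --safe #-}

-- Write p = 1/q. Then f(q,z) = F(z) = Σ p^(n²) zⁿ / (p;p)_n satisfies F(z) = F(pz) + pz F(p²z), so G = F(z)/F(pz) is
-- the Rogers–Ramanujan continued fraction, whose coefficients are polynomials in p. Put θ = z d/dz, L = θ log G, let L′ be
-- the analogue of L for p², and D(p) = L_n - L′_{n/2}. If n = 2^v m with m odd, then n (1 - p^n) times the n-th coefficient
-- is (q - 1) D(p). Since (1 - p^n)/(1 - p^(2^v)) is a 2-adic unit, it suffices that D = 2^v [2^v]_p E with E a polynomial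
-- over ℤ such that E(1) is even, because E(p) ≡ E(1) modulo 2.
--
-- * 2^v divides D by Dwork's congruence, because G(p,z)² ≡ G(p²,z²) modulo 2.
-- * [2^v]_p = Π_{j<v} (1 + p^(2^j)) divides D: at a root of unity ζ of order d = 2^(j+1) the norm N = Π_{i<d} G(ζ,ζⁱz) is an
--   eigenvalue of a product of d transfer matrices of trace 1 and determinant -z^d, so N² = N + z^d. Hence N(z) is the
--   fraction for p = 1 at z^d, which gives L_n(ζ) = L_{n/d}(1), and likewise L′_{n/2}(ζ²) = L_{n/d}(1).
-- * At p = 1 the coefficients of L are ±C(2n,n)/2, so E(1) is even by C(2n,n) ≡ ±C(n,n/2) modulo 2^(2v+2).

module Submission where

open import Algebra.Bundles using (CommutativeRing; RawRing)
open import Algebra.Solver.Ring.AlmostCommutativeRing using (fromCommutativeRing; _-Raw-AlmostCommutative⟶_; Induced-equivalence)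
import Algebra.Solver.Ring as RingSolver
import Algebra.Properties.Ring as RingProperties
import Algebra.Properties.Semiring.Mult as SemiringMult
import Algebra.Properties.CommutativeSemiring.Exp as SemiringExp
import Algebra.Morphism.Structures as Morphisms
import Relation.Binary.Reasoning.Setoid as SetoidReasoning
open import Data.Maybe.Base using (just; nothing)
open import Data.Nat as ℕ using (ℕ; zero; suc; z≤n; s≤s)
import Data.Nat.Properties as ℕ
open import Data.Integer as ℤ using (ℤ; +_; -[1+_]; _⊖_)
import Data.Integer.Properties as ℤ
open import Data.Product using (Σ; _×_; _,_; proj₁; proj₂)
open import Data.Sum using (_⊎_; inj₁; inj₂)
open import Data.Empty using (⊥; ⊥-elim; ⊥-elim-irr)
open import Level using (Level)
open import Relation.Binary.Definitions using (WeaklyDecidable)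
open import Relation.Binary.PropositionalEquality as ≡ using (_≡_)
open import Relation.Nullary using (¬_; yes; no)
open import Relation.Binary.Structures using (IsEquivalence)
import Data.Nat.Solver
import Algebra.Morphism.RingMonomorphism as RingMonomorphism
open import Data.List.Base as List using (List; []; _∷_)

-- Roots of unity and p = 1/q lie in different rings, so divisibility is established in ℤ[t] and
-- then evaluated. A root of unity of order 2^(j+1) is the class of t in ℤ[t]/(Φ) with Φ = 1 +
-- t^(2^j). Arguments that would use a field rest there on one property: 2x = 0 implies x = 0. It
-- holds because Φ has constant term 1 and so is a non-zero-divisor modulo 2. The two divisors of D
-- are joined in the same way: [2^v] is a non-zero-divisor modulo 2, hence a power of 2 dividing
-- [2^v] E divides E. The series G and L are never given by formulas. Each is determined by an
-- equation with a unique solution over any commutative ring, so the universal solution over ℤ[t]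
-- maps to the one over each quotient, over ℤ at t = 1 and over ℚ at t = 1/q. The bound n ≥ 3 is
-- forced by t = 1: for n = 1 and n = 2 the polynomial E is t and -t², odd at 1. These two
-- coefficients are computed directly.

private
  module ℕS = Data.Nat.Solver.+-*-Solver

-- Integer constants and ring solving over an arbitrary commutative ring

module RingTools {c ℓ : Level} (R : CommutativeRing c ℓ) where
  open CommutativeRing R
  open RingProperties ring
  open SemiringMult semiring using (×-homo-+; ×1-homo-*) renaming (_×_ to _ℕ×_)
  open SemiringExp commutativeSemiring using (_^_; ^-homo-*; ^-assocʳ; ^-distrib-*; ^-congˡ) public
  open SetoidReasoning setoid

  nat : ℕ → Carrier
  nat n = n ℕ× 1#

  nat-+ : ∀ m n → nat (m ℕ.+ n) ≈ nat m + nat n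
  nat-+ m n = ×-homo-+ 1# m n

  nat-* : ∀ m n → nat (m ℕ.* n) ≈ nat m * nat n
  nat-* m n = ×1-homo-* m n

  int : ℤ → Carrier
  int (+ n)    = nat n
  int -[1+ n ] = - nat (suc n)

  private
    cancel-1 : ∀ a b → a - b ≈ (1# + a) - (1# + b)
    cancel-1 a b = sym (begin
      (1# + a) - (1# + b) ≈⟨ +-cong (+-comm 1# a) (sym (-‿+-comm 1# b)) ⟩
      (a + 1#) + (- 1# + - b) ≈⟨ +-assoc a 1# _ ⟩
      a + (1# + (- 1# + - b)) ≈⟨ +-congˡ (sym (+-assoc 1# _ _)) ⟩
      a + ((1# + - 1#) + - b) ≈⟨ +-congˡ (+-congʳ (-‿inverseʳ 1#)) ⟩
      a + (0# + - b) ≈⟨ +-congˡ (+-identityˡ _) ⟩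
      a - b ∎)

  int-⊖ : ∀ m n → int (m ⊖ n) ≈ nat m - nat n
  int-⊖ m zero = begin
    nat m ≈⟨ sym (+-identityʳ _) ⟩
    nat m + 0# ≈⟨ +-congˡ (sym -0#≈0#) ⟩
    nat m - 0# ∎
  int-⊖ zero (suc n) = sym (+-identityˡ _)
  int-⊖ (suc m) (suc n) = begin
    int (suc m ⊖ suc n) ≡⟨ ≡.cong int (ℤ.[1+m]⊖[1+n]≡m⊖n m n) ⟩
    int (m ⊖ n) ≈⟨ int-⊖ m n ⟩
    nat m - nat n ≈⟨ cancel-1 _ _ ⟩
    nat (suc m) - nat (suc n) ∎

  int-neg : ∀ x → int (ℤ.- x) ≈ - int x
  int-neg (+ zero)  = sym -0#≈0#
  int-neg (+ suc n) = refl
  int-neg -[1+ n ]  = sym (-‿involutive _)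

  int-+ : ∀ x y → int (x ℤ.+ y) ≈ int x + int y
  int-+ (+ m) (+ n)       = nat-+ m n
  int-+ (+ m) -[1+ n ]    = int-⊖ m (suc n)
  int-+ -[1+ m ] (+ n)    = trans (int-⊖ n (suc m)) (+-comm _ _)
  int-+ -[1+ m ] -[1+ n ] = begin
    - nat (suc (suc (m ℕ.+ n))) ≡⟨ ≡.cong (λ k → - nat (suc k)) (≡.sym (ℕ.+-suc m n)) ⟩
    - nat (suc m ℕ.+ suc n) ≈⟨ -‿cong (nat-+ (suc m) (suc n)) ⟩
    - (nat (suc m) + nat (suc n)) ≈⟨ sym (-‿+-comm _ _) ⟩
    - nat (suc m) - nat (suc n) ∎

  private
    int-*⁺ : ∀ m y → int (+ m ℤ.* y) ≈ nat m * int y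
    int-*⁺ m (+ n)     = trans (reflexive (≡.cong int (≡.sym (ℤ.pos-* m n)))) (nat-* m n)
    int-*⁺ m -[1+ n ]  = begin
      int (+ m ℤ.* -[1+ n ]) ≡⟨ ≡.cong int (≡.sym (ℤ.neg-distribʳ-* (+ m) (+ suc n))) ⟩
      int (ℤ.- (+ m ℤ.* + suc n)) ≈⟨ int-neg (+ m ℤ.* + suc n) ⟩
      - int (+ m ℤ.* + suc n) ≈⟨ -‿cong (int-*⁺ m (+ suc n)) ⟩
      - (nat m * nat (suc n)) ≈⟨ -‿distribʳ-* _ _ ⟩
      nat m * - nat (suc n) ∎

  int-* : ∀ x y → int (x ℤ.* y) ≈ int x * int y
  int-* (+ m) y     = int-*⁺ m y
  int-* -[1+ m ] y  = begin
    int (-[1+ m ] ℤ.* y) ≡⟨ ≡.cong int (≡.sym (ℤ.neg-distribˡ-* (+ suc m) y)) ⟩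
    int (ℤ.- (+ suc m ℤ.* y)) ≈⟨ int-neg (+ suc m ℤ.* y) ⟩
    - int (+ suc m ℤ.* y) ≈⟨ -‿cong (int-*⁺ (suc m) y) ⟩
    - (nat (suc m) * int y) ≈⟨ -‿distribˡ-* _ _ ⟩
    - nat (suc m) * int y ∎

  private
    -- int up to the normal forms of ±1, so that solver constants match 1# definitionally.
    literal : ℤ → Carrier
    literal (+ 1)    = 1#
    literal -[1+ 0 ] = - 1#
    literal x        = int x

    literal≈int : ∀ x → literal x ≈ int x
    literal≈int (+ 0)           = refl
    literal≈int (+ 1)           = sym (+-identityʳ 1#)
    literal≈int (+ suc (suc n)) = refl
    literal≈int -[1+ 0 ]        = -‿cong (sym (+-identityʳ 1#))
    literal≈int -[1+ suc n ]    = refl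

    coefficients : CommutativeRing.rawRing ℤ.+-*-commutativeRing -Raw-AlmostCommutative⟶ fromCommutativeRing R
    coefficients = record
      { ⟦_⟧    = literal
      ; +-homo = λ x y → trans (literal≈int (x ℤ.+ y)) (trans (int-+ x y) (sym (+-cong (literal≈int x) (literal≈int y))))
      ; *-homo = λ x y → trans (literal≈int (x ℤ.* y)) (trans (int-* x y) (sym (*-cong (literal≈int x) (literal≈int y))))
      ; -‿homo = λ x → trans (literal≈int (ℤ.- x)) (trans (int-neg x) (-‿cong (sym (literal≈int x))))
      ; 0-homo = refl
      ; 1-homo = refl }

    literal-≟ : WeaklyDecidable (Induced-equivalence coefficients)
    literal-≟ x y with x ℤ.≟ y
    ... | yes p = just (reflexive (≡.cong literal p))
    ... | no _  = nothing

    module Solver = RingSolver (CommutativeRing.rawRing ℤ.+-*-commutativeRing) (fromCommutativeRing R) coefficients literal-≟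

  open Solver public using (solve; con; _:+_; _:*_; _:-_; :-_; _:=_)

  :0 :1 : ∀ {n} → Solver.Polynomial n
  :0 = con (+ 0)
  :1 = con (+ 1)

  x-y≈0⇒x≈y : ∀ {x y} → x - y ≈ 0# → x ≈ y
  x-y≈0⇒x≈y {x} {y} e = begin
    x ≈⟨ solve 2 (λ x y → x := (x :- y) :+ y) refl x y ⟩
    x - y + y ≈⟨ +-congʳ e ⟩
    0# + y ≈⟨ +-identityˡ y ⟩
    y ∎

  x≈y⇒x-y≈0 : ∀ {x y} → x ≈ y → x - y ≈ 0#
  x≈y⇒x-y≈0 {x} {y} e = trans (+-congʳ e) (-‿inverseʳ y)

-- Formal power series and the operators `scale`, `θ` and `σ`

module Series {c ℓ : Level} (R : CommutativeRing c ℓ) where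
  open CommutativeRing R
  open RingTools R
  open SetoidReasoning setoid

  infix 4 _≋_
  infixl 7 _⊗_
  infixr 7 _·_
  infixl 6 _⊕_

  Ser : Set c
  Ser = ℕ → Carrier

  -- A record, because pointwise equality as a bare function type unfolds and no longer lets `f` and
  -- `g` be inferred from a proof.
  record _≋_ (f g : Ser) : Set ℓ where
    constructor coeffs
    field
      at : ∀ n → f n ≈ g n
  open _≋_ public

  tail : Ser → Ser
  tail f n = f (suc n)

  constant : Carrier → Ser
  constant a zero    = a
  constant a (suc _) = 0#

  linear : Carrier → Ser
  linear a zero    = 0#
  linear a (suc n) = constant a n

  _⊕_ : Ser → Ser → Ser
  (f ⊕ g) n = f n + g n

  ⊝_ : Ser → Ser
  (⊝ f) n = - f n

  -- The Cauchy product read off from f = f₀ + z · `tail f`. Recursion on the index avoids finite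
  -- sums and truncated subtraction and turns the ring laws into inductions.
  _⊗_ : Ser → Ser → Ser
  (f ⊗ g) zero    = f 0 * g 0
  (f ⊗ g) (suc n) = f 0 * g (suc n) + (tail f ⊗ g) n

  _·_ : Carrier → Ser → Ser
  (a · f) n = a * f n

  -- Coefficient n of a product sees only coefficients up to n. The bounds matter for causal
  -- operators and for arguments modulo z^d.
  ⊗-cong-≤ : ∀ n {f f′ g g′} → (∀ {i} → i ℕ.≤ n → f i ≈ f′ i) → (∀ {i} → i ℕ.≤ n → g i ≈ g′ i) →
             (f ⊗ g) n ≈ (f′ ⊗ g′) n
  ⊗-cong-≤ zero    p q = *-cong (p z≤n) (q z≤n)
  ⊗-cong-≤ (suc n) p q =
    +-cong (*-cong (p z≤n) (q ℕ.≤-refl)) (⊗-cong-≤ n (λ i≤n → p (s≤s i≤n)) (λ i≤n → q (ℕ.m≤n⇒m≤1+n i≤n)))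

  ⊗-cong : ∀ {f f′ g g′} → f ≋ f′ → g ≋ g′ → f ⊗ g ≋ f′ ⊗ g′
  ⊗-cong p q = coeffs λ n → ⊗-cong-≤ n (λ {i} _ → at p i) (λ {i} _ → at q i)

  zeroˡ-⊗ : ∀ f {g} → (∀ n → f n ≈ 0#) → ∀ n → (f ⊗ g) n ≈ 0#
  zeroˡ-⊗ f p zero    = trans (*-congʳ (p 0)) (zeroˡ _)
  zeroˡ-⊗ f p (suc n) = begin
    f 0 * _ + _ ≈⟨ +-cong (trans (*-congʳ (p 0)) (zeroˡ _)) (zeroˡ-⊗ (tail f) (λ k → p (suc k)) n) ⟩
    0# + 0# ≈⟨ +-identityʳ 0# ⟩
    0# ∎

  constant-⊗ : ∀ a f n → (constant a ⊗ f) n ≈ a * f n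
  constant-⊗ a f zero    = refl
  constant-⊗ a f (suc n) = trans (+-congˡ (zeroˡ-⊗ (tail (constant a)) (λ _ → refl) n)) (+-identityʳ _)

  linear-⊗ : ∀ a f n → (linear a ⊗ f) (suc n) ≈ a * f n
  linear-⊗ a f n = begin
    0# * f (suc n) + (constant a ⊗ f) n ≈⟨ +-cong (zeroˡ _) (constant-⊗ a f n) ⟩
    0# + a * f n ≈⟨ +-identityˡ _ ⟩
    a * f n ∎

  ·-⊗ : ∀ a f g n → ((a · f) ⊗ g) n ≈ a * (f ⊗ g) n
  ·-⊗ a f g zero    = *-assoc _ _ _
  ·-⊗ a f g (suc n) = begin
    a * f 0 * g (suc n) + ((a · tail f) ⊗ g) n ≈⟨ +-congˡ (·-⊗ a (tail f) g n) ⟩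
    a * f 0 * g (suc n) + a * (tail f ⊗ g) n ≈⟨ solve 4 (λ a x y w → a :* x :* y :+ a :* w := a :* (x :* y :+ w)) refl a _ _ _ ⟩
    a * (f 0 * g (suc n) + (tail f ⊗ g) n) ∎

  ⊗-distribʳ : ∀ h f g n → ((f ⊕ g) ⊗ h) n ≈ (f ⊗ h) n + (g ⊗ h) n
  ⊗-distribʳ h f g zero    = distribʳ _ _ _
  ⊗-distribʳ h f g (suc n) = begin
    (f 0 + g 0) * h (suc n) + ((tail f ⊕ tail g) ⊗ h) n
      ≈⟨ +-congˡ (⊗-distribʳ h (tail f) (tail g) n) ⟩
    (f 0 + g 0) * h (suc n) + ((tail f ⊗ h) n + (tail g ⊗ h) n)
      ≈⟨ solve 5 (λ a b x u v → (a :+ b) :* x :+ (u :+ v) := (a :* x :+ u) :+ (b :* x :+ v)) refl _ _ _ _ _ ⟩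
    (f ⊗ h) (suc n) + (g ⊗ h) (suc n) ∎

  -- Splits off the last summand where the definition splits off the first; commutativity exchanges
  -- the two.
  ⊗-snoc : ∀ f g n → (f ⊗ g) (suc n) ≈ (f ⊗ tail g) n + f (suc n) * g 0
  ⊗-snoc f g zero    = refl
  ⊗-snoc f g (suc n) = begin
    f 0 * g (suc (suc n)) + (tail f ⊗ g) (suc n) ≈⟨ +-congˡ (⊗-snoc (tail f) g n) ⟩
    f 0 * g (suc (suc n)) + ((tail f ⊗ tail g) n + f (suc (suc n)) * g 0) ≈⟨ sym (+-assoc _ _ _) ⟩
    (f ⊗ tail g) (suc n) + f (suc (suc n)) * g 0 ∎

  ⊗-comm : ∀ f g n → (f ⊗ g) n ≈ (g ⊗ f) n
  ⊗-comm f g zero    = *-comm _ _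
  ⊗-comm f g (suc n) = begin
    f 0 * g (suc n) + (tail f ⊗ g) n ≈⟨ +-comm _ _ ⟩
    (tail f ⊗ g) n + f 0 * g (suc n) ≈⟨ +-cong (⊗-comm (tail f) g n) (*-comm _ _) ⟩
    (g ⊗ tail f) n + g (suc n) * f 0 ≈⟨ sym (⊗-snoc g f n) ⟩
    (g ⊗ f) (suc n) ∎

  ⊗-assoc : ∀ f g h n → ((f ⊗ g) ⊗ h) n ≈ (f ⊗ (g ⊗ h)) n
  ⊗-assoc f g h zero    = *-assoc _ _ _
  ⊗-assoc f g h (suc n) = begin
    f 0 * g 0 * h (suc n) + (((f 0 · tail g) ⊕ (tail f ⊗ g)) ⊗ h) n
      ≈⟨ +-congˡ (⊗-distribʳ h (f 0 · tail g) (tail f ⊗ g) n) ⟩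
    f 0 * g 0 * h (suc n) + (((f 0 · tail g) ⊗ h) n + ((tail f ⊗ g) ⊗ h) n)
      ≈⟨ +-congˡ (+-cong (·-⊗ (f 0) (tail g) h n) (⊗-assoc (tail f) g h n)) ⟩
    f 0 * g 0 * h (suc n) + (f 0 * (tail g ⊗ h) n + (tail f ⊗ (g ⊗ h)) n)
      ≈⟨ solve 5 (λ a b x u v → a :* b :* x :+ (a :* u :+ v) := a :* (b :* x :+ u) :+ v) refl _ _ _ _ _ ⟩
    f 0 * (g ⊗ h) (suc n) + (tail f ⊗ (g ⊗ h)) n ∎

  one : Ser
  one = constant 1#

  ⊗-identityˡ : ∀ f n → (one ⊗ f) n ≈ f n
  ⊗-identityˡ f n = trans (constant-⊗ 1# f n) (*-identityˡ _)

  ≋-isEquivalence : IsEquivalence _≋_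
  ≋-isEquivalence = record
    { refl  = coeffs λ _ → refl
    ; sym   = λ p → coeffs λ n → sym (at p n)
    ; trans = λ p q → coeffs λ n → trans (at p n) (at q n) }

  seriesRing : CommutativeRing c ℓ
  seriesRing = record
    { Carrier = Ser ; _≈_ = _≋_ ; _+_ = _⊕_ ; _*_ = _⊗_ ; -_ = ⊝_
    ; 0# = λ _ → 0# ; 1# = one
    ; isCommutativeRing = record
      { isRing = record
        { +-isAbelianGroup = record
          { isGroup = record
            { isMonoid = record
              { isSemigroup = record
                { isMagma = record
                  { isEquivalence = ≋-isEquivalence
                  ; ∙-cong = λ p q → coeffs λ n → +-cong (at p n) (at q n) }
                ; assoc = λ f g h → coeffs λ n → +-assoc _ _ _ }
              ; identity = (λ f → coeffs λ n → +-identityˡ _) , (λ f → coeffs λ n → +-identityʳ _) }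
            ; inverse = (λ f → coeffs λ n → -‿inverseˡ _) , (λ f → coeffs λ n → -‿inverseʳ _)
            ; ⁻¹-cong = λ p → coeffs λ n → -‿cong (at p n) }
          ; comm = λ f g → coeffs λ n → +-comm _ _ }
        ; *-cong = ⊗-cong
        ; *-assoc = λ f g h → coeffs (⊗-assoc f g h)
        ; *-identity = (λ f → coeffs (⊗-identityˡ f)) , (λ f → coeffs λ n → trans (⊗-comm f one n) (⊗-identityˡ f n))
        ; distrib = (λ h f g → coeffs λ n → trans (⊗-comm h (f ⊕ g) n) (trans (⊗-distribʳ h f g n)
                      (+-cong (⊗-comm f h n) (⊗-comm g h n))))
                  , (λ h f g → coeffs (⊗-distribʳ h f g)) }
      ; *-comm = λ f g → coeffs (⊗-comm f g) } }

  -- The substitution z ↦ az.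
  scale : Carrier → Ser → Ser
  scale a f n = a ^ n * f n

  scale-cong : ∀ a {f g} → f ≋ g → scale a f ≋ scale a g
  scale-cong a p = coeffs λ n → *-congˡ (at p n)

  scale-⊗ : ∀ a f g → scale a (f ⊗ g) ≋ scale a f ⊗ scale a g
  scale-⊗ a f g = coeffs (go f g)
    where
    go : ∀ f g n → scale a (f ⊗ g) n ≈ (scale a f ⊗ scale a g) n
    go f g zero    = solve 2 (λ x y → :1 :* (x :* y) := (:1 :* x) :* (:1 :* y)) refl (f 0) (g 0)
    go f g (suc n) = begin
      a * a ^ n * (f 0 * g (suc n) + (tail f ⊗ g) n)
        ≈⟨ solve 5 (λ a x u v w → a :* x :* (u :* v :+ w) := (:1 :* u) :* (a :* x :* v) :+ a :* (x :* w)) refl a (a ^ n) _ _ _ ⟩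
      (1# * f 0) * (a * a ^ n * g (suc n)) + a * scale a (tail f ⊗ g) n
        ≈⟨ +-congˡ (*-congˡ (go (tail f) g n)) ⟩
      (1# * f 0) * (a * a ^ n * g (suc n)) + a * (scale a (tail f) ⊗ scale a g) n
        ≈⟨ +-congˡ (sym (·-⊗ a (scale a (tail f)) (scale a g) n)) ⟩
      (1# * f 0) * (a * a ^ n * g (suc n)) + ((a · scale a (tail f)) ⊗ scale a g) n
        ≈⟨ +-congˡ (⊗-cong-≤ n (λ {i} _ → sym (*-assoc a (a ^ i) _)) (λ _ → refl)) ⟩
      (1# * f 0) * (a * a ^ n * g (suc n)) + (tail (scale a f) ⊗ scale a g) n ∎

  scale-⊕ : ∀ a f g → scale a (f ⊕ g) ≋ scale a f ⊕ scale a g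
  scale-⊕ a f g = coeffs λ n → distribˡ _ _ _

  scale-linear : ∀ a b → scale a (linear b) ≋ linear (a * b)
  scale-linear a b = coeffs λ where
    zero          → solve 1 (λ a → :1 :* :0 := :0) refl a
    (suc zero)    → solve 2 (λ a b → a :* :1 :* b := a :* b) refl a b
    (suc (suc n)) → zeroʳ _

  scale-scale : ∀ a b f → scale a (scale b f) ≋ scale (a * b) f
  scale-scale a b f = coeffs λ n → trans (sym (*-assoc _ _ _)) (*-congʳ (sym (^-distrib-* a b n)))

  scale-base : ∀ {a b} f → a ≈ b → scale a f ≋ scale b f
  scale-base f e = coeffs λ n → *-congʳ (^-congˡ n e)

  -- θ is z d/dz.
  θ : Ser → Ser
  θ f n = nat n * f n

  θ-cong : ∀ {f g} → f ≋ g → θ f ≋ θ g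
  θ-cong p = coeffs λ n → *-congˡ (at p n)

  θ-⊕ : ∀ f g → θ (f ⊕ g) ≋ θ f ⊕ θ g
  θ-⊕ f g = coeffs λ n → distribˡ _ _ _

  θ-constant : ∀ a n → θ (constant a) n ≈ 0#
  θ-constant a zero    = zeroˡ a
  θ-constant a (suc n) = zeroʳ _

  -- Induction on the index. Tails do not commute with θ: `tail (θ f)` is `tail f` + `θ (tail f)`,
  -- and the extra term absorbs the surplus copy of the tail product.
  θ-⊗ : ∀ f g → θ (f ⊗ g) ≋ θ f ⊗ g ⊕ f ⊗ θ g
  θ-⊗ f g = coeffs (go f g)
    where
    go : ∀ f g n → θ (f ⊗ g) n ≈ (θ f ⊗ g) n + (f ⊗ θ g) n
    go f g zero    = solve 2 (λ x y → :0 :* (x :* y) := :0 :* x :* y :+ x :* (:0 :* y)) refl _ _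
    go f g (suc n) = begin
      (1# + nat n) * (f 0 * g (suc n) + w)
        ≈⟨ solve 4 (λ k x y w → (:1 :+ k) :* (x :* y :+ w) := (w :+ k :* w) :+ x :* ((:1 :+ k) :* y)) refl (nat n) (f 0) (g (suc n)) w ⟩
      (w + nat n * w) + f 0 * θ g (suc n)
        ≈⟨ +-congʳ (+-congˡ (go (tail f) g n)) ⟩
      (w + ((θ (tail f) ⊗ g) n + (tail f ⊗ θ g) n)) + f 0 * θ g (suc n)
        ≈⟨ solve 5 (λ w u v z s → (w :+ (u :+ v)) :+ z := (:0 :* s :+ (w :+ u)) :+ (z :+ v)) refl w _ _ _ (g (suc n)) ⟩
      (0# * g (suc n) + (w + (θ (tail f) ⊗ g) n)) + (f 0 * θ g (suc n) + (tail f ⊗ θ g) n)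
        ≈⟨ +-congʳ (+-cong (*-congʳ (sym (zeroˡ (f 0)))) (sym (⊗-distribʳ g (tail f) (θ (tail f)) n))) ⟩
      (0# * f 0 * g (suc n) + ((tail f ⊕ θ (tail f)) ⊗ g) n) + (f ⊗ θ g) (suc n)
        ≈⟨ +-congʳ (+-congˡ (⊗-cong-≤ n (λ {i} _ → solve 2 (λ k x → x :+ k :* x := (:1 :+ k) :* x) refl (nat i) (f (suc i))) (λ _ → refl))) ⟩
      (θ f ⊗ g) (suc n) + (f ⊗ θ g) (suc n) ∎
      where w = (tail f ⊗ g) n

  -- σ is the substitution z ↦ z².
  σ : Ser → Ser
  σ f zero          = f 0
  σ f (suc zero)    = 0#
  σ f (suc (suc n)) = σ (tail f) n

  σ-cong : ∀ {f g} → f ≋ g → σ f ≋ σ g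
  σ-cong p = coeffs (go p)
    where
    go : ∀ {f g} → f ≋ g → ∀ n → σ f n ≈ σ g n
    go p zero          = at p 0
    go p (suc zero)    = refl
    go p (suc (suc n)) = go (coeffs λ k → at p (suc k)) n

  σ-⊕ : ∀ f g → σ (f ⊕ g) ≋ σ f ⊕ σ g
  σ-⊕ f g = coeffs (go f g)
    where
    go : ∀ f g n → σ (f ⊕ g) n ≈ σ f n + σ g n
    go f g zero          = refl
    go f g (suc zero)    = sym (+-identityˡ 0#)
    go f g (suc (suc n)) = go (tail f) (tail g) n

  σ-· : ∀ a f n → σ (a · f) n ≈ a * σ f n
  σ-· a f zero          = refl
  σ-· a f (suc zero)    = sym (zeroʳ a)
  σ-· a f (suc (suc n)) = σ-· a (tail f) n

  σ-⊗ : ∀ f g → σ (f ⊗ g) ≋ σ f ⊗ σ g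
  σ-⊗ f g = coeffs (go f g)
    where
    go : ∀ f g n → σ (f ⊗ g) n ≈ (σ f ⊗ σ g) n
    go f g zero          = refl
    go f g (suc zero)    = solve 2 (λ x y → :0 := x :* :0 :+ :0 :* y) refl (f 0) (g 0)
    go f g (suc (suc n)) = begin
      σ ((f 0 · tail g) ⊕ (tail f ⊗ g)) n ≈⟨ at (σ-⊕ (f 0 · tail g) (tail f ⊗ g)) n ⟩
      σ (f 0 · tail g) n + σ (tail f ⊗ g) n ≈⟨ +-cong (σ-· (f 0) (tail g) n) (go (tail f) g n) ⟩
      f 0 * σ (tail g) n + (σ (tail f) ⊗ σ g) n
        ≈⟨ solve 4 (λ x y w s → x :* y :+ w := x :* y :+ (:0 :* s :+ w)) refl (f 0) _ _ (σ g (suc n)) ⟩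
      f 0 * σ (tail g) n + (0# * σ g (suc n) + (σ (tail f) ⊗ σ g) n) ∎

  θ-σ : ∀ f → θ (σ f) ≋ σ (θ f) ⊕ σ (θ f)
  θ-σ f = coeffs λ n → trans (solve 2 (λ k x → k :* x := (k :+ (:0 :+ :0)) :* x) refl (nat n) (σ f n)) (trans (go 0 f n) (trans (at (σ-⊕ (h 0 f) (h 0 f)) n) (+-cong (lem n) (lem n))))
    where
    h : ℕ → Ser → Ser
    h k f n = (nat k + nat n) * f n

    lem : ∀ n → σ (h 0 f) n ≈ σ (θ f) n
    lem = at (σ-cong (coeffs λ n → *-congʳ (+-identityˡ _)))

    -- `σ` consumes two indices per tail, so the induction carries the number k of tails already
    -- taken: the original index is n + 2k in `σ f`, and k plus the current one in `f`.
    go : ∀ k f n → (nat n + (nat k + nat k)) * σ f n ≈ σ (h k f ⊕ h k f) n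
    go k f zero          = solve 2 (λ k x → (:0 :+ (k :+ k)) :* x := (k :+ :0) :* x :+ (k :+ :0) :* x) refl (nat k) (f 0)
    go k f (suc zero)    = zeroʳ _
    go k f (suc (suc n)) = begin
      ((1# + (1# + nat n)) + (nat k + nat k)) * σ (tail f) n
        ≈⟨ *-congʳ (solve 2 (λ k n → (:1 :+ (:1 :+ n)) :+ (k :+ k) := n :+ ((:1 :+ k) :+ (:1 :+ k))) refl (nat k) (nat n)) ⟩
      (nat n + (nat (suc k) + nat (suc k))) * σ (tail f) n
        ≈⟨ go (suc k) (tail f) n ⟩
      σ (h (suc k) (tail f) ⊕ h (suc k) (tail f)) n
        ≈⟨ at (σ-cong {h (suc k) (tail f) ⊕ h (suc k) (tail f)} {tail (h k f ⊕ h k f)} (coeffs λ m → solve 3 (λ k m x → (:1 :+ k :+ m) :* x :+ (:1 :+ k :+ m) :* x := (k :+ (:1 :+ m)) :* x :+ (k :+ (:1 :+ m)) :* x) refl (nat k) (nat m) (f (suc m)))) n ⟩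
      σ (tail (h k f ⊕ h k f)) n ∎

  σ-double : ∀ f n → σ f (n ℕ.+ n) ≡ f n
  σ-double f zero    = ≡.refl
  σ-double f (suc n) = ≡.trans (≡.cong (λ k → σ f (suc k)) (ℕ.+-suc n n)) (σ-double (tail f) n)

  σ-odd : ∀ f n → σ f (suc (n ℕ.+ n)) ≡ 0#
  σ-odd f zero    = ≡.refl
  σ-odd f (suc n) = ≡.trans (≡.cong (λ k → σ f (suc (suc k))) (ℕ.+-suc n n)) (σ-odd (tail f) n)

-- Equations with a unique power series solution

module SeriesEquations {c ℓ : Level} (R : CommutativeRing c ℓ) where
  open CommutativeRing R
  open RingTools R
  open Series R
  private
    module S = CommutativeRing seriesRing
    module ST = RingTools seriesRing
    module ≋-Reasoning = SetoidReasoning S.setoid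

  VanishesBelow : ℕ → Ser → Set ℓ
  VanishesBelow n f = ∀ {i} → i ℕ.< n → f i ≈ 0#

  ⊗-lowest : ∀ n f g → VanishesBelow n f → (f ⊗ g) n ≈ f n * g 0
  ⊗-lowest zero    f g low = refl
  ⊗-lowest (suc n) f g low = begin
    f 0 * g (suc n) + (tail f ⊗ g) n ≈⟨ +-cong (trans (*-congʳ (low (s≤s z≤n))) (zeroˡ _)) (⊗-lowest n (tail f) g (λ i<n → low (s≤s i<n))) ⟩
    0# + f (suc n) * g 0 ≈⟨ +-identityˡ _ ⟩
    f (suc n) * g 0 ∎
    where open SetoidReasoning setoid

  -- The induction shared by the uniqueness results: it is enough to treat the lowest coefficient
  -- that might survive.
  vanishes : ∀ f → (∀ n → VanishesBelow n f → f n ≈ 0#) → f ≋ S.0#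
  vanishes f step = coeffs λ n → step n (below n)
    where
    below : ∀ n → VanishesBelow n f
    below (suc n) {i} i<1+n with ℕ.m≤n⇒m<n∨m≡n (ℕ.≤-pred i<1+n)
    ... | inj₁ i<n      = below n i<n
    ... | inj₂ ≡.refl   = step n (below n)

  -- Zero divisors do no harm: the lowest coefficient of (x - y) f is that of x - y times f₀ = 1.
  ⊗-cancelˡ : ∀ f {x y} → f 0 ≈ 1# → f ⊗ x ≋ f ⊗ y → x ≋ y
  ⊗-cancelˡ f {x} {y} f₀ e = ST.x-y≈0⇒x≈y (vanishes Δ step)
    where
    Δ = x S.- y
    Δf≋0 : Δ ⊗ f ≋ S.0#
    Δf≋0 = S.trans (ST.solve 3 (λ x y f → (x ST.:- y) ST.:* f ST.:= (f ST.:* x) ST.:- (f ST.:* y)) S.refl x y f)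
                   (ST.x≈y⇒x-y≈0 e)
    step : ∀ n → VanishesBelow n Δ → Δ n ≈ 0#
    step n low = begin
      Δ n ≈⟨ sym (*-identityʳ _) ⟩
      Δ n * 1# ≈⟨ *-congˡ (sym f₀) ⟩
      Δ n * f 0 ≈⟨ sym (⊗-lowest n Δ f low) ⟩
      (Δ ⊗ f) n ≈⟨ at Δf≋0 n ⟩
      0# ∎
      where open SetoidReasoning setoid

  -- Let s be the substitution z ↦ uz. Subtracting the equations gives (X - Y) · sX = (sX - sY)(1 -
  -- Y). If X and Y agree below n, coefficient n is X_n - Y_n on the left and has the factor 1 - Y₀
  -- = 0 on the right, also when u is 1 or a root of unity. The term `C` is left general because tz,
  -- t²z² and z^d all occur.
  fractional-unique : ∀ u C {X Y} → X 0 ≈ 1# → Y 0 ≈ 1# →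
    X ⊗ scale u X ≋ scale u X ⊕ C → Y ⊗ scale u Y ≋ scale u Y ⊕ C → X ≋ Y
  fractional-unique u C {X} {Y} X₀ Y₀ eX eY = ST.x-y≈0⇒x≈y (vanishes Δ step)
    where
    Δ = X S.- Y
    sX = scale u X
    sY = scale u Y
    identity : Δ ⊗ sX ≋ (sX S.- sY) ⊗ (one S.- Y)
    identity = begin
      Δ ⊗ sX
        ≈⟨ ST.solve 3 (λ x y s → (x ST.:- y) ST.:* s ST.:= x ST.:* s ST.:- y ST.:* s) S.refl X Y sX ⟩
      X ⊗ sX S.- Y ⊗ sX
        ≈⟨ S.+-congʳ eX ⟩
      (sX ⊕ C) S.- Y ⊗ sX
        ≈⟨ ST.solve 4 (λ y s r c → (s ST.:+ c) ST.:- y ST.:* s ST.:= (s ST.:- r ST.:- y ST.:* s) ST.:+ (r ST.:+ c)) S.refl Y sX sY C ⟩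
      (sX S.- sY S.- Y ⊗ sX) ⊕ (sY ⊕ C)
        ≈⟨ S.+-congˡ (S.sym eY) ⟩
      (sX S.- sY S.- Y ⊗ sX) ⊕ (Y ⊗ sY)
        ≈⟨ ST.solve 3 (λ y s r → (s ST.:- r ST.:- y ST.:* s) ST.:+ (y ST.:* r) ST.:= (s ST.:- r) ST.:* (ST.:1 ST.:- y)) S.refl Y sX sY ⟩
      (sX S.- sY) ⊗ (one S.- Y) ∎
      where open ≋-Reasoning
    sΔ : ∀ n → Δ n ≈ 0# → (sX S.- sY) n ≈ 0#
    sΔ n e = trans (solve 3 (λ a x y → a :* x :- a :* y := a :* (x :- y)) refl (u ^ n) (X n) (Y n)) (trans (*-congˡ e) (zeroʳ _))
    step : ∀ n → VanishesBelow n Δ → Δ n ≈ 0#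
    step n low = begin
      Δ n ≈⟨ sym (*-identityʳ _) ⟩
      Δ n * 1# ≈⟨ *-congˡ (sym (trans (*-identityˡ _) X₀)) ⟩
      Δ n * sX 0 ≈⟨ sym (⊗-lowest n Δ sX low) ⟩
      (Δ ⊗ sX) n ≈⟨ at identity n ⟩
      ((sX S.- sY) ⊗ (one S.- Y)) n ≈⟨ ⊗-lowest n (sX S.- sY) (one S.- Y) (λ {i} i<n → sΔ i (low i<n)) ⟩
      (sX S.- sY) n * (1# - Y 0) ≈⟨ *-congˡ (x≈y⇒x-y≈0 (sym Y₀)) ⟩
      (sX S.- sY) n * 0# ≈⟨ zeroʳ _ ⟩
      0# ∎
      where open SetoidReasoning setoid

  Causal : (Ser → Ser) → Set _
  Causal Φ = ∀ n {f g} → (∀ {i} → i ℕ.< n → f i ≈ g i) → Φ f n ≈ Φ g n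

  iterate : (Ser → Ser) → ℕ → Ser
  iterate Φ zero    = S.0#
  iterate Φ (suc k) = Φ (iterate Φ k)

  -- Each round of a causal operator settles one more coefficient, so coefficient n is final after n
  -- + 1 rounds.
  fixpoint : (Ser → Ser) → Ser
  fixpoint Φ n = iterate Φ (suc n) n

  fixpoint-fixed : ∀ Φ → Causal Φ → fixpoint Φ ≋ Φ (fixpoint Φ)
  fixpoint-fixed Φ causal = coeffs λ n → causal n λ {i} i<n → stable i<n ℕ.≤-refl
    where
    stable : ∀ {k m n} → n ℕ.< k → n ℕ.< m → iterate Φ k n ≈ iterate Φ m n
    stable {suc k} {suc m} {n} (s≤s n≤k) (s≤s n≤m) =
      causal n λ i<n → stable (ℕ.<-≤-trans i<n n≤k) (ℕ.<-≤-trans i<n n≤m)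

  divide : ∀ f b → f 0 ≈ 1# → Σ Ser λ h → f ⊗ h ≋ b
  divide f b f₀ = h , coeffs quotient-eq
    where
    Φ : Ser → Ser
    Φ x zero    = b 0
    Φ x (suc n) = b (suc n) - (tail f ⊗ x) n
    causal : Causal Φ
    causal zero    p = refl
    causal (suc n) p = +-congˡ (-‿cong (⊗-cong-≤ n (λ _ → refl) (λ i≤n → p (s≤s i≤n))))
    h = fixpoint Φ
    fixed = fixpoint-fixed Φ causal
    quotient-eq : ∀ n → (f ⊗ h) n ≈ b n
    quotient-eq zero    = trans (*-congʳ f₀) (*-identityˡ _)
    quotient-eq (suc n) = begin
      f 0 * h (suc n) + (tail f ⊗ h) n ≈⟨ +-congʳ (*-cong f₀ (at fixed (suc n))) ⟩
      1# * (b (suc n) - (tail f ⊗ h) n) + (tail f ⊗ h) n ≈⟨ solve 2 (λ b w → :1 :* (b :- w) :+ w := b) refl _ _ ⟩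
      b (suc n) ∎
      where open SetoidReasoning setoid

  -- The Rogers–Ramanujan continued fraction G(z) = 1 + tz / G(tz).
  record IsFraction (t : Carrier) (G : Ser) : Set ℓ where
    field
      constantTerm : G 0 ≈ 1#
      functional   : G ⊗ scale t G ≋ scale t G ⊕ linear t
  open IsFraction public

  fraction-unique : ∀ {t u G H} → t ≈ u → IsFraction t G → IsFraction u H → G ≋ H
  fraction-unique {t} {u} {G} {H} t≈u p q = fractional-unique t (linear t) (constantTerm p) (constantTerm q) (functional p) (begin
      H ⊗ scale t H ≈⟨ S.*-congˡ {H} (scale-base H t≈u) ⟩
      H ⊗ scale u H ≈⟨ functional q ⟩
      scale u H ⊕ linear u ≈⟨ S.+-cong (S.sym (scale-base H t≈u)) (coeffs λ { zero → refl ; (suc zero) → sym t≈u ; (suc (suc _)) → refl }) ⟩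
      scale t H ⊕ linear t ∎)
    where open ≋-Reasoning

  -- With G = 1 + zY the equation becomes Y(z) G(tz) = t, that is Y₀ = t and Y_(n+1) = -(Y ·
  -- tY(tz))_n, a causal recursion without division.
  fraction-exists : ∀ t → Σ Ser (IsFraction t)
  fraction-exists t = G , record { constantTerm = refl ; functional = functional-eq }
    where
    Φ : Ser → Ser
    Φ Y zero    = t
    Φ Y (suc n) = - (Y ⊗ (t · scale t Y)) n
    causal : Causal Φ
    causal zero    p = refl
    causal (suc n) p = -‿cong (⊗-cong-≤ n (λ i≤n → p (s≤s i≤n)) (λ i≤n → *-congˡ (*-congˡ (p (s≤s i≤n)))))
    Y = fixpoint Φ
    fixed = fixpoint-fixed Φ causal
    G : Ser
    G zero    = 1#
    G (suc n) = Y n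
    sG = scale t G
    tail-eq : ∀ n → (Y ⊗ sG) n ≈ constant t n
    tail-eq zero    = trans (*-congˡ (*-identityˡ 1#)) (trans (*-identityʳ _) (at fixed 0))
    tail-eq (suc n) = begin
      (Y ⊗ sG) (suc n) ≈⟨ ⊗-snoc Y sG n ⟩
      (Y ⊗ tail sG) n + Y (suc n) * (1# * 1#) ≈⟨ +-cong (⊗-cong-≤ n (λ _ → refl) (λ {i} _ → *-assoc t (t ^ i) _)) (*-cong (at fixed (suc n)) (*-identityˡ 1#)) ⟩
      w + - w * 1# ≈⟨ solve 1 (λ w → w :+ (:- w) :* :1 := :0) refl w ⟩
      0# ∎
      where
      open SetoidReasoning setoid
      w = (Y ⊗ (t · scale t Y)) n
    functional-eq : G ⊗ sG ≋ sG ⊕ linear t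
    functional-eq = coeffs λ where
      zero    → solve 1 (λ x → :1 :* (:1 :* :1) := :1 :* :1 :+ :0) refl t
      (suc n) → +-cong (*-identityˡ _) (tail-eq n)

  -- S = θ log G with the denominator cleared: neither a logarithm nor an inverse integer appears,
  -- and ring homomorphisms preserve the relation.
  IsLogDerivative : Ser → Ser → Set ℓ
  IsLogDerivative G S = G ⊗ S ≋ θ G

  logDerivative-exists : ∀ G → G 0 ≈ 1# → Σ Ser (IsLogDerivative G)
  logDerivative-exists G G₀ = divide G (θ G) G₀

  logDerivative-cong : ∀ {G G′ S S′} → G 0 ≈ 1# → G ≋ G′ → IsLogDerivative G S → IsLogDerivative G′ S′ → S ≋ S′
  logDerivative-cong {G} {G′} {S} {S′} G₀ e p q = ⊗-cancelˡ G G₀ (begin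
      G ⊗ S ≈⟨ p ⟩
      θ G ≈⟨ θ-cong e ⟩
      θ G′ ≈⟨ S.sym q ⟩
      G′ ⊗ S′ ≈⟨ S.*-congʳ (S.sym e) ⟩
      G ⊗ S′ ∎)
    where open ≋-Reasoning

-- Base change and quotients by a principal ideal

module _ {c₁ ℓ₁ c₂ ℓ₂ : Level} (A : CommutativeRing c₁ ℓ₁) (B : CommutativeRing c₂ ℓ₂) where
  private
    module A = CommutativeRing A
    module B = CommutativeRing B
  IsHom : (A.Carrier → B.Carrier) → Set _
  IsHom = Morphisms.RingMorphisms.IsRingHomomorphism A.rawRing B.rawRing

module SeriesMap {c₁ ℓ₁ c₂ ℓ₂ : Level} (A : CommutativeRing c₁ ℓ₁) (B : CommutativeRing c₂ ℓ₂)
  (φ : CommutativeRing.Carrier A → CommutativeRing.Carrier B) (hom : IsHom A B φ) where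
  private
    module A where
      open CommutativeRing A public
      open RingTools A public
      open Series A public
      open SeriesEquations A public
    module B where
      open CommutativeRing B public
      open RingTools B public
      open Series B public
      open SeriesEquations B public
  open Morphisms.RingMorphisms.IsRingHomomorphism hom

  map : A.Ser → B.Ser
  map f n = φ (f n)

  φ-nat : ∀ n → φ (A.nat n) B.≈ B.nat n
  φ-nat zero    = 0#-homo
  φ-nat (suc n) = B.trans (+-homo _ _) (B.+-cong 1#-homo (φ-nat n))

  φ-^ : ∀ a n → φ (a A.^ n) B.≈ φ a B.^ n
  φ-^ a zero    = 1#-homo
  φ-^ a (suc n) = B.trans (*-homo _ _) (B.*-congˡ (φ-^ a n))

  map-⊗ : ∀ f g n → φ ((f A.⊗ g) n) B.≈ (map f B.⊗ map g) n
  map-⊗ f g zero    = *-homo _ _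
  map-⊗ f g (suc n) = B.trans (+-homo _ _) (B.+-cong (*-homo _ _) (map-⊗ (A.tail f) g n))

  map-scale : ∀ a f n → φ (A.scale a f n) B.≈ B.scale (φ a) (map f) n
  map-scale a f n = B.trans (*-homo _ _) (B.*-congʳ (φ-^ a n))

  map-θ : ∀ f n → φ (A.θ f n) B.≈ B.θ (map f) n
  map-θ f n = B.trans (*-homo _ _) (B.*-congʳ (φ-nat n))

  map-σ : ∀ f n → φ (A.σ f n) B.≈ B.σ (map f) n
  map-σ f zero          = B.refl
  map-σ f (suc zero)    = 0#-homo
  map-σ f (suc (suc n)) = map-σ (A.tail f) n

  map-linear : ∀ a n → φ (A.linear a n) B.≈ B.linear (φ a) n
  map-linear a zero          = 0#-homo
  map-linear a (suc zero)    = B.refl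
  map-linear a (suc (suc n)) = 0#-homo

  map-fraction : ∀ {t G} → A.IsFraction t G → B.IsFraction (φ t) (map G)
  map-fraction {t} {G} p = record
    { constantTerm = B.trans (⟦⟧-cong (A.constantTerm p)) 1#-homo
    ; functional   = B.coeffs λ n → begin
        (map G B.⊗ B.scale (φ t) (map G)) n ≈⟨ B.⊗-cong-≤ n (λ _ → B.refl) (λ {i} _ → B.sym (map-scale t G i)) ⟩
        (map G B.⊗ map (A.scale t G)) n ≈⟨ B.sym (map-⊗ G (A.scale t G) n) ⟩
        φ ((G A.⊗ A.scale t G) n) ≈⟨ ⟦⟧-cong (A.at (A.functional p) n) ⟩
        φ (A.scale t G n A.+ A.linear t n) ≈⟨ +-homo _ _ ⟩
        φ (A.scale t G n) B.+ φ (A.linear t n) ≈⟨ B.+-cong (map-scale t G n) (map-linear t n) ⟩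
        B.scale (φ t) (map G) n B.+ B.linear (φ t) n ∎ }
    where open SetoidReasoning B.setoid

  map-logDerivative : ∀ {G S} → A.IsLogDerivative G S → B.IsLogDerivative (map G) (map S)
  map-logDerivative {G} {S} p = B.coeffs λ n →
    B.trans (B.sym (map-⊗ G S n)) (B.trans (⟦⟧-cong (A.at p n)) (map-θ G n))

module Quotient {c ℓ : Level} (R : CommutativeRing c ℓ) (g : CommutativeRing.Carrier R) where
  open CommutativeRing R
  open RingTools R
  open SetoidReasoning setoid

  infix 4 _∼_
  record _∼_ (x y : Carrier) : Set (c Level.⊔ ℓ) where
    constructor _by_
    field
      multiplier : Carrier
      difference : x - y ≈ g * multiplier
  open _∼_ public

  ∼-reflexive : ∀ {x y} → x ≈ y → x ∼ y
  ∼-reflexive e = 0# by trans (x≈y⇒x-y≈0 e) (sym (zeroʳ g))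

  -- Only the equality is coarsened. The projection is the identity function, and a proof of
  -- equality stores the cofactor, which later serves as a witness of divisibility.
  quotientRing : CommutativeRing c (c Level.⊔ ℓ)
  quotientRing = record
    { Carrier = Carrier ; _≈_ = _∼_ ; _+_ = _+_ ; _*_ = _*_ ; -_ = -_ ; 0# = 0# ; 1# = 1#
    ; isCommutativeRing = record
      { isRing = record
        { +-isAbelianGroup = record
          { isGroup = record
            { isMonoid = record
              { isSemigroup = record
                { isMagma = record
                  { isEquivalence = record
                    { refl  = ∼-reflexive refl
                    ; sym   = λ {x} {y} p → (- multiplier p) by (begin
                        y - x ≈⟨ solve 2 (λ x y → y :- x := :- (x :- y)) refl x y ⟩
                        - (x - y) ≈⟨ -‿cong (difference p) ⟩
                        - (g * multiplier p) ≈⟨ solve 2 (λ g c → :- (g :* c) := g :* (:- c)) refl g _ ⟩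
                        g * - multiplier p ∎)
                    ; trans = λ {x} {y} {z} p q → (multiplier p + multiplier q) by (begin
                        x - z ≈⟨ solve 3 (λ x y z → x :- z := (x :- y) :+ (y :- z)) refl x y z ⟩
                        (x - y) + (y - z) ≈⟨ +-cong (difference p) (difference q) ⟩
                        g * multiplier p + g * multiplier q ≈⟨ sym (distribˡ g _ _) ⟩
                        g * (multiplier p + multiplier q) ∎) }
                  ; ∙-cong = λ {x} {y} {u} {v} p q → (multiplier p + multiplier q) by (begin
                        (x + u) - (y + v) ≈⟨ solve 4 (λ x y u v → (x :+ u) :- (y :+ v) := (x :- y) :+ (u :- v)) refl x y u v ⟩
                        (x - y) + (u - v) ≈⟨ +-cong (difference p) (difference q) ⟩
                        g * multiplier p + g * multiplier q ≈⟨ sym (distribˡ g _ _) ⟩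
                        g * (multiplier p + multiplier q) ∎) }
                ; assoc = λ x y z → ∼-reflexive (+-assoc x y z) }
              ; identity = (λ x → ∼-reflexive (+-identityˡ x)) , (λ x → ∼-reflexive (+-identityʳ x)) }
            ; inverse = (λ x → ∼-reflexive (-‿inverseˡ x)) , (λ x → ∼-reflexive (-‿inverseʳ x))
            ; ⁻¹-cong = λ {x} {y} p → (- multiplier p) by (begin
                        - x - - y ≈⟨ solve 2 (λ x y → (:- x) :- (:- y) := :- (x :- y)) refl x y ⟩
                        - (x - y) ≈⟨ -‿cong (difference p) ⟩
                        - (g * multiplier p) ≈⟨ solve 2 (λ g c → :- (g :* c) := g :* (:- c)) refl g _ ⟩
                        g * - multiplier p ∎) }
          ; comm = λ x y → ∼-reflexive (+-comm x y) }
        ; *-cong = λ {x} {y} {u} {v} p q → (multiplier p * u + y * multiplier q) by (begin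
                        x * u - y * v ≈⟨ solve 4 (λ x y u v → x :* u :- y :* v := (x :- y) :* u :+ y :* (u :- v)) refl x y u v ⟩
                        (x - y) * u + y * (u - v) ≈⟨ +-cong (*-congʳ (difference p)) (*-congˡ (difference q)) ⟩
                        g * multiplier p * u + y * (g * multiplier q) ≈⟨ solve 5 (λ g a u y b → g :* a :* u :+ y :* (g :* b) := g :* (a :* u :+ y :* b)) refl g _ u y _ ⟩
                        g * (multiplier p * u + y * multiplier q) ∎)
        ; *-assoc = λ x y z → ∼-reflexive (*-assoc x y z)
        ; *-identity = (λ x → ∼-reflexive (*-identityˡ x)) , (λ x → ∼-reflexive (*-identityʳ x))
        ; distrib = (λ x y z → ∼-reflexive (distribˡ x y z)) , (λ x y z → ∼-reflexive (distribʳ x y z)) }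
      ; *-comm = λ x y → ∼-reflexive (*-comm x y) } }

  projection-isHom : IsHom R quotientRing (λ x → x)
  projection-isHom = record
    { isSemiringHomomorphism = record
      { isNearSemiringHomomorphism = record
        { +-isMonoidHomomorphism = record
          { isMagmaHomomorphism = record
            { isRelHomomorphism = record { cong = ∼-reflexive }
            ; homo = λ x y → ∼-reflexive refl }
          ; ε-homo = ∼-reflexive refl }
        ; *-homo = λ x y → ∼-reflexive refl }
      ; 1#-homo = ∼-reflexive refl }
    ; -‿homo = λ x → ∼-reflexive refl }

-- Roots of unity of 2-power order

parity : ∀ n → Σ ℕ λ m → (n ≡ m ℕ.+ m) ⊎ (n ≡ suc (m ℕ.+ m))
parity zero    = 0 , inj₁ ≡.refl
parity (suc n) with parity n
... | m , inj₁ e = m , inj₂ (≡.cong suc e)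
... | m , inj₂ e = suc m , inj₁ (≡.trans (≡.cong suc e) (≡.cong suc (≡.sym (ℕ.+-suc m m))))

2^1+h≡2^h+2^h : ∀ h → 2 ℕ.^ suc h ≡ 2 ℕ.^ h ℕ.+ 2 ℕ.^ h
2^1+h≡2^h+2^h h = ≡.cong (2 ℕ.^ h ℕ.+_) (ℕ.+-identityʳ _)

module TwoAdic {c ℓ : Level} (R : CommutativeRing c ℓ) where
  open CommutativeRing R
  open RingTools R
  open SetoidReasoning setoid

  two : Carrier
  two = 1# + 1#

  TwoRegular : Set _
  TwoRegular = ∀ {x} → x + x ≈ 0# → x ≈ 0#

  -- A non-zero-divisor modulo 2, the form in which Gauss's lemma is used: divisibility of a product
  -- by 2 passes to the other factor.
  Primitive : Carrier → Set _
  Primitive g = ∀ {x y} → two * y ≈ g * x → Σ Carrier λ x′ → x ≈ two * x′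

  -- Φ t j is the cyclotomic polynomial of order 2^(j+1), evaluated at t.
  Φ : Carrier → ℕ → Carrier
  Φ t j = 1# + t ^ (2 ℕ.^ j)

  nat-2^ : ∀ v → nat (2 ℕ.^ v) ≈ two ^ v
  nat-2^ zero    = +-identityʳ 1#
  nat-2^ (suc v) = trans (nat-* 2 (2 ℕ.^ v)) (*-cong (+-congˡ (+-identityʳ 1#)) (nat-2^ v))

  two^-regular : TwoRegular → ∀ v {x} → two ^ v * x ≈ 0# → x ≈ 0#
  two^-regular reg zero    e = trans (sym (*-identityˡ _)) e
  two^-regular reg (suc v) e = two^-regular reg v
    (reg (trans (solve 2 (λ p x → p :* x :+ p :* x := (:1 :+ :1) :* p :* x) refl (two ^ v) _) e))

  1^ : ∀ n → 1# ^ n ≈ 1#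
  1^ zero    = refl
  1^ (suc n) = trans (*-identityˡ _) (1^ n)

  [-1]^2m : ∀ m → (- 1#) ^ (m ℕ.+ m) ≈ 1#
  [-1]^2m m = begin
    (- 1#) ^ (m ℕ.+ m) ≈⟨ ^-homo-* (- 1#) m m ⟩
    (- 1#) ^ m * (- 1#) ^ m ≈⟨ sym (^-distrib-* (- 1#) (- 1#) m) ⟩
    (- 1# * - 1#) ^ m ≈⟨ ^-congˡ m (solve 1 (λ x → :- :1 :* :- :1 := :1) refl 1#) ⟩
    1# ^ m ≈⟨ 1^ m ⟩
    1# ∎

  -- For even k pass to ζ² and k/2; for odd k raise ζ^k x = x to the power 2^h, which gives -x = x.
  root-regular : TwoRegular → ∀ h {ζ} → ζ ^ (2 ℕ.^ h) ≈ - 1# →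
    ∀ k → 0 ℕ.< k → k ℕ.< 2 ℕ.^ suc h → ∀ {x} → ζ ^ k * x ≈ x → x ≈ 0#
  root-regular reg h {ζ} root k 0<k k<d {x} fixed with parity k
  ... | m , inj₂ ≡.refl = reg (begin
      x + x ≈⟨ +-congʳ (sym (iterated (2 ℕ.^ h))) ⟩
      (ζ ^ k) ^ (2 ℕ.^ h) * x + x ≈⟨ +-congʳ (*-congʳ power) ⟩
      - 1# * x + x ≈⟨ solve 1 (λ x → :- :1 :* x :+ x := :0) refl x ⟩
      0# ∎)
    where
    iterated : ∀ n → (ζ ^ k) ^ n * x ≈ x
    iterated zero    = *-identityˡ x
    iterated (suc n) = trans (*-assoc _ _ _) (trans (*-congˡ (iterated n)) fixed)
    power : (ζ ^ k) ^ (2 ℕ.^ h) ≈ - 1#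
    power = begin
      (ζ ^ k) ^ (2 ℕ.^ h) ≈⟨ ^-assocʳ ζ k (2 ℕ.^ h) ⟩
      ζ ^ (k ℕ.* 2 ℕ.^ h) ≡⟨ ≡.cong (ζ ^_) (ℕ.*-comm k (2 ℕ.^ h)) ⟩
      ζ ^ (2 ℕ.^ h ℕ.* k) ≈⟨ sym (^-assocʳ ζ (2 ℕ.^ h) k) ⟩
      (ζ ^ (2 ℕ.^ h)) ^ k ≈⟨ ^-congˡ k root ⟩
      - 1# * (- 1#) ^ (m ℕ.+ m) ≈⟨ *-congˡ ([-1]^2m m) ⟩
      - 1# * 1# ≈⟨ *-identityʳ _ ⟩
      - 1# ∎
  root-regular reg h root _ () k<d fixed | zero , inj₁ ≡.refl
  root-regular reg zero root _ 0<k k<d fixed | suc m , inj₁ ≡.refl =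
    ⊥-elim (ℕ.<⇒≱ k<d (s≤s (ℕ.≤-trans (s≤s z≤n) (ℕ.m≤n+m (suc m) m))))
  root-regular reg (suc h) {ζ} root _ 0<k k<d {x} fixed | suc m , inj₁ ≡.refl =
    root-regular reg h {ζ * ζ} square-root (suc m) (s≤s z≤n) half
      (trans (*-congʳ (square (suc m))) fixed)
    where
    square : ∀ n → (ζ * ζ) ^ n ≈ ζ ^ (n ℕ.+ n)
    square n = trans (^-distrib-* ζ ζ n) (sym (^-homo-* ζ n n))
    square-root : (ζ * ζ) ^ (2 ℕ.^ h) ≈ - 1#
    square-root = trans (square (2 ℕ.^ h)) (trans (reflexive (≡.cong (ζ ^_) (≡.sym (2^1+h≡2^h+2^h h)))) root)
    half : suc m ℕ.< 2 ℕ.^ suc h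
    half = ℕ.≰⇒> λ le → ℕ.<⇒≱ k<d (≡.subst (ℕ._≤ suc m ℕ.+ suc m) (≡.sym (2^1+h≡2^h+2^h (suc h))) (ℕ.+-mono-≤ le le))

-- Squaring modulo 2 and congruences modulo powers of 2

module Frobenius {c ℓ : Level} (R : CommutativeRing c ℓ) where
  open CommutativeRing R
  open RingTools R
  open TwoAdic R
  open Series R
  open SeriesEquations R
  private
    module S = CommutativeRing seriesRing
    module ST = RingTools seriesRing
  open SetoidReasoning S.setoid

  scale-σ : ∀ t f → scale t (σ f) ≋ σ (scale (t * t) f)
  scale-σ t f = coeffs λ n → trans (sym (*-identityˡ _)) (trans (go 1# f n) (at (σ-cong (coeffs λ m → *-identityˡ _)) n))
    where
    -- The factor b collects the t² produced each time `σ` skips two indices.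
    go : ∀ b f n → b * (t ^ n * σ f n) ≈ σ (b · scale (t * t) f) n
    go b f zero          = refl
    go b f (suc zero)    = solve 2 (λ b t → b :* (t :* :1 :* :0) := :0) refl b t
    go b f (suc (suc n)) =
      trans (solve 4 (λ b t p x → b :* (t :* (t :* p) :* x) := b :* (t :* t) :* (p :* x)) refl b t (t ^ n) (σ (tail f) n))
      (trans (go (b * (t * t)) (tail f) n)
        (at (σ-cong (coeffs λ m → solve 4 (λ b t p x → b :* (t :* t) :* (p :* x) := b :* (t :* t :* p :* x)) refl b t _ _)) n))

  σ-linear : ∀ a → σ (linear (a * a)) ≋ linear a ⊗ linear a
  σ-linear a = coeffs coefficient
    where
    higher : ∀ n → σ (tail (tail (linear (a * a)))) n ≈ 0#
    higher zero          = refl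
    higher (suc zero)    = refl
    higher (suc (suc n)) = vanish n
      where
      vanish : ∀ n → σ (λ _ → 0#) n ≈ 0#
      vanish zero          = refl
      vanish (suc zero)    = refl
      vanish (suc (suc n)) = vanish n
    coefficient : ∀ n → σ (linear (a * a)) n ≈ (linear a ⊗ linear a) n
    coefficient zero                = sym (zeroˡ _)
    coefficient (suc zero)          = sym (trans (linear-⊗ a (linear a) 0) (zeroʳ a))
    coefficient (suc (suc zero))    = sym (linear-⊗ a (linear a) 1)
    coefficient (suc (suc (suc zero)))    = sym (trans (linear-⊗ a (linear a) 2) (zeroʳ a))
    coefficient (suc (suc (suc (suc n)))) = trans (higher n) (sym (trans (linear-⊗ a (linear a) (suc (suc (suc n)))) (zeroʳ a)))

  private
    ⊗-zeroˡ-2 : two ≈ 0# → ∀ f → f ⊕ f ≋ S.0#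
    ⊗-zeroˡ-2 two≈0 f = coeffs λ n → trans (solve 1 (λ x → x :+ x := (:1 :+ :1) :* x) refl (f n))
                                        (trans (*-congʳ two≈0) (zeroˡ _))

  -- In characteristic 2 squaring turns the equation for parameter t into the one for t², at z².
  fraction-frobenius : two ≈ 0# → ∀ {t G G′} → IsFraction t G → IsFraction (t * t) G′ → G ⊗ G ≋ σ G′
  fraction-frobenius two≈0 {t} {G} {G′} p p′ =
    fractional-unique t (linear t ⊗ linear t)
      (trans (*-cong (constantTerm p) (constantTerm p)) (*-identityˡ 1#)) (constantTerm p′) square inflated
    where
    sG = scale t G
    l = linear t
    square : (G ⊗ G) ⊗ scale t (G ⊗ G) ≋ scale t (G ⊗ G) ⊕ l ⊗ l
    square = begin
      (G ⊗ G) ⊗ scale t (G ⊗ G) ≈⟨ S.*-congˡ {G ⊗ G} (scale-⊗ t G G) ⟩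
      (G ⊗ G) ⊗ (sG ⊗ sG) ≈⟨ ST.solve 2 (λ g s → (g ST.:* g) ST.:* (s ST.:* s) ST.:= (g ST.:* s) ST.:* (g ST.:* s)) S.refl G sG ⟩
      (G ⊗ sG) ⊗ (G ⊗ sG) ≈⟨ S.*-cong (functional p) (functional p) ⟩
      (sG ⊕ l) ⊗ (sG ⊕ l) ≈⟨ ST.solve 2 (λ s l → (s ST.:+ l) ST.:* (s ST.:+ l) ST.:= (s ST.:* s ST.:+ l ST.:* l) ST.:+ (s ST.:* l ST.:+ s ST.:* l)) S.refl sG l ⟩
      -- Characteristic 2 removes the doubled cross term.
      (sG ⊗ sG ⊕ l ⊗ l) ⊕ (sG ⊗ l ⊕ sG ⊗ l) ≈⟨ S.+-congˡ (⊗-zeroˡ-2 two≈0 (sG ⊗ l)) ⟩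
      (sG ⊗ sG ⊕ l ⊗ l) ⊕ S.0# ≈⟨ S.+-identityʳ _ ⟩
      sG ⊗ sG ⊕ l ⊗ l ≈⟨ S.+-congʳ (S.sym (scale-⊗ t G G)) ⟩
      scale t (G ⊗ G) ⊕ l ⊗ l ∎
    inflated : σ G′ ⊗ scale t (σ G′) ≋ scale t (σ G′) ⊕ l ⊗ l
    inflated = begin
      σ G′ ⊗ scale t (σ G′) ≈⟨ S.*-congˡ {σ G′} (scale-σ t G′) ⟩
      σ G′ ⊗ σ (scale (t * t) G′) ≈⟨ S.sym (σ-⊗ G′ (scale (t * t) G′)) ⟩
      σ (G′ ⊗ scale (t * t) G′) ≈⟨ σ-cong (functional p′) ⟩
      σ (scale (t * t) G′ ⊕ linear (t * t)) ≈⟨ σ-⊕ (scale (t * t) G′) (linear (t * t)) ⟩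
      σ (scale (t * t) G′) ⊕ σ (linear (t * t)) ≈⟨ S.+-cong (S.sym (scale-σ t G′)) (σ-linear t) ⟩
      scale t (σ G′) ⊕ l ⊗ l ∎

module Dwork {c ℓ : Level} (R : CommutativeRing c ℓ) where
  open CommutativeRing R
  open RingTools R
  open TwoAdic R
  open Series R
  open SeriesEquations R
  private
    module S = CommutativeRing seriesRing
    module ST = RingTools seriesRing

  private
    constant-⊗-≋ : ∀ a f → constant a ⊗ f ≋ a · f
    constant-⊗-≋ a f = coeffs (constant-⊗ a f)

    θ-constant-⊗ : ∀ a f → θ (constant a ⊗ f) ≋ constant a ⊗ θ f
    θ-constant-⊗ a f = coeffs λ n → begin
      nat n * (constant a ⊗ f) n ≈⟨ *-congˡ (constant-⊗ a f n) ⟩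
      nat n * (a * f n) ≈⟨ solve 3 (λ k a x → k :* (a :* x) := a :* (k :* x)) refl (nat n) a (f n) ⟩
      a * (nat n * f n) ≈⟨ sym (constant-⊗ a (θ f) n) ⟩
      (constant a ⊗ θ f) n ∎
      where open SetoidReasoning setoid

  -- θ log (1 + cU) / c does not change when (c, U) becomes (2c, U + (c/2)U²), since (1 + cU)² = 1 + 2c(U + (c/2)U²).
  log-rescale : ∀ Δ U → Δ ⊗ (one ⊕ (one ⊕ one) ⊗ U) ≋ θ U →
    ∀ k → Σ Ser λ W → Δ ⊗ (one ⊕ constant (two ^ suc k) ⊗ W) ≋ θ W
  log-rescale Δ U e zero = U , S.trans (S.*-congˡ {Δ} (S.+-congˡ (S.*-congʳ (coeffs eq)))) e
    where
    eq : ∀ n → constant (two ^ 1) n ≈ (one ⊕ one) n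
    eq zero    = *-identityʳ two
    eq (suc n) = sym (+-identityˡ 0#)
  log-rescale Δ U e (suc k) with log-rescale Δ U e k
  ... | W , eW = W ⊕ a ⊗ (W ⊗ W) , (begin
      Δ ⊗ (one ⊕ constant (two ^ suc (suc k)) ⊗ (W ⊕ a ⊗ (W ⊗ W)))
        ≈⟨ S.*-congˡ {Δ} (S.+-congˡ (S.*-congʳ (S.trans (double (two ^ suc k)) (S.+-cong c≋a+a c≋a+a)))) ⟩
      Δ ⊗ (one ⊕ ((a ⊕ a) ⊕ (a ⊕ a)) ⊗ (W ⊕ a ⊗ (W ⊗ W)))
        ≈⟨ ST.solve 3 (λ d a w → d ST.:* (ST.:1 ST.:+ ((a ST.:+ a) ST.:+ (a ST.:+ a)) ST.:* (w ST.:+ a ST.:* (w ST.:* w))) ST.:=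
                d ST.:* (ST.:1 ST.:+ (a ST.:+ a) ST.:* w) ST.:* (ST.:1 ST.:+ (a ST.:+ a) ST.:* w)) S.refl Δ a W ⟩
      Δ ⊗ (one ⊕ (a ⊕ a) ⊗ W) ⊗ (one ⊕ (a ⊕ a) ⊗ W)
        ≈⟨ S.*-congʳ (S.*-congˡ {Δ} (S.+-congˡ (S.*-congʳ (S.sym c≋a+a)))) ⟩
      Δ ⊗ (one ⊕ constant (two ^ suc k) ⊗ W) ⊗ (one ⊕ (a ⊕ a) ⊗ W)
        ≈⟨ S.*-congʳ eW ⟩
      θ W ⊗ (one ⊕ (a ⊕ a) ⊗ W)
        ≈⟨ ST.solve 3 (λ t a w → t ST.:* (ST.:1 ST.:+ (a ST.:+ a) ST.:* w) ST.:= t ST.:+ a ST.:* (t ST.:* w ST.:+ w ST.:* t)) S.refl (θ W) a W ⟩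
      θ W ⊕ a ⊗ (θ W ⊗ W ⊕ W ⊗ θ W)
        ≈⟨ S.+-congˡ (S.*-congˡ {a} (S.sym (θ-⊗ W W))) ⟩
      θ W ⊕ a ⊗ θ (W ⊗ W)
        ≈⟨ S.+-congˡ (S.sym (θ-constant-⊗ (two ^ k) (W ⊗ W))) ⟩
      θ W ⊕ θ (a ⊗ (W ⊗ W))
        ≈⟨ S.sym (θ-⊕ W (a ⊗ (W ⊗ W))) ⟩
      θ (W ⊕ a ⊗ (W ⊗ W)) ∎)
    where
    open SetoidReasoning S.setoid
    a = constant (two ^ k)
    double : ∀ b → constant (two * b) ≋ constant b ⊕ constant b
    double b = coeffs λ { zero → solve 1 (λ b → (:1 :+ :1) :* b := b :+ b) refl b ; (suc n) → sym (+-identityˡ 0#) }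
    c≋a+a : constant (two ^ suc k) ≋ a ⊕ a
    c≋a+a = double (two ^ k)

  -- By `log-rescale` the hypothesis may be replaced by Δ (1 + 2^v W) = θ W. At an index n divisible
  -- by 2^v, the right side is n W_n and the correction on the left is 2^v (Δ W)_n.
  2^∣log : ∀ Δ U → Δ ⊗ (one ⊕ (one ⊕ one) ⊗ U) ≋ θ U →
    ∀ v m → Σ Carrier λ q → Δ (2 ℕ.^ v ℕ.* m) ≈ two ^ v * q
  2^∣log Δ U e zero    m = _ , sym (*-identityˡ _)
  2^∣log Δ U e (suc v) m with log-rescale Δ U e v
  ... | W , eW = nat m * W n - (Δ ⊗ W) n , (begin
      Δ n
        ≈⟨ solve 2 (λ d x → d := (d :+ x) :- x) refl (Δ n) (two ^ suc v * (Δ ⊗ W) n) ⟩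
      (Δ n + two ^ suc v * (Δ ⊗ W) n) - two ^ suc v * (Δ ⊗ W) n
        ≈⟨ +-congʳ (trans (sym (at expand n)) (at eW n)) ⟩
      nat n * W n - two ^ suc v * (Δ ⊗ W) n
        ≈⟨ +-congʳ (*-congʳ (trans (nat-* (2 ℕ.^ suc v) m) (*-congʳ (nat-2^ (suc v))))) ⟩
      two ^ suc v * nat m * W n - two ^ suc v * (Δ ⊗ W) n
        ≈⟨ solve 4 (λ p k w x → p :* k :* w :- p :* x := p :* (k :* w :- x)) refl (two ^ suc v) (nat m) (W n) _ ⟩
      two ^ suc v * (nat m * W n - (Δ ⊗ W) n) ∎)
    where
    open SetoidReasoning setoid
    n = 2 ℕ.^ suc v ℕ.* m
    expand : Δ ⊗ (one ⊕ constant (two ^ suc v) ⊗ W) ≋ Δ ⊕ (two ^ suc v) · (Δ ⊗ W)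
    expand = S.trans (ST.solve 3 (λ d k w → d ST.:* (ST.:1 ST.:+ k ST.:* w) ST.:= d ST.:+ k ST.:* (d ST.:* w)) S.refl Δ (constant (two ^ suc v)) W)
                     (S.+-congˡ (constant-⊗-≋ (two ^ suc v) (Δ ⊗ W)))

  module _ (reg : TwoRegular) where
    private
      double-cancel : ∀ {f g} → f ⊕ f ≋ g ⊕ g → f ≋ g
      double-cancel {f} {g} e = coeffs λ n → x-y≈0⇒x≈y (reg
        (trans (solve 2 (λ x y → (x :- y) :+ (x :- y) := (x :+ x) :- (y :+ y)) refl (f n) (g n)) (x≈y⇒x-y≈0 (at e n))))

    -- Write G² = σH · (1 + 2U). Applying θ log gives 2S = 2σT + 2θU / (1 + 2U), where θσ = 2σθ
    -- supplies the factor in front of σT. Regularity of 2 halves this, so Δ = S - σT satisfies the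
    -- hypothesis of `2^∣log`.
    logDerivative-congruence : ∀ {G H S T} → G 0 ≈ 1# → H 0 ≈ 1# → IsLogDerivative G S → IsLogDerivative H T →
      (V : Ser) → G ⊗ G ≋ σ H ⊕ (V ⊕ V) →
      ∀ v m → Σ Carrier λ q → S (2 ℕ.^ v ℕ.* m) - σ T (2 ℕ.^ v ℕ.* m) ≈ two ^ v * q
    logDerivative-congruence {G} {H} {S} {T} G₀ H₀ pS pT V eV = 2^∣log Δ U (⊗-cancelˡ (σ H) H₀ key)
      where
      open SetoidReasoning S.setoid
      Δ = S S.- σ T
      U = proj₁ (divide (σ H) V H₀)
      HU≋V : σ H ⊗ U ≋ V
      HU≋V = proj₂ (divide (σ H) V H₀)
      P = one ⊕ (one ⊕ one) ⊗ U
      G²≋HP : G ⊗ G ≋ σ H ⊗ P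
      G²≋HP = begin
        G ⊗ G ≈⟨ eV ⟩
        σ H ⊕ (V ⊕ V) ≈⟨ S.+-congˡ (S.+-cong (S.sym HU≋V) (S.sym HU≋V)) ⟩
        σ H ⊕ (σ H ⊗ U ⊕ σ H ⊗ U) ≈⟨ ST.solve 2 (λ h u → h ST.:+ (h ST.:* u ST.:+ h ST.:* u) ST.:= h ST.:* (ST.:1 ST.:+ (ST.:1 ST.:+ ST.:1) ST.:* u)) S.refl (σ H) U ⟩
        σ H ⊗ P ∎
      θσH : θ (σ H) ≋ σ H ⊗ σ T ⊕ σ H ⊗ σ T
      θσH = begin
        θ (σ H) ≈⟨ θ-σ H ⟩
        σ (θ H) ⊕ σ (θ H) ≈⟨ S.+-cong step step ⟩
        σ H ⊗ σ T ⊕ σ H ⊗ σ T ∎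
        where
        step : σ (θ H) ≋ σ H ⊗ σ T
        step = S.trans (σ-cong (S.sym pT)) (σ-⊗ H T)
      θP : θ P ≋ θ U ⊕ θ U
      θP = begin
        θ (one ⊕ (one ⊕ one) ⊗ U) ≈⟨ θ-⊕ one _ ⟩
        θ one ⊕ θ ((one ⊕ one) ⊗ U) ≈⟨ S.+-cong (coeffs (θ-constant 1#)) (θ-cong (ST.solve 1 (λ u → (ST.:1 ST.:+ ST.:1) ST.:* u ST.:= u ST.:+ u) S.refl U)) ⟩
        S.0# ⊕ θ (U ⊕ U) ≈⟨ S.trans (S.+-identityˡ _) (θ-⊕ U U) ⟩
        θ U ⊕ θ U ∎
      doubled : (σ H ⊗ P ⊗ S) ⊕ (σ H ⊗ P ⊗ S) ≋ (σ H ⊗ P ⊗ σ T ⊕ σ H ⊗ θ U) ⊕ (σ H ⊗ P ⊗ σ T ⊕ σ H ⊗ θ U)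
      doubled = begin
        (σ H ⊗ P ⊗ S) ⊕ (σ H ⊗ P ⊗ S) ≈⟨ S.+-cong (S.*-congʳ (S.sym G²≋HP)) (S.*-congʳ (S.sym G²≋HP)) ⟩
        (G ⊗ G ⊗ S) ⊕ (G ⊗ G ⊗ S) ≈⟨ ST.solve 2 (λ g s → (g ST.:* g ST.:* s) ST.:+ (g ST.:* g ST.:* s) ST.:= g ST.:* s ST.:* g ST.:+ g ST.:* (g ST.:* s)) S.refl G S ⟩
        G ⊗ S ⊗ G ⊕ G ⊗ (G ⊗ S) ≈⟨ S.+-cong (S.*-congʳ pS) (S.*-congˡ {G} pS) ⟩
        θ G ⊗ G ⊕ G ⊗ θ G ≈⟨ S.sym (θ-⊗ G G) ⟩
        θ (G ⊗ G) ≈⟨ θ-cong G²≋HP ⟩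
        θ (σ H ⊗ P) ≈⟨ θ-⊗ (σ H) P ⟩
        θ (σ H) ⊗ P ⊕ σ H ⊗ θ P ≈⟨ S.+-cong (S.*-congʳ θσH) (S.*-congˡ {σ H} θP) ⟩
        (σ H ⊗ σ T ⊕ σ H ⊗ σ T) ⊗ P ⊕ σ H ⊗ (θ U ⊕ θ U)
          ≈⟨ ST.solve 4 (λ h t p u → (h ST.:* t ST.:+ h ST.:* t) ST.:* p ST.:+ h ST.:* (u ST.:+ u) ST.:=
                  (h ST.:* p ST.:* t ST.:+ h ST.:* u) ST.:+ (h ST.:* p ST.:* t ST.:+ h ST.:* u)) S.refl (σ H) (σ T) P (θ U) ⟩
        (σ H ⊗ P ⊗ σ T ⊕ σ H ⊗ θ U) ⊕ (σ H ⊗ P ⊗ σ T ⊕ σ H ⊗ θ U) ∎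
      key : σ H ⊗ (Δ ⊗ P) ≋ σ H ⊗ θ U
      key = begin
        σ H ⊗ (Δ ⊗ P) ≈⟨ ST.solve 4 (λ h s t p → h ST.:* ((s ST.:- t) ST.:* p) ST.:= h ST.:* p ST.:* s ST.:- h ST.:* p ST.:* t) S.refl (σ H) S (σ T) P ⟩
        σ H ⊗ P ⊗ S S.- σ H ⊗ P ⊗ σ T ≈⟨ S.+-congʳ (double-cancel doubled) ⟩
        (σ H ⊗ P ⊗ σ T ⊕ σ H ⊗ θ U) S.- σ H ⊗ P ⊗ σ T ≈⟨ ST.solve 2 (λ x y → (x ST.:+ y) ST.:- x ST.:= y) S.refl (σ H ⊗ P ⊗ σ T) (σ H ⊗ θ U) ⟩
        σ H ⊗ θ U ∎

    fraction-congruence : ∀ {t G G′ S S′} → IsFraction t G → IsFraction (t * t) G′ →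
      IsLogDerivative G S → IsLogDerivative G′ S′ →
      ∀ v m → Σ Carrier λ q → S (2 ℕ.^ v ℕ.* m) - σ S′ (2 ℕ.^ v ℕ.* m) ≈ two ^ v * q
    fraction-congruence {t} {G} {G′} p p′ pS pS′ =
      logDerivative-congruence (constantTerm p) (constantTerm p′) pS pS′ V (coeffs G²≈)
      where
      open Quotient R two
      module Q where
        open Frobenius quotientRing public
        open Series quotientRing public
      open SeriesMap R quotientRing (λ x → x) projection-isHom
      two∼0 : two ∼ 0#
      two∼0 = 1# by solve 1 (λ x → (:1 :+ :1) :- :0 := (:1 :+ :1) :* :1) refl 0#
      frobenius = Q.fraction-frobenius two∼0 (map-fraction p) (map-fraction p′)
      same : ∀ n → (G ⊗ G) n ∼ σ G′ n
      same n = CommutativeRing.trans quotientRing (map-⊗ G G n)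
        (CommutativeRing.trans quotientRing (Q.at frobenius n) (CommutativeRing.sym quotientRing (map-σ G′ n)))
      -- Half the difference G² - σG′, read off from the congruence modulo 2.
      V : Ser
      V n = multiplier (same n)
      G²≈ : ∀ n → (G ⊗ G) n ≈ σ G′ n + (V n + V n)
      G²≈ n = begin
        (G ⊗ G) n ≈⟨ solve 2 (λ x y → x := y :+ (x :- y)) refl _ (σ G′ n) ⟩
        σ G′ n + ((G ⊗ G) n - σ G′ n) ≈⟨ +-congˡ (difference (same n)) ⟩
        σ G′ n + two * V n ≈⟨ +-congˡ (solve 1 (λ x → (:1 :+ :1) :* x := x :+ x) refl (V n)) ⟩
        σ G′ n + (V n + V n) ∎
        where open SetoidReasoning setoid

-- The norm of the continued fraction at a root of unity

triangle : ℕ → ℕ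
triangle zero    = 0
triangle (suc k) = suc k ℕ.+ triangle k

-- This is the exponent of ζ in the determinant after 2m steps. With ζ^m = -1 the power of ζ is
-- (-1)^(2m+1) = -1.
triangle-even : ∀ m → triangle (m ℕ.+ m) ≡ m ℕ.* suc (m ℕ.+ m)
triangle-even zero    = ≡.refl
triangle-even (suc m) = ≡.trans (≡.cong triangle (≡.cong suc (ℕ.+-suc m m)))
  (≡.trans (≡.cong (λ k → suc (suc (m ℕ.+ m)) ℕ.+ (suc (m ℕ.+ m) ℕ.+ k)) (triangle-even m))
    (≡.trans (ℕS.solve 1 (λ m → (ℕS.con 2 ℕS.:+ (m ℕS.:+ m)) ℕS.:+ ((ℕS.con 1 ℕS.:+ (m ℕS.:+ m)) ℕS.:+ m ℕS.:* (ℕS.con 1 ℕS.:+ (m ℕS.:+ m)))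
        ℕS.:= (ℕS.con 1 ℕS.:+ m) ℕS.:* (ℕS.con 3 ℕS.:+ (m ℕS.:+ m))) ≡.refl m)
      (≡.cong (λ k → suc m ℕ.* suc (suc k)) (≡.sym (ℕ.+-suc m m)))))

module RootOfUnity {c ℓ : Level} (R : CommutativeRing c ℓ) where
  open CommutativeRing R
  open RingTools R
  open TwoAdic R
  open Series R
  open SeriesEquations R
  private
    module S = CommutativeRing seriesRing
    module ST = RingTools seriesRing

  scale-1 : ∀ f → scale 1# f ≋ f
  scale-1 f = coeffs λ n → trans (*-congʳ (1^ n)) (*-identityˡ _)

  -- The substitution z ↦ z^(2^J).
  dilate : ℕ → Ser → Ser
  dilate zero    f = f
  dilate (suc J) f = dilate J (σ f)

  dilate-⊗ : ∀ J f g → dilate J (f ⊗ g) ≋ dilate J f ⊗ dilate J g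
  dilate-cong : ∀ J {f g} → f ≋ g → dilate J f ≋ dilate J g
  dilate-cong zero    e = e
  dilate-cong (suc J) e = dilate-cong J (σ-cong e)
  dilate-⊗ zero    f g = S.refl
  dilate-⊗ (suc J) f g = S.trans (dilate-cong J (σ-⊗ f g)) (dilate-⊗ J (σ f) (σ g))

  dilate-⊕ : ∀ J f g → dilate J (f ⊕ g) ≋ dilate J f ⊕ dilate J g
  dilate-⊕ zero    f g = S.refl
  dilate-⊕ (suc J) f g = S.trans (dilate-cong J (σ-⊕ f g)) (dilate-⊕ J (σ f) (σ g))

  dilate-0 : ∀ J f → dilate J f 0 ≡ f 0
  dilate-0 zero    f = ≡.refl
  dilate-0 (suc J) f = dilate-0 J (σ f)

  dilate-multiple : ∀ J f m → dilate J f (2 ℕ.^ J ℕ.* m) ≡ f m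
  dilate-multiple zero    f m = ≡.cong f (ℕ.+-identityʳ m)
  dilate-multiple (suc J) f m = ≡.trans (≡.cong (dilate J (σ f)) index)
                                        (≡.trans (dilate-multiple J (σ f) (m ℕ.+ m)) (σ-double f m))
    where
    index : 2 ℕ.^ suc J ℕ.* m ≡ 2 ℕ.^ J ℕ.* (m ℕ.+ m)
    index = ℕS.solve 2 (λ p m → (ℕS.con 2 ℕS.:* p) ℕS.:* m ℕS.:= p ℕS.:* (m ℕS.:+ m)) ≡.refl (2 ℕ.^ J) m

  θ-dilate : ∀ J f → θ (dilate J f) ≋ (two ^ J) · dilate J (θ f)
  θ-dilate zero    f = coeffs λ n → sym (*-identityˡ _)
  θ-dilate (suc J) f = coeffs λ n → begin
      θ (dilate J (σ f)) n ≈⟨ at (θ-dilate J (σ f)) n ⟩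
      two ^ J * dilate J (θ (σ f)) n ≈⟨ *-congˡ (at (dilate-cong J (θ-σ f)) n) ⟩
      two ^ J * dilate J (σ (θ f) ⊕ σ (θ f)) n ≈⟨ *-congˡ (at (dilate-⊕ J (σ (θ f)) (σ (θ f))) n) ⟩
      two ^ J * (dilate J (σ (θ f)) n + dilate J (σ (θ f)) n) ≈⟨ solve 2 (λ p x → p :* (x :+ x) := (:1 :+ :1) :* p :* x) refl (two ^ J) _ ⟩
      two ^ suc J * dilate J (σ (θ f)) n ∎
    where open SetoidReasoning setoid

  Z : Ser
  Z = linear 1#

  Z^-below : ∀ k {n} → n ℕ.< k → (Z ST.^ k) n ≈ 0#
  Z^-below (suc k) {zero}  _         = zeroˡ _
  Z^-below (suc k) {suc n} (s≤s n<k) = trans (linear-⊗ 1# (Z ST.^ k) n) (trans (*-congˡ (Z^-below k n<k)) (zeroʳ _))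

  Z^2^J : ∀ J → Z ST.^ (2 ℕ.^ J) ≋ dilate J Z
  Z^2^J zero    = S.*-identityʳ Z
  Z^2^J (suc J) = begin
      Z ST.^ (2 ℕ.^ suc J) ≡⟨ ≡.cong (Z ST.^_) (2^1+h≡2^h+2^h J) ⟩
      Z ST.^ (2 ℕ.^ J ℕ.+ 2 ℕ.^ J) ≈⟨ ST.^-homo-* Z (2 ℕ.^ J) (2 ℕ.^ J) ⟩
      Z ST.^ (2 ℕ.^ J) ⊗ Z ST.^ (2 ℕ.^ J) ≈⟨ S.*-cong (Z^2^J J) (Z^2^J J) ⟩
      dilate J Z ⊗ dilate J Z ≈⟨ S.sym (dilate-⊗ J Z Z) ⟩
      dilate J (Z ⊗ Z) ≈⟨ dilate-cong J (S.sym Z²) ⟩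
      dilate J (σ Z) ∎
    where
    open SetoidReasoning S.setoid
    Z² : σ Z ≋ Z ⊗ Z
    Z² = S.trans (σ-cong (coeffs λ { zero → refl ; (suc zero) → sym (*-identityˡ 1#) ; (suc (suc n)) → refl }))
                 (Frobenius.σ-linear R 1#)

  DegreeAtMost : ℕ → Ser → Set ℓ
  DegreeAtMost d f = ∀ {n} → d ℕ.< n → f n ≈ 0#

  degree-linear-⊗ : ∀ a {d f} → DegreeAtMost d f → DegreeAtMost (suc d) (linear a ⊗ f)
  degree-linear-⊗ a deg {suc n} (s≤s d<n) = trans (linear-⊗ a _ n) (trans (*-congˡ (deg d<n)) (zeroʳ a))

  degree-⊕ : ∀ {d f g} → DegreeAtMost d f → DegreeAtMost d g → DegreeAtMost d (f ⊕ g)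
  degree-⊕ p q d<n = trans (+-cong (p d<n) (q d<n)) (+-identityˡ 0#)

  degree-suc : ∀ {d f} → DegreeAtMost d f → DegreeAtMost (suc d) f
  degree-suc p d<n = p (ℕ.<-trans (ℕ.n<1+n _) d<n)

  module Continuants (ζ : Carrier) where

    step : ℕ → Ser
    step k = linear (ζ ^ suc k)

    -- The vector (U, V) starts at (x, y), and step k applies the transfer matrix with rows (1, 1)
    -- and (ζ^(k+1) z, 0), which encodes G(ζ^k z) = 1 + ζ^(k+1) z / G(ζ^(k+1) z).
    U V : Ser → Ser → ℕ → Ser
    U x y zero    = x
    U x y (suc k) = U x y k ⊕ V x y k
    V x y zero    = y
    V x y (suc k) = step k ⊗ U x y k

    -- A factor z enters through V and reaches U one step later, so the degree grows by at most one
    -- in two steps. After d = 2M steps it is at most M, below d.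
    continuant-degree : ∀ x y → DegreeAtMost 0 x → DegreeAtMost 0 y →
      ∀ m → DegreeAtMost m (U x y (m ℕ.+ m)) × DegreeAtMost m (V x y (m ℕ.+ m))
    continuant-degree x y p q zero    = p , q
    continuant-degree x y p q (suc m) =
      ≡.subst (λ k → DegreeAtMost (suc m) (U x y (suc k)) × DegreeAtMost (suc m) (V x y (suc k))) (≡.sym (ℕ.+-suc m m))
        ( degree-⊕ (degree-⊕ (degree-suc (proj₁ ih)) (degree-suc (proj₂ ih))) (degree-linear-⊗ _ (proj₁ ih))
        , degree-linear-⊗ _ (degree-⊕ (proj₁ ih) (proj₂ ih)) )
      where ih = continuant-degree x y p q m

    det : ℕ → Ser
    det k = U one S.0# k ⊗ V S.0# one k S.- U S.0# one k ⊗ V one S.0# k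

    det-step : ∀ k → det (suc k) ≋ S.- (step k ⊗ det k)
    det-step k = ST.solve 5 (λ u v u′ v′ l → (u ST.:+ v) ST.:* (l ST.:* u′) ST.:- (u′ ST.:+ v′) ST.:* (l ST.:* u)
        ST.:= ST.:- (l ST.:* (u ST.:* v′ ST.:- u′ ST.:* v)))
      S.refl (U one S.0# k) (V one S.0# k) (U S.0# one k) (V S.0# one k) (step k)

    -- Step k multiplies the determinant by -ζ^(k+1) z, hence the sign and the triangular exponent.
    det-closed : ∀ k → det k ≋ ((- 1#) ^ k * ζ ^ triangle k) · (Z ST.^ k)
    det-closed zero    = S.trans (ST.solve 1 (λ x → ST.:1 ST.:* ST.:1 ST.:- ST.:0 ST.:* ST.:0 ST.:= ST.:1) S.refl one)
                                 (coeffs λ n → solve 1 (λ x → x := :1 :* :1 :* x) refl _)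
    det-closed (suc k) = S.trans (det-step k) (coeffs coefficient)
      where
      e = (- 1#) ^ k * ζ ^ triangle k
      coefficient : ∀ n → - (step k ⊗ det k) n ≈ (- 1# * (- 1#) ^ k * ζ ^ triangle (suc k)) * (Z ⊗ (Z ST.^ k)) n
      coefficient zero    = solve 3 (λ x y w → :- (:0 :* x) := w :* (:0 :* y)) refl _ _ _
      coefficient (suc n) = begin
        - (step k ⊗ det k) (suc n) ≈⟨ -‿cong (linear-⊗ (ζ ^ suc k) (det k) n) ⟩
        - (ζ ^ suc k * det k n) ≈⟨ -‿cong (*-congˡ (at (det-closed k) n)) ⟩
        - (ζ ^ suc k * (e * (Z ST.^ k) n))
          ≈⟨ solve 4 (λ a s t x → :- (a :* (s :* t :* x)) := (:- :1 :* s :* (a :* t)) :* (:1 :* x)) refl (ζ ^ suc k) ((- 1#) ^ k) (ζ ^ triangle k) _ ⟩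
        (- 1# * (- 1#) ^ k * (ζ ^ suc k * ζ ^ triangle k)) * (1# * (Z ST.^ k) n)
          ≈⟨ *-cong (*-congˡ (sym (^-homo-* ζ (suc k) (triangle k)))) (sym (linear-⊗ 1# (Z ST.^ k) n)) ⟩
        (- 1# * (- 1#) ^ k * ζ ^ triangle (suc k)) * (Z ⊗ (Z ST.^ k)) (suc n) ∎
        where open SetoidReasoning setoid

    module _ {G : Ser} (isFraction : IsFraction ζ G) where

      shifted : ℕ → Ser
      shifted k = scale (ζ ^ k) G

      norm : ℕ → Ser
      norm zero    = one
      norm (suc k) = norm k ⊗ shifted k

      shifted-functional : ∀ k → shifted k ⊗ shifted (suc k) ≋ shifted (suc k) ⊕ step k
      shifted-functional k = begin
          shifted k ⊗ shifted (suc k) ≈⟨ S.*-congˡ {shifted k} (S.sym shift) ⟩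
          shifted k ⊗ scale (ζ ^ k) (scale ζ G) ≈⟨ S.sym (scale-⊗ (ζ ^ k) G (scale ζ G)) ⟩
          scale (ζ ^ k) (G ⊗ scale ζ G) ≈⟨ scale-cong (ζ ^ k) (functional isFraction) ⟩
          scale (ζ ^ k) (scale ζ G ⊕ linear ζ) ≈⟨ scale-⊕ (ζ ^ k) (scale ζ G) (linear ζ) ⟩
          scale (ζ ^ k) (scale ζ G) ⊕ scale (ζ ^ k) (linear ζ) ≈⟨ S.+-cong shift (S.trans (scale-linear (ζ ^ k) ζ) linear-comm) ⟩
          shifted (suc k) ⊕ step k ∎
        where
        open SetoidReasoning S.setoid
        shift : scale (ζ ^ k) (scale ζ G) ≋ shifted (suc k)
        shift = S.trans (scale-scale (ζ ^ k) ζ G) (scale-base G (*-comm _ _))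
        linear-comm : linear (ζ ^ k * ζ) ≋ step k
        linear-comm = coeffs λ { zero → refl ; (suc zero) → *-comm _ _ ; (suc (suc n)) → refl }

      -- The multiplier p selects the starting vector: p = 1 starts at (1, 0) and p = 1/G at (0, 1).
      -- The two cases together give both columns of the matrix product.
      continuant-norm : ∀ p x y → p ⊗ shifted 0 ≋ x ⊗ shifted 0 ⊕ y →
        ∀ k → p ⊗ norm k ⊗ shifted k ≋ U x y k ⊗ shifted k ⊕ V x y k
      continuant-norm p x y e zero    = S.trans (S.*-congʳ (S.*-identityʳ p)) e
      continuant-norm p x y e (suc k) = begin
          p ⊗ (norm k ⊗ shifted k) ⊗ shifted (suc k)
            ≈⟨ S.*-congʳ (S.sym (S.*-assoc p (norm k) (shifted k))) ⟩
          p ⊗ norm k ⊗ shifted k ⊗ shifted (suc k)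
            ≈⟨ S.*-congʳ (continuant-norm p x y e k) ⟩
          (U x y k ⊗ shifted k ⊕ V x y k) ⊗ shifted (suc k)
            ≈⟨ ST.solve 4 (λ u g v h → (u ST.:* g ST.:+ v) ST.:* h ST.:= u ST.:* (g ST.:* h) ST.:+ v ST.:* h) S.refl (U x y k) (shifted k) (V x y k) (shifted (suc k)) ⟩
          U x y k ⊗ (shifted k ⊗ shifted (suc k)) ⊕ V x y k ⊗ shifted (suc k)
            ≈⟨ S.+-congʳ (S.*-congˡ {U x y k} (shifted-functional k)) ⟩
          U x y k ⊗ (shifted (suc k) ⊕ step k) ⊕ V x y k ⊗ shifted (suc k)
            ≈⟨ ST.solve 4 (λ u v h l → u ST.:* (h ST.:+ l) ST.:+ v ST.:* h ST.:= (u ST.:+ v) ST.:* h ST.:+ l ST.:* u) S.refl (U x y k) (V x y k) (shifted (suc k)) (step k) ⟩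
          (U x y k ⊕ V x y k) ⊗ shifted (suc k) ⊕ step k ⊗ U x y k ∎
        where open SetoidReasoning S.setoid

      norm-0 : ∀ k → norm k 0 ≈ 1#
      norm-0 zero    = refl
      norm-0 (suc k) = trans (*-cong (norm-0 k) (trans (*-identityˡ _) (constantTerm isFraction))) (*-identityˡ 1#)

      -- Passing from z to ζz shifts the window of factors by one. At k = d the factor gained equals
      -- the factor lost, so the full norm is invariant.
      scale-norm : ∀ k → shifted 0 ⊗ scale ζ (norm k) ≋ norm k ⊗ shifted k
      scale-norm zero    = S.trans (S.*-congˡ {shifted 0} (coeffs λ { zero → *-identityˡ 1# ; (suc n) → zeroʳ _ })) (S.*-comm (shifted 0) one)
      scale-norm (suc k) = begin
          shifted 0 ⊗ scale ζ (norm k ⊗ shifted k) ≈⟨ S.*-congˡ {shifted 0} (scale-⊗ ζ (norm k) (shifted k)) ⟩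
          shifted 0 ⊗ (scale ζ (norm k) ⊗ scale ζ (shifted k)) ≈⟨ S.sym (S.*-assoc (shifted 0) (scale ζ (norm k)) (scale ζ (shifted k))) ⟩
          shifted 0 ⊗ scale ζ (norm k) ⊗ scale ζ (shifted k) ≈⟨ S.*-cong (scale-norm k) (scale-scale ζ (ζ ^ k) G) ⟩
          norm k ⊗ shifted k ⊗ shifted (suc k) ∎
        where open SetoidReasoning S.setoid

      logSum : Ser → ℕ → Ser
      logSum T zero    = S.0#
      logSum T (suc k) = logSum T k ⊕ scale (ζ ^ k) T

      norm-logDerivative : ∀ {T} → IsLogDerivative G T → ∀ k → IsLogDerivative (norm k) (logSum T k)
      norm-logDerivative {T} pT zero    = S.trans (S.*-identityˡ S.0#) (S.sym (coeffs (θ-constant 1#)))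
      norm-logDerivative {T} pT (suc k) = begin
          norm k ⊗ shifted k ⊗ (logSum T k ⊕ scale (ζ ^ k) T)
            ≈⟨ ST.solve 4 (λ n s l t → n ST.:* s ST.:* (l ST.:+ t) ST.:= n ST.:* l ST.:* s ST.:+ n ST.:* (s ST.:* t)) S.refl (norm k) (shifted k) (logSum T k) (scale (ζ ^ k) T) ⟩
          norm k ⊗ logSum T k ⊗ shifted k ⊕ norm k ⊗ (shifted k ⊗ scale (ζ ^ k) T)
            ≈⟨ S.+-cong (S.*-congʳ (norm-logDerivative pT k)) (S.*-congˡ {norm k} shifted-log) ⟩
          θ (norm k) ⊗ shifted k ⊕ norm k ⊗ θ (shifted k)
            ≈⟨ S.sym (θ-⊗ (norm k) (shifted k)) ⟩
          θ (norm k ⊗ shifted k) ∎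
        where
        open SetoidReasoning S.setoid
        shifted-log : shifted k ⊗ scale (ζ ^ k) T ≋ θ (shifted k)
        shifted-log = S.trans (S.sym (scale-⊗ (ζ ^ k) G T)) (S.trans (scale-cong (ζ ^ k) pT)
          (coeffs λ n → solve 3 (λ a b x → a :* (b :* x) := b :* (a :* x)) refl _ (nat n) (G n)))

      -- All conjugate summands agree at an index n with ζ^n = 1, so there the logarithmic
      -- derivative of the norm has coefficient d S_n.
      logSum-fixed : ∀ T n → ζ ^ n ≈ 1# → ∀ k → logSum T k n ≈ nat k * T n
      logSum-fixed T n e zero    = sym (zeroˡ _)
      logSum-fixed T n e (suc k) = begin
          logSum T k n + (ζ ^ k) ^ n * T n ≈⟨ +-cong (logSum-fixed T n e k) (*-congʳ power) ⟩
          nat k * T n + 1# * T n ≈⟨ solve 2 (λ k x → k :* x :+ :1 :* x := (:1 :+ k) :* x) refl (nat k) (T n) ⟩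
          nat (suc k) * T n ∎
        where
        open SetoidReasoning setoid
        power : (ζ ^ k) ^ n ≈ 1#
        power = trans (^-assocʳ ζ k n) (trans (reflexive (≡.cong (ζ ^_) (ℕ.*-comm k n)))
                  (trans (sym (^-assocʳ ζ n k)) (trans (^-congˡ k e) (1^ k))))

      module _ (reg : TwoRegular) (h : ℕ) (root : ζ ^ (2 ℕ.^ h) ≈ - 1#) where
        private
          M = 2 ℕ.^ h
          d = M ℕ.+ M
          d≡2^1+h : d ≡ 2 ℕ.^ suc h
          d≡2^1+h = ≡.sym (2^1+h≡2^h+2^h h)
          N = norm d
          instance
            M≢0 : ℕ.NonZero M
            M≢0 = ℕ.m^n≢0 2 h
          0<M : 0 ℕ.< M
          0<M = ℕ.>-nonZero⁻¹ M
          M<d : M ℕ.< d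
          M<d = ℕ.m<m+n M 0<M

        ζ^d≈1 : ζ ^ d ≈ 1#
        ζ^d≈1 = trans (^-homo-* ζ M M) (trans (*-cong root root)
                  (solve 1 (λ x → :- :1 :* :- :1 := :1) refl 1#))

        shifted-d : shifted d ≋ shifted 0
        shifted-d = scale-base G ζ^d≈1

        G₀ : shifted 0 0 ≈ 1#
        G₀ = trans (*-identityˡ _) (constantTerm isFraction)

        norm-invariant : scale ζ N ≋ N
        norm-invariant = ⊗-cancelˡ (shifted 0) G₀ (S.trans (scale-norm d)
                           (S.trans (S.*-congˡ {N} shifted-d) (S.*-comm N (shifted 0))))

        -- Invariance under z ↦ ζz says ζ^k N_k = N_k, and `root-regular` turns this into N_k = 0
        -- for 0 < k < d. Thus N is 1 modulo z^d.
        norm-gap : ∀ {k} → k ℕ.< d → N k ≈ one k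
        norm-gap {zero}  _   = norm-0 d
        norm-gap {suc k} k<d = root-regular reg h root (suc k) (s≤s z≤n)
                                 (≡.subst (suc k ℕ.<_) d≡2^1+h k<d) (at norm-invariant (suc k))

        det-d : ∀ n → det d n ≈ - (Z ST.^ d) n
        det-d n = begin
            det d n ≈⟨ at (det-closed d) n ⟩
            ((- 1#) ^ d * ζ ^ triangle d) * (Z ST.^ d) n ≈⟨ *-congʳ (*-cong ([-1]^2m M) sign) ⟩
            (1# * - 1#) * (Z ST.^ d) n ≈⟨ solve 1 (λ x → (:1 :* :- :1) :* x := :- x) refl _ ⟩
            - (Z ST.^ d) n ∎
          where
          open SetoidReasoning setoid
          sign : ζ ^ triangle d ≈ - 1#
          sign = begin
            ζ ^ triangle d ≡⟨ ≡.cong (ζ ^_) (triangle-even M) ⟩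
            ζ ^ (M ℕ.* suc d) ≈⟨ sym (^-assocʳ ζ M (suc d)) ⟩
            (ζ ^ M) ^ suc d ≈⟨ ^-congˡ (suc d) root ⟩
            - 1# * (- 1#) ^ d ≈⟨ *-congˡ ([-1]^2m M) ⟩
            - 1# * 1# ≈⟨ *-identityʳ _ ⟩
            - 1# ∎

        trace : Ser
        trace = U one S.0# d ⊕ V S.0# one d

        -- With g = G(z), the two columns give N g = u g + v and N = u′ g + w, so N is an eigenvalue
        -- of the matrix with entries u, v, u′, w. Eliminating g leaves the characteristic equation.
        cayley-hamilton : N ⊗ N ≋ trace ⊗ N S.- det d
        cayley-hamilton = begin
            N ⊗ N
              ≈⟨ ST.solve 2 (λ n w → n ST.:* n ST.:= n ST.:* (n ST.:- w) ST.:+ n ST.:* w) S.refl N w ⟩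
            N ⊗ (N S.- w) ⊕ N ⊗ w
              ≈⟨ S.+-congʳ (S.*-congˡ {N} N-w) ⟩
            N ⊗ (u′ ⊗ g) ⊕ N ⊗ w
              ≈⟨ ST.solve 4 (λ n u g w → n ST.:* (u ST.:* g) ST.:+ n ST.:* w ST.:= u ST.:* (n ST.:* g) ST.:+ n ST.:* w) S.refl N u′ g w ⟩
            u′ ⊗ (N ⊗ g) ⊕ N ⊗ w
              ≈⟨ S.+-congʳ (S.*-congˡ {u′} first) ⟩
            u′ ⊗ (u ⊗ g ⊕ v) ⊕ N ⊗ w
              ≈⟨ ST.solve 6 (λ n u g v u′ w → u′ ST.:* (u ST.:* g ST.:+ v) ST.:+ n ST.:* w ST.:= u ST.:* (u′ ST.:* g) ST.:+ (u′ ST.:* v ST.:+ n ST.:* w)) S.refl N u g v u′ w ⟩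
            u ⊗ (u′ ⊗ g) ⊕ (u′ ⊗ v ⊕ N ⊗ w)
              ≈⟨ S.+-congʳ (S.*-congˡ {u} (S.sym N-w)) ⟩
            u ⊗ (N S.- w) ⊕ (u′ ⊗ v ⊕ N ⊗ w)
              ≈⟨ ST.solve 5 (λ n u v u′ w → u ST.:* (n ST.:- w) ST.:+ (u′ ST.:* v ST.:+ n ST.:* w) ST.:= (u ST.:+ w) ST.:* n ST.:- (u ST.:* w ST.:- u′ ST.:* v)) S.refl N u v u′ w ⟩
            trace ⊗ N S.- det d ∎
          where
          open SetoidReasoning S.setoid
          g = shifted 0
          u = U one S.0# d
          v = V one S.0# d
          u′ = U S.0# one d
          w = V S.0# one d
          inverse = divide g one G₀
          p = proj₁ inverse
          first : N ⊗ g ≋ u ⊗ g ⊕ v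
          first = begin
            N ⊗ g ≈⟨ S.*-cong (S.sym (S.*-identityˡ N)) (S.sym shifted-d) ⟩
            one ⊗ N ⊗ shifted d ≈⟨ continuant-norm one one S.0# (S.sym (S.+-identityʳ _)) d ⟩
            u ⊗ shifted d ⊕ v ≈⟨ S.+-congʳ (S.*-congˡ {u} shifted-d) ⟩
            u ⊗ g ⊕ v ∎
          second : N ≋ u′ ⊗ g ⊕ w
          second = begin
            N ≈⟨ S.sym (S.*-identityˡ N) ⟩
            one ⊗ N ≈⟨ S.*-congʳ (S.sym (proj₂ inverse)) ⟩
            g ⊗ p ⊗ N ≈⟨ ST.solve 3 (λ g p n → g ST.:* p ST.:* n ST.:= p ST.:* n ST.:* g) S.refl g p N ⟩
            p ⊗ N ⊗ g ≈⟨ S.*-congˡ {p ⊗ N} (S.sym shifted-d) ⟩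
            p ⊗ N ⊗ shifted d ≈⟨ continuant-norm p S.0# one initial d ⟩
            u′ ⊗ shifted d ⊕ w ≈⟨ S.+-congʳ (S.*-congˡ {u′} shifted-d) ⟩
            u′ ⊗ g ⊕ w ∎
            where
            initial : p ⊗ g ≋ S.0# ⊗ g ⊕ one
            initial = S.trans (S.*-comm p g) (S.trans (proj₂ inverse)
                      (ST.solve 1 (λ g → ST.:1 ST.:= ST.:0 ST.:* g ST.:+ ST.:1) S.refl g))
          N-w : N S.- w ≋ u′ ⊗ g
          N-w = S.trans (S.+-congʳ second) (ST.solve 2 (λ x w → (x ST.:+ w) ST.:- w ST.:= x) S.refl (u′ ⊗ g) w)

        -- Below degree d, N is 1 and the determinant vanishes, so the characteristic equation
        -- itself reads trace = 1. From degree d on, the bound M < d on the degree makes the trace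
        -- zero.
        trace≋one : trace ≋ one
        trace≋one = coeffs λ n → coefficient n (ℕ.<-≤-connex n d)
          where
          coefficient : ∀ n → (n ℕ.< d) ⊎ (d ℕ.≤ n) → trace n ≈ one n
          coefficient n (inj₁ n<d) = begin
              trace n ≈⟨ sym (trans (⊗-comm trace one n) (⊗-identityˡ trace n)) ⟩
              (trace ⊗ one) n ≈⟨ ⊗-cong-≤ n (λ _ → refl) (λ i≤n → sym (gap i≤n)) ⟩
              (trace ⊗ N) n ≈⟨ solve 2 (λ x y → x := (x :- y) :+ y) refl _ (det d n) ⟩
              ((trace ⊗ N) n - det d n) + det d n ≈⟨ +-cong (sym (at cayley-hamilton n)) (trans (det-d n) (-‿cong (Z^-below d n<d))) ⟩
              (N ⊗ N) n - 0# ≈⟨ solve 1 (λ x → x :- :0 := x) refl _ ⟩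
              (N ⊗ N) n ≈⟨ ⊗-cong-≤ n gap gap ⟩
              (one ⊗ one) n ≈⟨ ⊗-identityˡ one n ⟩
              one n ∎
            where
            open SetoidReasoning setoid
            gap : ∀ {i} → i ℕ.≤ n → N i ≈ one i
            gap i≤n = norm-gap (ℕ.≤-<-trans i≤n n<d)
          coefficient (suc n) (inj₂ d≤n) = degree-⊕ {M} {U one S.0# d} {V S.0# one d}
            (proj₁ (continuant-degree one S.0# one-degree (λ _ → refl) M))
            (proj₂ (continuant-degree S.0# one (λ _ → refl) one-degree M)) (ℕ.<-≤-trans M<d d≤n)
            where
            one-degree : DegreeAtMost 0 one
            one-degree {suc n} _ = refl
          coefficient zero (inj₂ d≤0) = ⊥-elim (ℕ.<⇒≱ (ℕ.<-trans 0<M M<d) d≤0)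

        -- At parameter 1 the fraction satisfies H² = H + z. Hence H(z^d) and N both solve X² = X +
        -- z^d with constant term 1, and `fractional-unique` applies with u = 1.
        norm≋dilate : ∀ {H} → IsFraction 1# H → N ≋ dilate (suc h) H
        norm≋dilate {H} pH = fractional-unique 1# (dilate (suc h) Z) (norm-0 d)
            (trans (reflexive (dilate-0 (suc h) H)) (constantTerm pH)) quadratic dilated
          where
          open SetoidReasoning S.setoid
          quadratic : N ⊗ scale 1# N ≋ scale 1# N ⊕ dilate (suc h) Z
          quadratic = begin
            N ⊗ scale 1# N ≈⟨ S.*-congˡ {N} (scale-1 N) ⟩
            N ⊗ N ≈⟨ cayley-hamilton ⟩
            trace ⊗ N S.- det d ≈⟨ S.+-cong (S.trans (S.*-congʳ trace≋one) (S.*-identityˡ N)) (coeffs λ n → trans (-‿cong (det-d n)) (solve 1 (λ x → :- (:- x) := x) refl _)) ⟩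
            N ⊕ Z ST.^ d ≡⟨ ≡.cong (λ k → N ⊕ Z ST.^ k) d≡2^1+h ⟩
            N ⊕ Z ST.^ (2 ℕ.^ suc h) ≈⟨ S.+-cong (S.sym (scale-1 N)) (Z^2^J (suc h)) ⟩
            scale 1# N ⊕ dilate (suc h) Z ∎
          dilated : dilate (suc h) H ⊗ scale 1# (dilate (suc h) H) ≋ scale 1# (dilate (suc h) H) ⊕ dilate (suc h) Z
          dilated = begin
            dilate (suc h) H ⊗ scale 1# (dilate (suc h) H) ≈⟨ S.*-congˡ {dilate (suc h) H} (scale-1 _) ⟩
            dilate (suc h) H ⊗ dilate (suc h) H ≈⟨ S.sym (dilate-⊗ (suc h) H H) ⟩
            dilate (suc h) (H ⊗ H) ≈⟨ dilate-cong (suc h) (S.trans (S.*-congˡ {H} (S.sym (scale-1 H))) (S.trans (functional pH) (S.+-congʳ (scale-1 H)))) ⟩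
            dilate (suc h) (H ⊕ Z) ≈⟨ dilate-⊕ (suc h) H Z ⟩
            dilate (suc h) H ⊕ dilate (suc h) Z ≈⟨ S.+-congʳ (S.sym (scale-1 _)) ⟩
            scale 1# (dilate (suc h) H) ⊕ dilate (suc h) Z ∎

        -- Compares θ log of both sides of N = H(z^d) at n = dm: one side is d S_n, the other d T_m
        -- by the chain rule, and d is a power of 2, which cancels by regularity.
        logDerivative-at-root : ∀ {H S T} → IsFraction 1# H → IsLogDerivative G S → IsLogDerivative H T →
          ∀ m → S (2 ℕ.^ suc h ℕ.* m) ≈ T m
        logDerivative-at-root {H} {S} {T} pH pS pT m = x-y≈0⇒x≈y (two^-regular reg (suc h) (begin
            two ^ suc h * (S n - T m) ≈⟨ solve 3 (λ p s t → p :* (s :- t) := p :* s :- p :* t) refl (two ^ suc h) (S n) (T m) ⟩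
            two ^ suc h * S n - two ^ suc h * T m ≈⟨ x≈y⇒x-y≈0 equal ⟩
            0# ∎))
          where
          open SetoidReasoning setoid
          n = 2 ℕ.^ suc h ℕ.* m
          dilated-log : IsLogDerivative (dilate (suc h) H) ((two ^ suc h) · dilate (suc h) T)
          dilated-log = coeffs λ k → begin
            (dilate (suc h) H ⊗ ((two ^ suc h) · dilate (suc h) T)) k ≈⟨ ⊗-comm (dilate (suc h) H) ((two ^ suc h) · dilate (suc h) T) k ⟩
            (((two ^ suc h) · dilate (suc h) T) ⊗ dilate (suc h) H) k ≈⟨ ·-⊗ (two ^ suc h) (dilate (suc h) T) (dilate (suc h) H) k ⟩
            two ^ suc h * (dilate (suc h) T ⊗ dilate (suc h) H) k ≈⟨ *-congˡ (⊗-comm (dilate (suc h) T) (dilate (suc h) H) k) ⟩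
            two ^ suc h * (dilate (suc h) H ⊗ dilate (suc h) T) k ≈⟨ *-congˡ (sym (at (dilate-⊗ (suc h) H T) k)) ⟩
            two ^ suc h * dilate (suc h) (H ⊗ T) k ≈⟨ *-congˡ (at (dilate-cong (suc h) pT) k) ⟩
            two ^ suc h * dilate (suc h) (θ H) k ≈⟨ sym (at (θ-dilate (suc h) H) k) ⟩
            θ (dilate (suc h) H) k ∎
          ζ^n≈1 : ζ ^ n ≈ 1#
          ζ^n≈1 = begin
            ζ ^ n ≈⟨ sym (^-assocʳ ζ (2 ℕ.^ suc h) m) ⟩
            (ζ ^ (2 ℕ.^ suc h)) ^ m ≡⟨ ≡.cong (λ k → (ζ ^ k) ^ m) (≡.sym d≡2^1+h) ⟩
            (ζ ^ d) ^ m ≈⟨ ^-congˡ m ζ^d≈1 ⟩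
            1# ^ m ≈⟨ 1^ m ⟩
            1# ∎
          equal : two ^ suc h * S n ≈ two ^ suc h * T m
          equal = begin
            two ^ suc h * S n ≈⟨ *-congʳ (sym (trans (reflexive (≡.cong nat d≡2^1+h)) (nat-2^ (suc h)))) ⟩
            nat d * S n ≈⟨ sym (logSum-fixed S n ζ^n≈1 d) ⟩
            logSum S d n ≈⟨ at (logDerivative-cong (norm-0 d) (norm≋dilate pH) (norm-logDerivative pS d) dilated-log) n ⟩
            two ^ suc h * dilate (suc h) T n ≡⟨ ≡.cong (two ^ suc h *_) (dilate-multiple (suc h) T m) ⟩
            two ^ suc h * T m ∎

ℤring : CommutativeRing _ _
ℤring = ℤ.+-*-commutativeRing

ℤ-twoRegular : TwoAdic.TwoRegular ℤring
ℤ-twoRegular {+ zero}   _ = ≡.refl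
ℤ-twoRegular {+ suc n}  ()
ℤ-twoRegular { -[1+ n ]} ()

-- Divisibility by cyclotomic polynomials of 2-power order

module _ {c ℓ : Level} (A : CommutativeRing c ℓ) where
  open CommutativeRing A
  open RingTools A
  open TwoAdic A
  open Series A
  open SeriesEquations A
  open RootOfUnity A

  -- ζ² has half the order of ζ, and `σ` halves the index, so both terms reduce to the same
  -- coefficient M_k at parameter 1.
  logDerivative-difference-at-root : ∀ ζ → TwoRegular → ∀ j → ζ ^ (2 ℕ.^ j) ≈ - 1# →
    ∀ {G G′ L L′} → IsFraction ζ G → IsFraction (ζ * ζ) G′ → IsLogDerivative G L → IsLogDerivative G′ L′ →
    ∀ k → L (2 ℕ.^ suc j ℕ.* k) - σ L′ (2 ℕ.^ suc j ℕ.* k) ≈ 0#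
  logDerivative-difference-at-root ζ reg j root {G} {G′} {L} {L′} isG isG′ isL isL′ k =
    x≈y⇒x-y≈0 (trans at-ζ (sym (trans (reflexive index) (at-ζ² j refl))))
    where
    H = proj₁ (fraction-exists 1#)
    isH = proj₂ (fraction-exists 1#)
    M = proj₁ (logDerivative-exists H (constantTerm isH))
    isM = proj₂ (logDerivative-exists H (constantTerm isH))
    at-ζ : L (2 ℕ.^ suc j ℕ.* k) ≈ M k
    at-ζ = Continuants.logDerivative-at-root ζ isG reg j root isH isL isM k
    index : σ L′ (2 ℕ.^ suc j ℕ.* k) ≡ L′ (2 ℕ.^ j ℕ.* k)
    index = ≡.trans (≡.cong (σ L′) (≡.trans (≡.cong (ℕ._* k) (2^1+h≡2^h+2^h j)) (ℕ.*-distribʳ-+ k (2 ℕ.^ j) (2 ℕ.^ j))))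
                    (σ-double L′ (2 ℕ.^ j ℕ.* k))
    -- For j = 0 the parameter ζ² is 1, and uniqueness of the fraction replaces the norm argument.
    -- The separate index i permits this case split while j stays fixed in `root`.
    at-ζ² : ∀ i → ζ ^ (2 ℕ.^ i) ≈ ζ ^ (2 ℕ.^ j) → L′ (2 ℕ.^ i ℕ.* k) ≈ M k
    at-ζ² zero    e = trans (reflexive (≡.cong L′ (ℕ.+-identityʳ k)))
      (at (logDerivative-cong (constantTerm isG′) (fraction-unique ζ²≈1 isG′ isH) isL′ isM) k)
      where
      ζ≈-1 : ζ ≈ - 1#
      ζ≈-1 = trans (sym (*-identityʳ ζ)) (trans e root)
      ζ²≈1 : ζ * ζ ≈ 1#
      ζ²≈1 = trans (*-cong ζ≈-1 ζ≈-1) (solve 1 (λ x → (:- :1) :* (:- :1) := :1) refl ζ)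
    at-ζ² (suc i) e = Continuants.logDerivative-at-root (ζ * ζ) isG′ reg i square isH isL′ isM k
      where
      square : (ζ * ζ) ^ (2 ℕ.^ i) ≈ - 1#
      square = trans (^-distrib-* ζ ζ (2 ℕ.^ i)) (trans (sym (^-homo-* ζ (2 ℕ.^ i) (2 ℕ.^ i)))
        (trans (reflexive (≡.cong (ζ ^_) (≡.sym (2^1+h≡2^h+2^h i)))) (trans e root)))

module TwoPowerCyclotomic {c ℓ : Level} (R : CommutativeRing c ℓ) (T : CommutativeRing.Carrier R)
  (regular : TwoAdic.TwoRegular R)
  (Φ-primitive : ∀ j → TwoAdic.Primitive R (TwoAdic.Φ R T j)) where
  open CommutativeRing R
  open RingTools R
  open TwoAdic R hiding (Φ)
  private
    Φ : ℕ → Carrier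
    Φ = TwoAdic.Φ R T

  two-cancel : ∀ {x y} → two * x ≈ two * y → x ≈ y
  two-cancel {x} {y} e = x-y≈0⇒x≈y (regular (trans
    (solve 2 (λ x y → (x :- y) :+ (x :- y) := (:1 :+ :1) :* x :- (:1 :+ :1) :* y) refl x y) (x≈y⇒x-y≈0 e)))

  2^-factor : ∀ w g {x y} → Primitive g → two ^ w * y ≈ g * x → Σ Carrier λ x′ → x ≈ two ^ w * x′
  2^-factor zero    g {x} prim e = x , sym (*-identityˡ x)
  2^-factor (suc w) g {x} {y} prim e with prim (trans (sym (*-assoc two (two ^ w) y)) e)
  ... | x₁ , e₁ with 2^-factor w g prim (two-cancel (begin
        two * (two ^ w * y) ≈⟨ sym (*-assoc two (two ^ w) y) ⟩
        two ^ suc w * y ≈⟨ e ⟩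
        g * x ≈⟨ *-congˡ {g} e₁ ⟩
        g * (two * x₁) ≈⟨ solve 3 (λ g a x → g :* (a :* x) := a :* (g :* x)) refl g two x₁ ⟩
        two * (g * x₁) ∎))
    where open SetoidReasoning setoid
  ...   | x₂ , e₂ = x₂ , trans e₁ (trans (*-congˡ {two} e₂) (sym (*-assoc two (two ^ w) x₂)))

  -- The q-analogue [2^v] = 1 + T + ... + T^(2^v - 1), as the product of the cyclotomic polynomials
  -- of orders 2, 4, ..., 2^v.
  qnumber : ℕ → Carrier
  qnumber zero    = 1#
  qnumber (suc v) = qnumber v * Φ v

  qnumber-primitive : ∀ v → Primitive (qnumber v)
  qnumber-primitive zero    {x} {y} e = y , trans (sym (*-identityˡ x)) (sym e)
  qnumber-primitive (suc v) {x} {y} e with qnumber-primitive v (trans e (*-assoc (qnumber v) (Φ v) x))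
  ... | x₁ , e₁ = Φ-primitive v (sym e₁)

  qnumber-closed : ∀ v → (T - 1#) * qnumber v ≈ T ^ (2 ℕ.^ v) - 1#
  qnumber-closed zero    = solve 1 (λ t → (t :- :1) :* :1 := t :* :1 :- :1) refl T
  qnumber-closed (suc v) = begin
      (T - 1#) * (qnumber v * Φ v) ≈⟨ sym (*-assoc (T - 1#) (qnumber v) (Φ v)) ⟩
      (T - 1#) * qnumber v * Φ v ≈⟨ *-congʳ {Φ v} (qnumber-closed v) ⟩
      (p - 1#) * (1# + p) ≈⟨ solve 1 (λ p → (p :- :1) :* (:1 :+ p) := p :* p :- :1) refl p ⟩
      p * p - 1# ≈⟨ +-congʳ { - 1# } (sym (^-homo-* T (2 ℕ.^ v) (2 ℕ.^ v))) ⟩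
      T ^ (2 ℕ.^ v ℕ.+ 2 ℕ.^ v) - 1# ≡⟨ ≡.cong (λ k → T ^ k - 1#) (≡.sym (2^1+h≡2^h+2^h v)) ⟩
      T ^ (2 ℕ.^ suc v) - 1# ∎
    where
    open SetoidReasoning setoid
    p = T ^ (2 ℕ.^ v)

  module Cyclotomic (j : ℕ) where
    open Quotient R (Φ j) public
    module A where
      open CommutativeRing quotientRing public
      open TwoAdic quotientRing public
      open RingTools quotientRing public
      open SeriesEquations quotientRing public

    root : A._≈_ (A._^_ T (2 ℕ.^ j)) (A.- A.1#)
    root = A.trans (A.sym (φ-^ T (2 ℕ.^ j))) (1# by
        solve 1 (λ p → p :- (:- :1) := (:1 :+ p) :* :1) refl (T ^ (2 ℕ.^ j)))
      where open SeriesMap R quotientRing (λ x → x) projection-isHom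

    -- From 2x = Φc, primitivity of Φ makes c even, and halving exhibits x as a multiple of Φ.
    twoRegular : A.TwoRegular
    twoRegular {x} (c by e) with Φ-primitive j {c} {x}
      (trans (solve 1 (λ x → (:1 :+ :1) :* x := (x :+ x) :- :0) refl x) e)
    ... | c′ , e′ = c′ by trans (solve 1 (λ x → x :- :0 := x) refl x) (two-cancel (begin
        two * x ≈⟨ solve 1 (λ x → (:1 :+ :1) :* x := (x :+ x) :- :0) refl x ⟩
        (x + x) - 0# ≈⟨ e ⟩
        Φ j * c ≈⟨ *-congˡ {Φ j} e′ ⟩
        Φ j * (two * c′) ≈⟨ solve 3 (λ g a x → g :* (a :* x) := a :* (g :* x)) refl (Φ j) two c′ ⟩
        two * (Φ j * c′) ∎))
      where open SetoidReasoning setoid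

  -- The cyclotomic factors are coprime only up to 2, which is compensated by regularity of 2. Let D
  -- = [2^v] a. Modulo Φ_v one has (T - 1) [2^v] = T^(2^v) - 1 = -2, so D = 0 gives 2a = 0 and then
  -- a = 0.
  qnumber-divides : ∀ v D → (∀ j → j ℕ.< v → Cyclotomic._∼_ j D 0#) → Σ Carrier λ E → D ≈ qnumber v * E
  qnumber-divides zero    D p = D , sym (*-identityˡ D)
  qnumber-divides (suc v) D p with qnumber-divides v D (λ j j<v → p j (ℕ.m<n⇒m<1+n j<v))
  ... | a , D≈ = multiplier a∼0 , (begin
      D ≈⟨ D≈ ⟩
      qnumber v * a ≈⟨ *-congˡ {qnumber v} (trans (solve 1 (λ x → x := x :- :0) refl a) (difference a∼0)) ⟩
      qnumber v * (Φ v * multiplier a∼0) ≈⟨ sym (*-assoc (qnumber v) (Φ v) _) ⟩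
      qnumber v * Φ v * multiplier a∼0 ∎)
    where
    open SetoidReasoning setoid
    open Cyclotomic v
    b = multiplier (p v ℕ.≤-refl)
    tp = T ^ (2 ℕ.^ v)
    D≈Φb : D ≈ Φ v * b
    D≈Φb = trans (solve 1 (λ x → x := x :- :0) refl D) (difference (p v ℕ.≤-refl))
    a∼0 : a ∼ 0#
    a∼0 = twoRegular ((a - (T - 1#) * b) by (begin
      (a + a) - 0# ≈⟨ solve 2 (λ a p → (a :+ a) :- :0 := (:1 :+ p) :* a :- (p :- :1) :* a) refl a tp ⟩
      Φ v * a - (tp - 1#) * a ≈⟨ +-congˡ {Φ v * a} (-‿cong (*-congʳ {a} (sym (qnumber-closed v)))) ⟩
      Φ v * a - (T - 1#) * qnumber v * a ≈⟨ +-congˡ {Φ v * a} (-‿cong (trans (*-assoc (T - 1#) (qnumber v) a) (*-congˡ {T - 1#} (trans (sym D≈) D≈Φb)))) ⟩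
      Φ v * a - (T - 1#) * (Φ v * b) ≈⟨ solve 4 (λ g a t b → g :* a :- t :* (g :* b) := g :* (a :- t :* b)) refl (Φ v) a (T - 1#) b ⟩
      Φ v * (a - (T - 1#) * b) ∎))

  -- Gauss's lemma: [2^v] is primitive, so if 2^v divides [2^v] E it divides E.
  both-divide : ∀ v {D} → Σ Carrier (λ E → D ≈ qnumber v * E) → Σ Carrier (λ q → D ≈ two ^ v * q) →
    Σ Carrier λ E → D ≈ qnumber v * (two ^ v * E)
  both-divide v (E , D≈) (q , D≈2^q) = proj₁ factor , trans D≈ (*-congˡ (proj₂ factor))
    where factor = 2^-factor v (qnumber v) {E} {q} (qnumber-primitive v) (trans (sym D≈2^q) D≈)

  open Series R using (σ)
  open SeriesEquations R using (IsFraction; IsLogDerivative; constantTerm)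
  open Dwork R using (fraction-congruence)

  module _ {G G′ L L′} (isG : IsFraction T G) (isG′ : IsFraction (T * T) G′)
           (isL : IsLogDerivative G L) (isL′ : IsLogDerivative G′ L′) where

    cyclotomic-divides : ∀ j k → Cyclotomic._∼_ j (L (2 ℕ.^ suc j ℕ.* k) - σ L′ (2 ℕ.^ suc j ℕ.* k)) 0#
    cyclotomic-divides j k = A.trans (A.+-congˡ (A.-‿cong (Map.map-σ L′ (2 ℕ.^ suc j ℕ.* k))))
      (logDerivative-difference-at-root quotientRing T twoRegular j root {G} {G′} {L} {L′}
        (Map.map-fraction isG) (Map.map-fraction isG′) (Map.map-logDerivative {G} {L} isL) (Map.map-logDerivative {G′} {L′} isL′) k)
      where
      open Cyclotomic j
      module Map = SeriesMap R quotientRing (λ x → x) projection-isHom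

    logDerivative-factor : ∀ v m → Σ Carrier λ E → L (2 ℕ.^ v ℕ.* m) - σ L′ (2 ℕ.^ v ℕ.* m) ≈ qnumber v * (two ^ v * E)
    logDerivative-factor v m = both-divide v (qnumber-divides v _ divides)
        (fraction-congruence regular {T} {G} {G′} {L} {L′} isG isG′ isL isL′ v m)
      where
      divides : ∀ j → j ℕ.< v → Cyclotomic._∼_ j (L (2 ℕ.^ v ℕ.* m) - σ L′ (2 ℕ.^ v ℕ.* m)) 0#
      divides j j<v = ≡.subst (λ n → Cyclotomic._∼_ j (L n - σ L′ n) 0#) index (cyclotomic-divides j (2 ℕ.^ (v ℕ.∸ suc j) ℕ.* m))
        where
        index : 2 ℕ.^ suc j ℕ.* (2 ℕ.^ (v ℕ.∸ suc j) ℕ.* m) ≡ 2 ℕ.^ v ℕ.* m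
        index = ≡.trans (≡.sym (ℕ.*-assoc (2 ℕ.^ suc j) (2 ℕ.^ (v ℕ.∸ suc j)) m)) (≡.cong (ℕ._* m)
          (≡.trans (≡.sym (ℕ.^-distribˡ-+-* 2 (suc j) (v ℕ.∸ suc j))) (≡.cong (2 ℕ.^_) (ℕ.m+[n∸m]≡n j<v))))

-- The polynomial ring ℤ[t] and evaluation

-- ℤ[t] as coefficient lists, up to trailing zeros.
module Polynomial where
  open Series ℤring using (Ser; tail; _⊗_; _≋_; coeffs; at; ⊗-cong-≤; zeroˡ-⊗; constant)
  private
    module SZ = CommutativeRing (Series.seriesRing ℤring)

  Poly : Set
  Poly = List ℤ

  coef : Poly → Ser
  coef []      n       = + 0
  coef (a ∷ f) zero    = a
  coef (a ∷ f) (suc n) = coef f n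

  _⊞_ _⊠_ : Poly → Poly → Poly
  []      ⊞ g       = g
  (a ∷ f) ⊞ []      = a ∷ f
  (a ∷ f) ⊞ (b ∷ g) = (a ℤ.+ b) ∷ (f ⊞ g)

  []      ⊠ g = []
  (a ∷ f) ⊠ g = List.map (a ℤ.*_) g ⊞ (+ 0 ∷ (f ⊠ g))

  ⊟_ : Poly → Poly
  ⊟_ = List.map (ℤ.-_)

  coef-⊞ : ∀ f g n → coef (f ⊞ g) n ≡ coef f n ℤ.+ coef g n
  coef-⊞ []      g       n       = ≡.sym (ℤ.+-identityˡ _)
  coef-⊞ (a ∷ f) []      n       = ≡.sym (ℤ.+-identityʳ _)
  coef-⊞ (a ∷ f) (b ∷ g) zero    = ≡.refl
  coef-⊞ (a ∷ f) (b ∷ g) (suc n) = coef-⊞ f g n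

  coef-map-* : ∀ a f n → coef (List.map (a ℤ.*_) f) n ≡ a ℤ.* coef f n
  coef-map-* a []      n       = ≡.sym (ℤ.*-zeroʳ a)
  coef-map-* a (b ∷ f) zero    = ≡.refl
  coef-map-* a (b ∷ f) (suc n) = coef-map-* a f n

  coef-⊟ : ∀ f n → coef (⊟ f) n ≡ ℤ.- coef f n
  coef-⊟ []      n       = ≡.refl
  coef-⊟ (a ∷ f) zero    = ≡.refl
  coef-⊟ (a ∷ f) (suc n) = coef-⊟ f n

  coef-⊠ : ∀ f g n → coef (f ⊠ g) n ≡ (coef f ⊗ coef g) n
  coef-⊠ []      g n       = ≡.sym (zeroˡ-⊗ (coef []) (λ _ → ≡.refl) n)
  coef-⊠ (a ∷ f) g zero    = ≡.trans (coef-⊞ (List.map (a ℤ.*_) g) _ 0)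
                               (≡.trans (ℤ.+-identityʳ _) (coef-map-* a g 0))
  coef-⊠ (a ∷ f) g (suc n) = ≡.trans (coef-⊞ (List.map (a ℤ.*_) g) _ (suc n))
                               (≡.cong₂ ℤ._+_ (coef-map-* a g (suc n)) (coef-⊠ f g n))

  polyRawRing : RawRing _ _
  polyRawRing = record
    { Carrier = Poly ; _≈_ = λ f g → coef f ≋ coef g ; _+_ = _⊞_ ; _*_ = _⊠_ ; -_ = ⊟_ ; 0# = [] ; 1# = + 1 ∷ [] }

  -- The ring laws are pulled back from ℤ[[t]] along the injective `coef`. Lists are kept as
  -- carriers because evaluation requires finitely many terms.
  coef-isRingMonomorphism : Morphisms.RingMorphisms.IsRingMonomorphism polyRawRing SZ.rawRing coef
  coef-isRingMonomorphism = record
    { isRingHomomorphism = record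
      { isSemiringHomomorphism = record
        { isNearSemiringHomomorphism = record
          { +-isMonoidHomomorphism = record
            { isMagmaHomomorphism = record
              { isRelHomomorphism = record { cong = λ e → e }
              ; homo = λ f g → coeffs (coef-⊞ f g) }
            ; ε-homo = SZ.refl }
          ; *-homo = λ f g → coeffs (coef-⊠ f g) }
        ; 1#-homo = coeffs λ { zero → ≡.refl ; (suc n) → ≡.refl } }
      ; -‿homo = λ f → coeffs (coef-⊟ f) }
    ; injective = λ e → e }

  polyRing : CommutativeRing _ _
  polyRing = record
    { isCommutativeRing = RingMonomorphism.isCommutativeRing coef-isRingMonomorphism SZ.isCommutativeRing }

  open CommutativeRing polyRing public
  open TwoAdic polyRing public using (two; TwoRegular; Primitive; Φ)
  open RingTools polyRing public using (_^_)

  poly-twoRegular : TwoRegular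
  poly-twoRegular {x} e = coeffs λ n → ℤ-twoRegular (≡.trans (≡.sym (coef-⊞ x x n)) (at e n))

  T : Poly
  T = + 0 ∷ + 1 ∷ []

  coef-two : ∀ f n → coef (two * f) n ≡ + 2 ℤ.* coef f n
  coef-two f n = ≡.trans (coef-⊠ two f n) (≡.trans (⊗-cong-≤ n {f′ = constant (+ 2)} (λ {i} _ → two-coef i) (λ _ → ≡.refl)) (Series.constant-⊗ ℤring (+ 2) (coef f) n))
    where
    two-coef : ∀ i → coef two i ≡ constant (+ 2) i
    two-coef zero    = ≡.refl
    two-coef (suc i) = ≡.refl

  private
    module Mod2 = Quotient ℤring (+ 2)

  -- Over ℤ/2 a series with constant term 1 can be cancelled, so if 2 divides g x it divides every
  -- coefficient of x. `half` assembles the quotients stored in these congruences.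
  unit-primitive : ∀ g → coef g 0 ≡ + 1 → Primitive g
  unit-primitive g g₀ {x} {y} e = half x even , coeffs λ n → ≡.trans (half-correct x even n) (≡.sym (coef-two (half x even) n))
    where
    module Q where
      open Series Mod2.quotientRing public
      open SeriesEquations Mod2.quotientRing public
      open CommutativeRing Mod2.quotientRing public
      open CommutativeRing seriesRing public using () renaming (0# to 0s)
    open SeriesMap ℤring Mod2.quotientRing (λ x → x) Mod2.projection-isHom
    gx∼0 : ∀ n → (coef g Q.⊗ coef x) n Q.≈ + 0
    gx∼0 n = Q.trans (Q.sym (map-⊗ (coef g) (coef x) n)) (coef y n Mod2.by
      ≡.trans (ℤ.+-identityʳ _) (≡.trans (≡.sym (coef-⊠ g x n)) (≡.trans (≡.sym (at e n)) (coef-two y n))))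
    even : ∀ n → coef x n Q.≈ + 0
    even = Q.at (Q.⊗-cancelˡ (coef g) {coef x} {Q.0s} (Mod2.∼-reflexive g₀)
      (Q.coeffs λ n → Q.trans (gx∼0 n) (Q.sym (Q.trans (Q.⊗-comm (coef g) Q.0s n) (Q.zeroˡ-⊗ Q.0s (λ _ → Q.refl) n)))))
    half : ∀ f → (∀ n → coef f n Q.≈ + 0) → Poly
    half []      p = []
    half (a ∷ f) p = Mod2.multiplier (p 0) ∷ half f (λ n → p (suc n))
    half-correct : ∀ f p n → coef f n ≡ + 2 ℤ.* coef (half f p) n
    half-correct []      p n       = ≡.refl
    half-correct (a ∷ f) p zero    = ≡.trans (≡.sym (ℤ.+-identityʳ _)) (Mod2.difference (p 0))
    half-correct (a ∷ f) p (suc n) = half-correct f (λ k → p (suc k)) n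

  T-power-0 : ∀ k .{{_ : ℕ.NonZero k}} → coef (T ^ k) 0 ≡ + 0
  T-power-0 (suc k) = ≡.trans (coef-⊠ T (T ^ k) 0) (ℤ.*-zeroˡ (coef (T ^ k) 0))

  Φ-primitive : ∀ j → Primitive (Φ T j)
  Φ-primitive j {x} {y} = unit-primitive (Φ T j)
    (≡.trans (coef-⊞ 1# (T ^ (2 ℕ.^ j)) 0) (≡.cong (λ z → + 1 ℤ.+ z) (T-power-0 (2 ℕ.^ j) {{ℕ.m^n≢0 2 j}}))) {x} {y}

module Evaluation {c ℓ : Level} (B : CommutativeRing c ℓ) (b : CommutativeRing.Carrier B) where
  open CommutativeRing B
  open RingTools B
  open RingProperties ring using (-0#≈0#)
  open Polynomial using (Poly; coef; _⊞_; _⊠_; ⊟_; polyRing; T)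
  open Series ℤring using (_≋_; coeffs; at)
  open SetoidReasoning setoid

  eval : Poly → Carrier
  eval []      = 0#
  eval (a ∷ f) = int a + b * eval f

  eval-⊞ : ∀ f g → eval (f ⊞ g) ≈ eval f + eval g
  eval-⊞ []      g       = sym (+-identityˡ _)
  eval-⊞ (x ∷ f) []      = sym (+-identityʳ _)
  eval-⊞ (x ∷ f) (y ∷ g) = begin
    int (x ℤ.+ y) + b * eval (f ⊞ g) ≈⟨ +-cong (int-+ x y) (*-congˡ (eval-⊞ f g)) ⟩
    (int x + int y) + b * (eval f + eval g) ≈⟨ solve 5 (λ x y b u v → (x :+ y) :+ b :* (u :+ v) := (x :+ b :* u) :+ (y :+ b :* v)) refl _ _ b _ _ ⟩
    (int x + b * eval f) + (int y + b * eval g) ∎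

  eval-map-* : ∀ a f → eval (List.map (a ℤ.*_) f) ≈ int a * eval f
  eval-map-* a []      = sym (zeroʳ _)
  eval-map-* a (x ∷ f) = begin
    int (a ℤ.* x) + b * eval (List.map (a ℤ.*_) f) ≈⟨ +-cong (int-* a x) (*-congˡ (eval-map-* a f)) ⟩
    int a * int x + b * (int a * eval f) ≈⟨ solve 4 (λ a x b u → a :* x :+ b :* (a :* u) := a :* (x :+ b :* u)) refl _ _ b _ ⟩
    int a * (int x + b * eval f) ∎

  eval-⊟ : ∀ f → eval (⊟ f) ≈ - eval f
  eval-⊟ []      = sym -0#≈0#
  eval-⊟ (x ∷ f) = begin
    int (ℤ.- x) + b * eval (⊟ f) ≈⟨ +-cong (int-neg x) (*-congˡ (eval-⊟ f)) ⟩
    - int x + b * - eval f ≈⟨ solve 3 (λ x b u → :- x :+ b :* (:- u) := :- (x :+ b :* u)) refl _ b _ ⟩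
    - (int x + b * eval f) ∎

  eval-⊠ : ∀ f g → eval (f ⊠ g) ≈ eval f * eval g
  eval-⊠ []      g = sym (zeroˡ _)
  eval-⊠ (x ∷ f) g = begin
    eval (List.map (x ℤ.*_) g ⊞ (+ 0 ∷ (f ⊠ g))) ≈⟨ eval-⊞ (List.map (x ℤ.*_) g) _ ⟩
    eval (List.map (x ℤ.*_) g) + (0# + b * eval (f ⊠ g)) ≈⟨ +-cong (eval-map-* x g) (+-congˡ (*-congˡ (eval-⊠ f g))) ⟩
    int x * eval g + (0# + b * (eval f * eval g)) ≈⟨ solve 4 (λ x g b f → x :* g :+ (:0 :+ b :* (f :* g)) := (x :+ b :* f) :* g) refl _ _ b _ ⟩
    (int x + b * eval f) * eval g ∎

  eval-0 : ∀ f → (∀ n → coef f n ≡ + 0) → eval f ≈ 0#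
  eval-0 []      p = refl
  eval-0 (x ∷ f) p = begin
    int x + b * eval f ≈⟨ +-cong (reflexive (≡.cong int (p 0))) (*-congˡ (eval-0 f (λ n → p (suc n)))) ⟩
    0# + b * 0# ≈⟨ solve 1 (λ b → :0 :+ b :* :0 := :0) refl b ⟩
    0# ∎

  -- Equal polynomials may be lists of different lengths; the surplus zeros evaluate to 0.
  eval-cong : ∀ f g → (∀ n → coef f n ≡ coef g n) → eval f ≈ eval g
  eval-cong []      g       p = sym (eval-0 g (λ n → ≡.sym (p n)))
  eval-cong (x ∷ f) []      p = eval-0 (x ∷ f) p
  eval-cong (x ∷ f) (y ∷ g) p = +-cong (reflexive (≡.cong int (p 0))) (*-congˡ (eval-cong f g (λ n → p (suc n))))

  eval-T : eval T ≈ b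
  eval-T = solve 1 (λ b → :0 :+ b :* ((:1 :+ :0) :+ b :* :0) := b) refl b

  eval-isHom : IsHom polyRing B eval
  eval-isHom = record
    { isSemiringHomomorphism = record
      { isNearSemiringHomomorphism = record
        { +-isMonoidHomomorphism = record
          { isMagmaHomomorphism = record
            { isRelHomomorphism = record { cong = λ {f} {g} e → eval-cong f g (at e) }
            ; homo = eval-⊞ }
          ; ε-homo = refl }
        ; *-homo = eval-⊠ }
      ; 1#-homo = solve 1 (λ b → (:1 :+ :0) :+ b :* :0 := :1) refl b }
    ; -‿homo = eval-⊟ }

-- The case t = 1: central binomial coefficients

module CentralBinomial {c ℓ : Level} (A : CommutativeRing c ℓ) where
  open CommutativeRing A
  open RingTools A
  open Series A
  open SeriesEquations A
  open RootOfUnity A using (Z; scale-1)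
  private
    module S = CommutativeRing seriesRing
    module ST = RingTools seriesRing

  -- With H² = H + z and w = 2H - 1 one has w² = 1 + 4z and 1 - 2s = 1/w, the generating function of (-1)ⁿ C(2n,n).
  recurrence : ∀ {H s} → IsFraction 1# H → IsLogDerivative H s → ∀ n →
    nat (suc n) * (one S.- (s ⊕ s)) (suc n) + (nat 4 * nat n + nat 2) * (one S.- (s ⊕ s)) n ≈ 0#
  recurrence {H} {s} isH isS n = begin
      nat (suc n) * r (suc n) + (nat 4 * nat n + nat 2) * r n
        ≈⟨ solve 4 (λ m x k y → m :* x :+ (con (+ 4) :* k :+ con (+ 2)) :* y :=
              (m :* x :+ con (+ 4) :* (:1 :* (k :* y))) :+ con (+ 2) :* (:1 :* y)) refl (nat (suc n)) (r (suc n)) (nat n) (r n) ⟩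
      (θ r (suc n) + nat 4 * (1# * θ r n)) + nat 2 * (1# * r n)
        ≈⟨ +-cong (+-congˡ (*-congˡ (sym (linear-⊗ 1# (θ r) n)))) (*-congˡ (sym (linear-⊗ 1# r n))) ⟩
      (θ r (suc n) + nat 4 * (Z ⊗ θ r) (suc n)) + nat 2 * (Z ⊗ r) (suc n)
        ≈⟨ solve 3 (λ x y u → (x :+ con (+ 4) :* y) :+ con (+ 2) :* u := (x :+ (y :+ y :+ (y :+ y))) :+ (u :+ u)) refl (θ r (suc n)) ((Z ⊗ θ r) (suc n)) ((Z ⊗ r) (suc n)) ⟩
      ((θ r ⊕ ((Z ⊗ θ r ⊕ Z ⊗ θ r) ⊕ (Z ⊗ θ r ⊕ Z ⊗ θ r))) ⊕ (Z ⊗ r ⊕ Z ⊗ r)) (suc n)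
        ≈⟨ at differential (suc n) ⟩
      0# ∎
    where
    open SetoidReasoning setoid
    r = one S.- (s ⊕ s)
    w = (H ⊕ H) S.- one
    H² : H ⊗ H ≋ H ⊕ Z
    H² = S.trans (S.*-congˡ {H} (S.sym (scale-1 H))) (S.trans (functional isH) (S.+-congʳ (scale-1 H)))
    θZ : θ Z ≋ Z
    θZ = coeffs λ { zero → zeroˡ _ ; (suc zero) → trans (*-identityʳ _) (+-identityʳ 1#) ; (suc (suc n)) → zeroʳ _ }
    wθH : w ⊗ θ H ≋ Z
    wθH = S.trans (ST.solve 2 (λ h t → (h ST.:+ h ST.:- ST.:1) ST.:* t ST.:= (t ST.:* h ST.:+ h ST.:* t) ST.:- t) S.refl H (θ H))
         (S.trans (S.+-congʳ (S.trans (S.sym (θ-⊗ H H)) (S.trans (θ-cong H²) (S.trans (θ-⊕ H Z) (S.+-congˡ θZ)))))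
                  (ST.solve 2 (λ t z → (t ST.:+ z) ST.:- t ST.:= z) S.refl (θ H) Z))
    ws : w ⊗ s ≋ H S.- one
    ws = ⊗-cancelˡ H (constantTerm isH) (S.trans (ST.solve 3 (λ h w s → h ST.:* (w ST.:* s) ST.:= w ST.:* (h ST.:* s)) S.refl H w s)
         (S.trans (S.*-congˡ {w} isS) (S.trans wθH
         (S.trans (ST.solve 2 (λ h z → z ST.:= (h ST.:+ z) ST.:- h) S.refl H Z) (S.trans (S.+-congʳ (S.sym H²))
           (ST.solve 1 (λ h → h ST.:* h ST.:- h ST.:= h ST.:* (h ST.:- ST.:1)) S.refl H))))))
    wr : w ⊗ r ≋ one
    wr = S.trans (ST.solve 2 (λ w s → w ST.:* (ST.:1 ST.:- (s ST.:+ s)) ST.:= w ST.:- (w ST.:* s ST.:+ w ST.:* s)) S.refl w s)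
         (S.trans (S.+-congˡ (S.-‿cong (S.+-cong ws ws)))
           (ST.solve 1 (λ h → (h ST.:+ h ST.:- ST.:1) ST.:- ((h ST.:- ST.:1) ST.:+ (h ST.:- ST.:1)) ST.:= ST.:1) S.refl H))
    w² : w ⊗ w ≋ one ⊕ ((Z ⊕ Z) ⊕ (Z ⊕ Z))
    w² = S.trans (ST.solve 1 (λ h → (h ST.:+ h ST.:- ST.:1) ST.:* (h ST.:+ h ST.:- ST.:1) ST.:=
             ST.con (+ 4) ST.:* (h ST.:* h) ST.:- ST.con (+ 4) ST.:* h ST.:+ ST.:1) S.refl H)
         (S.trans (S.+-congʳ (S.+-congʳ (S.*-congˡ {ST.nat 4} H²)))
           (ST.solve 2 (λ h z → ST.con (+ 4) ST.:* (h ST.:+ z) ST.:- ST.con (+ 4) ST.:* h ST.:+ ST.:1 ST.:= ST.:1 ST.:+ (z ST.:+ z ST.:+ (z ST.:+ z))) S.refl H Z))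
    θw : θ w ≋ θ H ⊕ θ H
    θw = coeffs λ n → trans (solve 3 (λ k h o → k :* (h :+ h :- o) := (k :* h :+ k :* h) :- k :* o) refl (nat n) (H n) (one n))
                     (trans (+-congˡ (-‿cong (θ-constant 1# n))) (solve 1 (λ x → x :- :0 := x) refl _))
    derivative : θ w ⊗ r ⊕ w ⊗ θ r ≋ S.0#
    derivative = S.trans (S.sym (θ-⊗ w r)) (S.trans (θ-cong wr) (coeffs (θ-constant 1#)))
    -- This is w · θ(w r) = 0, rewritten by w² = 1 + 4z and w θw = 2z.
    differential : (θ r ⊕ ((Z ⊗ θ r ⊕ Z ⊗ θ r) ⊕ (Z ⊗ θ r ⊕ Z ⊗ θ r))) ⊕ (Z ⊗ r ⊕ Z ⊗ r) ≋ S.0#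
    differential = S.trans (ST.solve 3 (λ t z r → (t ST.:+ ((z ST.:* t ST.:+ z ST.:* t) ST.:+ (z ST.:* t ST.:+ z ST.:* t))) ST.:+ (z ST.:* r ST.:+ z ST.:* r)
              ST.:= (ST.:1 ST.:+ ((z ST.:+ z) ST.:+ (z ST.:+ z))) ST.:* t ST.:+ (z ST.:+ z) ST.:* r) S.refl (θ r) Z r)
         (S.trans (S.+-cong (S.*-congʳ (S.sym w²)) (S.*-congʳ (S.+-cong (S.sym wθH) (S.sym wθH))))
         (S.trans (ST.solve 4 (λ w t h r → w ST.:* w ST.:* t ST.:+ (w ST.:* h ST.:+ w ST.:* h) ST.:* r ST.:= w ST.:* ((h ST.:+ h) ST.:* r ST.:+ w ST.:* t)) S.refl w (θ r) (θ H) r)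
         (S.trans (S.*-congˡ {w} (S.trans (S.+-congʳ (S.*-congʳ (S.sym θw))) derivative))
           (S.zeroʳ w))))

module CentralCongruence where
  open import Data.Integer using (_+_; _*_; -_; _-_)
  open RingTools ℤring using (solve; con; :0; :1; _:+_; _:*_; _:-_; :-_; _:=_; _^_; nat)
  open TwoAdic ℤring using (two; [-1]^2m)
  open Series ℤring using (Ser; one; σ; σ-double; σ-odd)
  open SeriesEquations ℤring using (IsFraction; IsLogDerivative; constantTerm)
  open ≡.≡-Reasoning

  nat≡+ : ∀ n → nat n ≡ + n
  nat≡+ zero    = ≡.refl
  nat≡+ (suc n) = ≡.cong (λ x → + 1 + x) (nat≡+ n)

  Odd : ℤ → Set
  Odd a = Σ ℤ λ b → a ≡ + 1 + (b + b)

  odd-* : ∀ {a b} → Odd a → Odd b → Odd (a * b)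
  odd-* (x , ≡.refl) (y , ≡.refl) = x + y + (x * y + x * y) ,
    solve 2 (λ x y → (:1 :+ (x :+ x)) :* (:1 :+ (y :+ y)) := :1 :+ ((x :+ y :+ (x :* y :+ x :* y)) :+ (x :+ y :+ (x :* y :+ x :* y)))) ≡.refl x y

  -- With a = 1 + 2b one has x = ax - 2bx, so x is even; halve and repeat.
  2^∣-odd-cancel : ∀ w {a x y} → Odd a → a * x ≡ two ^ w * y → Σ ℤ λ z → x ≡ two ^ w * z
  2^∣-odd-cancel zero    {x = x} _ _ = x , ≡.sym (ℤ.*-identityˡ x)
  2^∣-odd-cancel (suc w) {x = x} {y} (b , ≡.refl) e = proj₁ rest , (begin
      x ≡⟨ x≡2x′ ⟩
      + 2 * x′ ≡⟨ ≡.cong (+ 2 *_) (proj₂ rest) ⟩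
      + 2 * (two ^ w * proj₁ rest) ≡⟨ ≡.sym (ℤ.*-assoc (+ 2) (two ^ w) (proj₁ rest)) ⟩
      two ^ suc w * proj₁ rest ∎)
    where
    x′ = two ^ w * y - b * x
    x≡2x′ : x ≡ + 2 * x′
    x≡2x′ = begin
      x ≡⟨ solve 2 (λ b x → x := (:1 :+ (b :+ b)) :* x :- con (+ 2) :* (b :* x)) ≡.refl b x ⟩
      (+ 1 + (b + b)) * x - + 2 * (b * x) ≡⟨ ≡.cong (_- + 2 * (b * x)) e ⟩
      two ^ suc w * y - + 2 * (b * x) ≡⟨ solve 3 (λ p y u → con (+ 2) :* p :* y :- con (+ 2) :* u := con (+ 2) :* (p :* y :- u)) ≡.refl (two ^ w) y (b * x) ⟩
      + 2 * x′ ∎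
    rest = 2^∣-odd-cancel w (b , ≡.refl) (ℤ.*-cancelˡ-≡ (+ 2) _ _ (begin
      + 2 * ((+ 1 + (b + b)) * x′) ≡⟨ solve 2 (λ a x → con (+ 2) :* (a :* x) := a :* (con (+ 2) :* x)) ≡.refl (+ 1 + (b + b)) x′ ⟩
      (+ 1 + (b + b)) * (+ 2 * x′) ≡⟨ ≡.cong ((+ 1 + (b + b)) *_) (≡.sym x≡2x′) ⟩
      (+ 1 + (b + b)) * x ≡⟨ e ⟩
      two ^ suc w * y ≡⟨ ℤ.*-assoc (+ 2) (two ^ w) y ⟩
      + 2 * (two ^ w * y) ∎))

  -- The product (c + 1)(c + 3) ... (c + 2m - 1); at c = 0 it is the double factorial (2m - 1)!!.
  oddStep : ℕ → ℤ → ℤ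
  oddStep zero    c = + 1
  oddStep (suc m) c = oddStep m c * (c + (+ m + + m) + + 1)

  oddStep-odd : ∀ m c → Odd (oddStep m (c + c))
  oddStep-odd zero    c = + 0 , ≡.refl
  oddStep-odd (suc m) c = odd-* (oddStep-odd m c)
    (c + + m , solve 2 (λ c m → (c :+ c) :+ (m :+ m) :+ :1 := :1 :+ ((c :+ m) :+ (c :+ m))) ≡.refl c (+ m))

  oddStep-+ : ∀ a b c → oddStep (a ℕ.+ b) c ≡ oddStep a c * oddStep b (c + (+ a + + a))
  oddStep-+ a zero    c = ≡.trans (≡.cong (λ k → oddStep k c) (ℕ.+-identityʳ a)) (≡.sym (ℤ.*-identityʳ _))
  oddStep-+ a (suc b) c = begin
    oddStep (a ℕ.+ suc b) c ≡⟨ ≡.cong (λ k → oddStep k c) (ℕ.+-suc a b) ⟩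
    oddStep (a ℕ.+ b) c * (c + ((+ a + + b) + (+ a + + b)) + + 1)
                                               ≡⟨ ≡.cong (_* (c + ((+ a + + b) + (+ a + + b)) + + 1)) (oddStep-+ a b c) ⟩
    oddStep a c * oddStep b (c + (+ a + + a)) * (c + ((+ a + + b) + (+ a + + b)) + + 1)
      ≡⟨ solve 5 (λ u v c a b → u :* v :* (c :+ ((a :+ b) :+ (a :+ b)) :+ :1) := u :* (v :* ((c :+ (a :+ a)) :+ (b :+ b) :+ :1))) ≡.refl (oddStep a c) (oddStep b (c + (+ a + + a))) c (+ a) (+ b) ⟩
    oddStep a c * oddStep (suc b) (c + (+ a + + a)) ∎

  oddStep-front : ∀ m c → oddStep (suc m) c ≡ (c + + 1) * oddStep m (c + + 2)
  oddStep-front m c = ≡.trans (oddStep-+ 1 m c) (≡.cong (_* oddStep m (c + + 2)) (solve 1 (λ c → :1 :* (c :+ (:0 :+ :0) :+ :1) := c :+ :1) ≡.refl c))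

  -- The same factors in reverse order, each negated.
  oddStep-reverse : ∀ m c → oddStep m c ≡ (- + 1) ^ m * oddStep m (- c - (+ m + + m))
  oddStep-reverse zero    c = ≡.refl
  oddStep-reverse (suc m) c = begin
    oddStep (suc m) c ≡⟨ oddStep-front m c ⟩
    (c + + 1) * oddStep m (c + + 2) ≡⟨ ≡.cong ((c + + 1) *_) (oddStep-reverse m (c + + 2)) ⟩
    (c + + 1) * (ε * oddStep m (- (c + + 2) - (+ m + + m))) ≡⟨ ≡.cong (λ k → (c + + 1) * (ε * oddStep m k)) shift ⟩
    (c + + 1) * (ε * oddStep m c′)
      ≡⟨ solve 4 (λ c e o m → (c :+ :1) :* (e :* o) := (:- :1) :* e :* (o :* ((:- c :- ((:1 :+ m) :+ (:1 :+ m))) :+ (m :+ m) :+ :1))) ≡.refl c ε (oddStep m c′) (+ m) ⟩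
    (- + 1) ^ suc m * oddStep (suc m) c′ ∎
    where
    ε = (- + 1) ^ m
    c′ = - c - (+ suc m + + suc m)
    shift : - (c + + 2) - (+ m + + m) ≡ c′
    shift = solve 2 (λ c m → :- (c :+ con (+ 2)) :- (m :+ m) := :- c :- ((:1 :+ m) :+ (:1 :+ m))) ≡.refl c (+ m)

  oddStep-mod4 : ∀ m c d → Σ ℤ λ x → oddStep m (c + + 4 * d) ≡ oddStep m c + + 4 * x
  oddStep-mod4 zero    c d = + 0 , ≡.refl
  oddStep-mod4 (suc m) c d with oddStep-mod4 m c d
  ... | x , e = x * (c + + 4 * d + (+ m + + m) + + 1) + oddStep m c * d ,
    ≡.trans (≡.cong (_* (c + + 4 * d + (+ m + + m) + + 1)) e)
      (solve 5 (λ o x c d m → (o :+ con (+ 4) :* x) :* (c :+ con (+ 4) :* d :+ (m :+ m) :+ :1) :=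
          o :* (c :+ (m :+ m) :+ :1) :+ con (+ 4) :* (x :* (c :+ con (+ 4) :* d :+ (m :+ m) :+ :1) :+ o :* d)) ≡.refl (oddStep m c) x c d (+ m))

  -- Consecutive odd j, j′ contribute (j² - n²)(j′² - n²) ≡ j²j′² modulo 2n², as j² + j′² and n are even.
  oddStep-± : ∀ h l → Σ ℤ λ x → oddStep (l ℕ.+ l) (h + h) * oddStep (l ℕ.+ l) (- (h + h))
    ≡ oddStep (l ℕ.+ l) (+ 0) * oddStep (l ℕ.+ l) (+ 0) + + 2 * ((h + h) * (h + h)) * x
  oddStep-± h zero    = + 0 , solve 1 (λ h → :1 := :1 :+ con (+ 2) :* ((h :+ h) :* (h :+ h)) :* :0) ≡.refl h
  oddStep-± h (suc l) rewrite ℕ.+-suc l l with oddStep-± h l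
  ... | x , e = _ , (begin
      P * (n + (K + K) + + 1) * (n + (K′ + K′) + + 1) * (Q * (- n + (K + K) + + 1) * (- n + (K′ + K′) + + 1))
        ≡⟨ solve 6 (λ p q a b c d → p :* a :* b :* (q :* c :* d) := p :* q :* (a :* b :* (c :* d))) ≡.refl P Q _ _ _ _ ⟩
      P * Q * F
        ≡⟨ ≡.cong (_* F) e ⟩
      (O * O + + 2 * (n * n) * x) * F
        -- At c = 0 the new factors are j = 4l + 1 and j′ = 4l + 3. The last bracket comes from j² +
        -- j′² = 2 (16l² + 16l + 5) and n⁴ = 2n² · 2h².
        ≡⟨ solve 4 (λ o x h l → let
             n = h :+ h
             j c = c :+ (l :+ l :+ (l :+ l)) :+ :1
             j′ c = c :+ (:1 :+ (l :+ l) :+ (:1 :+ (l :+ l))) :+ :1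
             f = j n :* j′ n :* (j (:- n) :* j′ (:- n)) in
             (o :* o :+ con (+ 2) :* (n :* n) :* x) :* f :=
             o :* j :0 :* j′ :0 :* (o :* j :0 :* j′ :0) :+ con (+ 2) :* (n :* n) :* (x :* f
                :+ o :* o :* (con (+ 2) :* (h :* h) :- (con (+ 16) :* (l :* l) :+ con (+ 16) :* l :+ con (+ 5))))) ≡.refl O x h (+ l) ⟩
      _ ∎)
    where
    n = h + h
    K = + (l ℕ.+ l)
    K′ = + suc (l ℕ.+ l)
    P = oddStep (l ℕ.+ l) n
    Q = oddStep (l ℕ.+ l) (- n)
    O = oddStep (l ℕ.+ l) (+ 0)
    F = (n + (K + K) + + 1) * (n + (K′ + K′) + + 1) * ((- n + (K + K) + + 1) * (- n + (K′ + K′) + + 1))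

  module _ {H s : Ser} (isH : IsFraction (+ 1) H) (isS : IsLogDerivative H s) where

    r : Ser
    r n = one n - (s n + s n)

    r-suc : ∀ n → r (suc n) ≡ - (+ 2) * s (suc n)
    r-suc n = solve 1 (λ x → :0 :- (x :+ x) := (:- con (+ 2)) :* x) ≡.refl (s (suc n))

    s-0 : s 0 ≡ + 0
    s-0 = begin
      s 0 ≡⟨ ≡.sym (ℤ.*-identityˡ _) ⟩
      + 1 * s 0 ≡⟨ ≡.cong (_* s 0) (≡.sym (constantTerm isH)) ⟩
      H 0 * s 0 ≡⟨ Series.at isS 0 ⟩
      + 0 * H 0 ≡⟨ ℤ.*-zeroˡ (H 0) ⟩
      + 0 ∎

    r-0 : r 0 ≡ + 1
    r-0 = ≡.cong (λ x → + 1 - (x + x)) s-0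

    r-step : ∀ n → + suc n * r (suc n) ≡ - ((+ 4 * + n + + 2) * r n)
    r-step n = begin
      + suc n * r (suc n) ≡⟨ solve 2 (λ x y → x := (x :+ y) :- y) ≡.refl _ ((+ 4 * + n + + 2) * r n) ⟩
      (+ suc n * r (suc n) + (+ 4 * + n + + 2) * r n) - (+ 4 * + n + + 2) * r n
                            ≡⟨ ≡.cong (_- (+ 4 * + n + + 2) * r n) rec ⟩
      + 0 - (+ 4 * + n + + 2) * r n
                            ≡⟨ ℤ.+-identityˡ _ ⟩
      - ((+ 4 * + n + + 2) * r n) ∎
      where
      rec : + suc n * r (suc n) + (+ 4 * + n + + 2) * r n ≡ + 0
      rec = ≡.subst₂ (λ a b → a * r (suc n) + (+ 4 * b + + 2) * r n ≡ + 0) (nat≡+ (suc n)) (nat≡+ n)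
              (CentralBinomial.recurrence ℤring isH isS n)

    -- In binomials: C(4k, 2k) / C(2k, k) = (4k - 1)!! / (2k - 1)!!², cleared of denominators.
    r-double : ∀ k → oddStep k (+ 0) * oddStep k (+ 0) * r (k ℕ.+ k) ≡ (- + 1) ^ k * r k * oddStep (k ℕ.+ k) (+ 0)
    r-double zero = ≡.trans (≡.cong (λ x → + 1 * + 1 * x) r-0) (≡.sym (≡.cong (λ x → + 1 * x * + 1) r-0))
    -- Two steps of the recurrence from 2k against one from k leave the common factor 2 (k + 1).
    r-double (suc k) rewrite ℕ.+-suc k k = ℤ.*-cancelˡ-≡ (+ 2 * + suc k) _ _ (begin
        + 2 * + suc k * (e * j * (e * j) * r″)
          ≡⟨ solve 4 (λ k e j x → con (+ 2) :* (:1 :+ k) :* (e :* j :* (e :* j) :* x) := e :* e :* j :* j :* ((:1 :+ (:1 :+ (k :+ k))) :* x)) ≡.refl K e j r″ ⟩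
        e * e * j * j * (+ suc (suc (k ℕ.+ k)) * r″)
          ≡⟨ ≡.cong (e * e * j * j *_) (r-step (suc (k ℕ.+ k))) ⟩
        e * e * j * j * - ((+ 4 * + suc (k ℕ.+ k) + + 2) * r′)
          ≡⟨ solve 3 (λ k e x → e :* e :* (:0 :+ (k :+ k) :+ :1) :* (:0 :+ (k :+ k) :+ :1) :* (:- ((con (+ 4) :* (:1 :+ (k :+ k)) :+ con (+ 2)) :* x))
               := :- (e :* e :* (:0 :+ (k :+ k) :+ :1) :* (con (+ 4) :* (:1 :+ (k :+ k)) :+ con (+ 2)) :* ((:1 :+ (k :+ k)) :* x))) ≡.refl K e r′ ⟩
        - (e * e * j * (+ 4 * + suc (k ℕ.+ k) + + 2) * (+ suc (k ℕ.+ k) * r′))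
          ≡⟨ ≡.cong (λ x → - (e * e * j * (+ 4 * + suc (k ℕ.+ k) + + 2) * x)) (r-step (k ℕ.+ k)) ⟩
        - (e * e * j * (+ 4 * + suc (k ℕ.+ k) + + 2) * - ((+ 4 * + (k ℕ.+ k) + + 2) * r (k ℕ.+ k)))
          ≡⟨ solve 3 (λ k e x → :- (e :* e :* (:0 :+ (k :+ k) :+ :1) :* (con (+ 4) :* (:1 :+ (k :+ k)) :+ con (+ 2)) :* (:- ((con (+ 4) :* (k :+ k) :+ con (+ 2)) :* x)))
               := con (+ 2) :* (con (+ 4) :* k :+ con (+ 2)) :* (con (+ 4) :* k :+ con (+ 3)) :* (con (+ 4) :* k :+ :1) :* (e :* e :* x)) ≡.refl K e (r (k ℕ.+ k)) ⟩
        + 2 * (+ 4 * K + + 2) * (+ 4 * K + + 3) * (+ 4 * K + + 1) * (e * e * r (k ℕ.+ k))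
          ≡⟨ ≡.cong (+ 2 * (+ 4 * K + + 2) * (+ 4 * K + + 3) * (+ 4 * K + + 1) *_) (r-double k) ⟩
        + 2 * (+ 4 * K + + 2) * (+ 4 * K + + 3) * (+ 4 * K + + 1) * (ε * r k * o)
          ≡⟨ solve 4 (λ k ε x o → con (+ 2) :* (con (+ 4) :* k :+ con (+ 2)) :* (con (+ 4) :* k :+ con (+ 3)) :* (con (+ 4) :* k :+ :1) :* (ε :* x :* o)
               := con (+ 2) :* ((:- :1) :* ε :* (:- ((con (+ 4) :* k :+ con (+ 2)) :* x))) :* (o :* (:0 :+ ((k :+ k) :+ (k :+ k)) :+ :1) :* (:0 :+ ((:1 :+ (k :+ k)) :+ (:1 :+ (k :+ k))) :+ :1))) ≡.refl K ε (r k) o ⟩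
        + 2 * (- + 1 * ε * - ((+ 4 * K + + 2) * r k)) * O
          ≡⟨ ≡.cong (λ x → + 2 * (- + 1 * ε * x) * O) (≡.sym (r-step k)) ⟩
        + 2 * (- + 1 * ε * (+ suc k * r (suc k))) * O
          ≡⟨ solve 4 (λ k ε x o → con (+ 2) :* ((:- :1) :* ε :* (k :* x)) :* o := con (+ 2) :* k :* ((:- :1) :* ε :* x :* o)) ≡.refl (+ suc k) ε (r (suc k)) O ⟩
        + 2 * + suc k * (- + 1 * ε * r (suc k) * O) ∎)
      where
      K = + k
      e = oddStep k (+ 0)
      j = + 0 + (K + K) + + 1
      ε = (- + 1) ^ k
      o = oddStep (k ℕ.+ k) (+ 0)
      O = oddStep (suc (suc (k ℕ.+ k))) (+ 0)
      r′ = r (suc (k ℕ.+ k))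
      r″ = r (suc (suc (k ℕ.+ k)))

    -- At positive indices r = -2s, and (4k - 1)!! splits into (2k - 1)!! and the k factors that
    -- follow it. Positivity of k excludes r₀ = 1.
    s-double : ∀ k → 0 ℕ.< k → let e = oddStep k (+ 0) in
      e * e * (s (k ℕ.+ k) - s k) ≡ s k * ((- + 1) ^ k * (e * oddStep k (+ k + + k)) - e * e)
    s-double k@(suc k-1) _ = ℤ.*-cancelˡ-≡ (- (+ 2)) _ _ (begin
        - (+ 2) * (e * e * (s (k ℕ.+ k) - s k))
          ≡⟨ solve 3 (λ e x y → (:- con (+ 2)) :* (e :* e :* (x :- y)) := e :* e :* ((:- con (+ 2)) :* x) :- e :* e :* ((:- con (+ 2)) :* y)) ≡.refl e (s (k ℕ.+ k)) (s k) ⟩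
        e * e * (- (+ 2) * s (k ℕ.+ k)) - e * e * (- (+ 2) * s k)
          ≡⟨ ≡.cong₂ (λ x y → e * e * x - e * e * y) (≡.sym (r-suc _)) (≡.sym (r-suc k-1)) ⟩
        e * e * r (k ℕ.+ k) - e * e * r k
          ≡⟨ ≡.cong (_- e * e * r k) (r-double k) ⟩
        ε * r k * oddStep (k ℕ.+ k) (+ 0) - e * e * r k
          ≡⟨ ≡.cong (λ x → ε * r k * x - e * e * r k) (≡.trans (oddStep-+ k k (+ 0)) (≡.cong (λ c → e * oddStep k c) (ℤ.+-identityˡ (+ k + + k)))) ⟩
        ε * r k * (e * O) - e * e * r k
          ≡⟨ ≡.cong (λ x → ε * x * (e * O) - e * e * x) (r-suc k-1) ⟩
        ε * (- (+ 2) * s k) * (e * O) - e * e * (- (+ 2) * s k)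
          ≡⟨ solve 4 (λ ε x e o → ε :* ((:- con (+ 2)) :* x) :* (e :* o) :- e :* e :* ((:- con (+ 2)) :* x) := (:- con (+ 2)) :* (x :* (ε :* (e :* o) :- e :* e))) ≡.refl ε (s k) e O ⟩
        - (+ 2) * (s k * (ε * (e * O) - e * e)) ∎)
      where
      e = oddStep k (+ 0)
      ε = (- + 1) ^ k
      O = oddStep k (+ k + + k)

    -- For n = 2l + 1 the recurrence becomes n s_n = -2 (4l + 1) s_(2l) with n odd. At l = 0 this
    -- fails, since r₀ = 1 is not -2 s₀.
    s-odd-even : ∀ l → 0 ℕ.< l → Σ ℤ λ x → s (suc (l ℕ.+ l)) ≡ + 2 * x
    s-odd-even l@(suc _) _ = 2^∣-odd-cancel 1 {a = + suc (l ℕ.+ l)} (+ l , ≡.refl)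
        (ℤ.*-cancelˡ-≡ (- (+ 2)) _ (+ 2 * y) (begin
      - (+ 2) * (+ suc (l ℕ.+ l) * s (suc (l ℕ.+ l))) ≡⟨ solve 2 (λ a x → (:- con (+ 2)) :* (a :* x) := a :* ((:- con (+ 2)) :* x)) ≡.refl (+ suc (l ℕ.+ l)) _ ⟩
      + suc (l ℕ.+ l) * (- (+ 2) * s (suc (l ℕ.+ l))) ≡⟨ ≡.cong (+ suc (l ℕ.+ l) *_) (≡.sym (r-suc (l ℕ.+ l))) ⟩
      + suc (l ℕ.+ l) * r (suc (l ℕ.+ l)) ≡⟨ r-step (l ℕ.+ l) ⟩
      - ((+ 4 * + (l ℕ.+ l) + + 2) * r (l ℕ.+ l)) ≡⟨ ≡.cong (λ x → - ((+ 4 * + (l ℕ.+ l) + + 2) * x)) (r-suc _) ⟩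
      - ((+ 4 * + (l ℕ.+ l) + + 2) * (- (+ 2) * s (l ℕ.+ l)))
        ≡⟨ solve 2 (λ l x → :- ((con (+ 4) :* l :+ con (+ 2)) :* ((:- con (+ 2)) :* x)) := (:- con (+ 2)) :* (con (+ 2) :* (:- ((con (+ 2) :* l :+ :1) :* x)))) ≡.refl (+ (l ℕ.+ l)) (s (l ℕ.+ l)) ⟩
      - (+ 2) * (+ 2 * y) ∎))
      where y = - ((+ 2 * + (l ℕ.+ l) + + 1) * s (l ℕ.+ l))

    private
      e-odd : ∀ k → Odd (oddStep k (+ 0) * oddStep k (+ 0))
      e-odd k = odd-* (oddStep-odd k (+ 0)) (oddStep-odd k (+ 0))

    -- Put n = 2k. Since k is even, reversal gives `oddStep k (- n)` = (2k - 1)!!. Hence `oddStep-±`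
    -- compares (2k - 1)!! · `oddStep k n` with (2k - 1)!!² modulo 2n².
    s-even-difference : ∀ l → 0 ℕ.< l → let k = l ℕ.+ l ; e = oddStep k (+ 0) in
      Σ ℤ λ x → e * e * (s (k ℕ.+ k) - s k) ≡ + 2 * ((+ k + + k) * (+ k + + k)) * x
    s-even-difference l 0<l = s k * x , (begin
        e * e * (s (k ℕ.+ k) - s k) ≡⟨ s-double k (ℕ.<-≤-trans 0<l (ℕ.m≤m+n l l)) ⟩
        s k * ((- + 1) ^ k * (e * O) - e * e) ≡⟨ ≡.cong (λ z → s k * (z * (e * O) - e * e)) ([-1]^2m l) ⟩
        s k * (+ 1 * (e * O) - e * e) ≡⟨ ≡.cong (λ z → s k * (z - e * e)) eO ⟩
        s k * ((e * e + N * x) - e * e) ≡⟨ solve 4 (λ s e n x → s :* ((e :* e :+ n :* x) :- e :* e) := n :* (s :* x)) ≡.refl (s k) e N x ⟩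
        N * (s k * x) ∎)
      where
      k = l ℕ.+ l
      e = oddStep k (+ 0)
      O = oddStep k (+ k + + k)
      N = + 2 * ((+ k + + k) * (+ k + + k))
      x = proj₁ (oddStep-± (+ k) l)
      reversed : oddStep k (- (+ k + + k)) ≡ e
      reversed = begin
        oddStep k (- (+ k + + k)) ≡⟨ oddStep-reverse k (- (+ k + + k)) ⟩
        (- + 1) ^ k * oddStep k (- - (+ k + + k) - (+ k + + k)) ≡⟨ ≡.cong₂ (λ z c → z * oddStep k c) ([-1]^2m l) (solve 1 (λ n → :- (:- n) :- n := :0) ≡.refl (+ k + + k)) ⟩
        + 1 * e ≡⟨ ℤ.*-identityˡ e ⟩
        e ∎
      eO : + 1 * (e * O) ≡ e * e + N * x
      eO = begin
        + 1 * (e * O) ≡⟨ solve 2 (λ e o → :1 :* (e :* o) := o :* e) ≡.refl e O ⟩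
        O * e ≡⟨ ≡.cong (O *_) (≡.sym reversed) ⟩
        O * oddStep k (- (+ k + + k)) ≡⟨ proj₂ (oddStep-± (+ k) l) ⟩
        e * e + N * x ∎

    -- As k is odd, 2k is 2 modulo 4, so the k odd factors after (2k - 1)!! multiply to (2k + 1)!! =
    -- (2k - 1)!! (2k + 1) modulo 4. Adding (2k - 1)!! yields the factor 2k + 2, divisible by 4, and
    -- the even s_k supplies the remaining 2.
    s-odd-difference : ∀ l → 0 ℕ.< l → let k = suc (l ℕ.+ l) ; e = oddStep k (+ 0) in
      Σ ℤ λ x → e * e * (s (k ℕ.+ k) - s k) ≡ + 8 * x
    s-odd-difference l 0<l = - (y * (e * (e * (L + + 1) + x))) , (begin
        e * e * (s (k ℕ.+ k) - s k) ≡⟨ s-double k (s≤s z≤n) ⟩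
        s k * ((- + 1) ^ k * (e * O) - e * e) ≡⟨ ≡.cong₂ (λ u z → u * (z * (e * O) - e * e)) (proj₂ (s-odd-even l 0<l)) (≡.cong (- + 1 *_) ([-1]^2m l)) ⟩
        + 2 * y * (- + 1 * + 1 * (e * O) - e * e) ≡⟨ ≡.cong (λ u → + 2 * y * (- + 1 * + 1 * (e * u) - e * e)) O≡ ⟩
        + 2 * y * (- + 1 * + 1 * (e * (e * (+ 0 + (K + K) + + 1) + + 4 * x)) - e * e)
          ≡⟨ solve 4 (λ y e l x → con (+ 2) :* y :* ((:- :1) :* :1 :* (e :* (e :* (:0 :+ ((:1 :+ (l :+ l)) :+ (:1 :+ (l :+ l))) :+ :1) :+ con (+ 4) :* x)) :- e :* e)
                := con (+ 8) :* (:- (y :* (e :* (e :* (l :+ :1) :+ x))))) ≡.refl y e L x ⟩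
        + 8 * - (y * (e * (e * (L + + 1) + x))) ∎)
      where
      k = suc (l ℕ.+ l)
      K = + k
      L = + l
      e = oddStep k (+ 0)
      O = oddStep k (+ k + + k)
      y = proj₁ (s-odd-even l 0<l)
      x = proj₁ (oddStep-mod4 k (+ 2) L)
      O≡ : O ≡ e * (+ 0 + (K + K) + + 1) + + 4 * x
      O≡ = begin
        O ≡⟨ ≡.cong (oddStep k) (solve 1 (λ l → (:1 :+ (l :+ l)) :+ (:1 :+ (l :+ l)) := con (+ 2) :+ con (+ 4) :* l) ≡.refl L) ⟩
        oddStep k (+ 2 + + 4 * L) ≡⟨ proj₂ (oddStep-mod4 k (+ 2) L) ⟩
        oddStep k (+ 2) + + 4 * x ≡⟨ ≡.cong (_+ + 4 * x) (≡.trans (≡.sym (ℤ.*-identityˡ _)) (≡.sym (oddStep-front k (+ 0)))) ⟩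
        oddStep (suc k) (+ 0) + + 4 * x ∎

    -- One factor 2^v is the value of [2^v] at 1, the other is the power of 2 in D = 2^v [2^v] E,
    -- and the last 2 is the parity of E(1). The cases are n odd, where the `σ` term vanishes; n
    -- twice an odd number; and n divisible by 4, where 2n² contains the required power of 2.
    s-congruence : ∀ v l → 3 ℕ.≤ 2 ℕ.^ v ℕ.* suc (l ℕ.+ l) →
      Σ ℤ λ x → s (2 ℕ.^ v ℕ.* suc (l ℕ.+ l)) - σ s (2 ℕ.^ v ℕ.* suc (l ℕ.+ l)) ≡ two ^ v * (two ^ v * (+ 2 * x))
    s-congruence zero    zero    (s≤s ())
    s-congruence zero    (suc l) _ = ≡.subst (λ n → Σ ℤ λ x → s n - σ s n ≡ + 1 * (+ 1 * (+ 2 * x)))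
        (≡.sym (ℕ.+-identityʳ (suc (suc l ℕ.+ suc l)))) (proj₁ half , (begin
      s m - σ s m ≡⟨ ≡.cong₂ _-_ (proj₂ half) (σ-odd s (suc l)) ⟩
      + 2 * proj₁ half - + 0 ≡⟨ solve 1 (λ x → con (+ 2) :* x :- :0 := :1 :* (:1 :* (con (+ 2) :* x))) ≡.refl (proj₁ half) ⟩
      + 1 * (+ 1 * (+ 2 * proj₁ half)) ∎))
      where
      m = suc (suc l ℕ.+ suc l)
      half = s-odd-even (suc l) (s≤s z≤n)
    s-congruence (suc w) l 3≤n = go w 3≤n
      where
      m = suc (l ℕ.+ l)
      goal : ℕ → ℕ → Set
      goal w n = Σ ℤ λ x → s n - σ s n ≡ two ^ suc w * (two ^ suc w * (+ 2 * x))
      from-half : ∀ w k → Σ ℤ (λ z → s (k ℕ.+ k) - s k ≡ two ^ suc w * (two ^ suc w * (+ 2 * z))) → goal w (k ℕ.+ k)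
      from-half w k (z , e) = z , ≡.trans (≡.cong (λ u → s (k ℕ.+ k) - u) (σ-double s k)) e
      regroup : ∀ w y → two ^ (suc w ℕ.+ suc w ℕ.+ 1) * y ≡ two ^ suc w * (two ^ suc w * (+ 2 * y))
      regroup w y = begin
        two ^ (suc w ℕ.+ suc w ℕ.+ 1) * y ≡⟨ ≡.cong (_* y) (RingTools.^-homo-* ℤring two (suc w ℕ.+ suc w) 1) ⟩
        two ^ (suc w ℕ.+ suc w) * two ^ 1 * y ≡⟨ ≡.cong (λ u → u * two ^ 1 * y) (RingTools.^-homo-* ℤring two (suc w) (suc w)) ⟩
        two ^ suc w * two ^ suc w * + 2 * y ≡⟨ solve 2 (λ p y → p :* p :* con (+ 2) :* y := p :* (p :* (con (+ 2) :* y))) ≡.refl (two ^ suc w) y ⟩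
        two ^ suc w * (two ^ suc w * (+ 2 * y)) ∎
      cancel : ∀ w k y → oddStep k (+ 0) * oddStep k (+ 0) * (s (k ℕ.+ k) - s k) ≡ two ^ suc w * (two ^ suc w * (+ 2 * y)) →
        goal w (k ℕ.+ k)
      cancel w k y e = from-half w k (proj₁ z , ≡.trans (proj₂ z) (regroup w (proj₁ z)))
        where z = 2^∣-odd-cancel (suc w ℕ.+ suc w ℕ.+ 1) (e-odd k) (≡.trans e (≡.sym (regroup w y)))
      go : ∀ w → 3 ℕ.≤ 2 ℕ.^ suc w ℕ.* m → goal w (2 ℕ.^ suc w ℕ.* m)
      go zero 3≤ = ≡.subst (goal 0) (≡.cong (m ℕ.+_) (≡.sym (ℕ.+-identityʳ m))) (odd l (≡.subst (3 ℕ.≤_) (≡.cong (m ℕ.+_) (ℕ.+-identityʳ m)) 3≤))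
        where
        odd : ∀ l → 3 ℕ.≤ suc (l ℕ.+ l) ℕ.+ suc (l ℕ.+ l) → goal 0 (suc (l ℕ.+ l) ℕ.+ suc (l ℕ.+ l))
        odd zero    (s≤s (s≤s ()))
        odd (suc l) _ = cancel 0 (suc (suc l ℕ.+ suc l)) x (≡.trans e (solve 1 (λ x → con (+ 8) :* x := con (+ 2) :* (con (+ 2) :* (con (+ 2) :* x))) ≡.refl x))
          where
          x = proj₁ (s-odd-difference (suc l) (s≤s z≤n))
          e = proj₂ (s-odd-difference (suc l) (s≤s z≤n))
      go (suc w) _ = ≡.subst (goal (suc w)) index (cancel (suc w) k (M * M * x) (≡.trans e (begin
          + 2 * ((+ k + + k) * (+ k + + k)) * x ≡⟨ ≡.cong (λ u → + 2 * (u * u) * x) k+k ⟩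
          + 2 * (q * M * (q * M)) * x ≡⟨ solve 3 (λ q m x → con (+ 2) :* (q :* m :* (q :* m)) :* x := q :* (q :* (con (+ 2) :* (m :* m :* x)))) ≡.refl q M x ⟩
          q * (q * (+ 2 * (M * M * x))) ∎)))
        where
        h = 2 ℕ.^ w ℕ.* m
        k = h ℕ.+ h
        M = + m
        q = two ^ suc (suc w)
        0<h : 0 ℕ.< h
        0<h = ℕ.>-nonZero⁻¹ h {{ℕ.m*n≢0 (2 ℕ.^ w) m {{ℕ.m^n≢0 2 w}}}}
        x = proj₁ (s-even-difference h 0<h)
        e = proj₂ (s-even-difference h 0<h)
        index : k ℕ.+ k ≡ 2 ℕ.^ suc (suc w) ℕ.* m
        index = ℕS.solve 2 (λ p m → (p ℕS.:* m ℕS.:+ p ℕS.:* m) ℕS.:+ (p ℕS.:* m ℕS.:+ p ℕS.:* m) ℕS.:= (ℕS.con 2 ℕS.:* (ℕS.con 2 ℕS.:* p)) ℕS.:* m) ≡.refl (2 ℕ.^ w) m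
        2^≡ : ∀ v → + (2 ℕ.^ v) ≡ two ^ v
        2^≡ v = ≡.trans (≡.sym (nat≡+ (2 ℕ.^ v))) (TwoAdic.nat-2^ ℤring v)
        k+k : + k + + k ≡ q * M
        k+k = ≡.trans (≡.cong +_ index) (≡.trans (ℤ.pos-* (2 ℕ.^ suc (suc w)) m) (≡.cong (_* M) (2^≡ (suc (suc w)))))

-- The logarithm and its derivative

module FormalLogarithm {c ℓ : Level} (K : CommutativeRing c ℓ) (recip : ℕ → CommutativeRing.Carrier K)
  (recip-inverse : ∀ j → CommutativeRing._≈_ K (CommutativeRing._*_ K (RingTools.nat K (suc j)) (recip j)) (CommutativeRing.1# K)) where
  open CommutativeRing K
  open RingTools K
  open Series K
  open SeriesEquations K
  private
    module S = CommutativeRing seriesRing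
    module ST = RingTools seriesRing

  sum : ℕ → (ℕ → Carrier) → Carrier
  sum zero    a = a 0
  sum (suc n) a = sum n a + a (suc n)

  sum-cong : ∀ n {a b : ℕ → Carrier} → (∀ j → a j ≈ b j) → sum n a ≈ sum n b
  sum-cong zero    e = e 0
  sum-cong (suc n) e = +-cong (sum-cong n e) (e (suc n))

  sum-*ˡ : ∀ x n a → x * sum n a ≈ sum n (λ j → x * a j)
  sum-*ˡ x zero    a = refl
  sum-*ˡ x (suc n) a = trans (distribˡ x _ _) (+-congʳ (sum-*ˡ x n a))

  dropHead : Ser → Ser
  dropHead f zero    = 0#
  dropHead f (suc n) = f (suc n)

  log : Ser → Ser
  log f zero    = 0#
  log f (suc n) = sum n (λ j → ((- 1#) ^ j * recip j) * (dropHead f ST.^ suc j) (suc n))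

  θ-power : ∀ g j n → θ (g ST.^ suc j) n ≈ nat (suc j) * ((g ST.^ j) ⊗ θ g) n
  θ-power g zero    n = begin
      θ (g ⊗ one) n ≈⟨ at (θ-cong (S.*-identityʳ g)) n ⟩
      θ g n ≈⟨ sym (⊗-identityˡ (θ g) n) ⟩
      (one ⊗ θ g) n ≈⟨ solve 1 (λ x → x := (:1 :+ :0) :* x) refl _ ⟩
      nat 1 * (one ⊗ θ g) n ∎
    where open SetoidReasoning setoid
  θ-power g (suc j) n = begin
      θ (g ⊗ g ST.^ suc j) n
        ≈⟨ at (θ-⊗ g (g ST.^ suc j)) n ⟩
      (θ g ⊗ g ST.^ suc j) n + (g ⊗ θ (g ST.^ suc j)) n
        ≈⟨ +-congˡ (⊗-cong-≤ n (λ _ → refl) (λ {i} _ → θ-power g j i)) ⟩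
      (θ g ⊗ g ST.^ suc j) n + (g ⊗ (nat (suc j) · (g ST.^ j ⊗ θ g))) n
        ≈⟨ +-congˡ (trans (⊗-comm g (nat (suc j) · (g ST.^ j ⊗ θ g)) n) (·-⊗ (nat (suc j)) (g ST.^ j ⊗ θ g) g n)) ⟩
      (θ g ⊗ g ST.^ suc j) n + nat (suc j) * ((g ST.^ j ⊗ θ g) ⊗ g) n
        ≈⟨ +-cong (⊗-comm (θ g) (g ST.^ suc j) n) (*-congˡ (at rearrange n)) ⟩
      (g ST.^ suc j ⊗ θ g) n + nat (suc j) * (g ST.^ suc j ⊗ θ g) n
        ≈⟨ solve 2 (λ k x → x :+ k :* x := (:1 :+ k) :* x) refl (nat (suc j)) _ ⟩
      nat (suc (suc j)) * (g ST.^ suc j ⊗ θ g) n ∎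
    where
    open SetoidReasoning setoid
    rearrange : (g ST.^ j ⊗ θ g) ⊗ g ≋ g ST.^ suc j ⊗ θ g
    rearrange = ST.solve 3 (λ p t g → p ST.:* t ST.:* g ST.:= g ST.:* p ST.:* t) S.refl (g ST.^ j) (θ g) g

  module _ (f : Ser) (f₀ : f 0 ≈ 1#) where
    private
      g = dropHead f

      term : ℕ → Ser
      term j = (- 1#) ^ j · (g ST.^ j ⊗ θ g)

      partial : ℕ → Ser
      partial zero    = term 0
      partial (suc k) = partial k ⊕ term (suc k)

      partial-sum : ∀ k n → sum k (λ j → term j n) ≈ partial k n
      partial-sum zero    n = refl
      partial-sum (suc k) n = +-congʳ (partial-sum k n)

      power-low : ∀ j → VanishesBelow j (g ST.^ j)
      power-low (suc j) {i} (s≤s i≤j) = trans (⊗-comm g (g ST.^ j) i)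
        (trans (⊗-lowest i (g ST.^ j) g (λ k<i → power-low j (ℕ.<-≤-trans k<i i≤j))) (zeroʳ _))

      g^jθg-low : ∀ j k → k ℕ.≤ j → (g ST.^ j ⊗ θ g) k ≈ 0#
      g^jθg-low j k k≤j = trans (⊗-lowest k (g ST.^ j) (θ g) (λ i<k → power-low j (ℕ.<-≤-trans i<k k≤j)))
                               (trans (*-congˡ (zeroˡ _)) (zeroʳ _))

      term-low : ∀ j k → k ℕ.≤ j → term j k ≈ 0#
      term-low j k k≤j = trans (*-congˡ (g^jθg-low j k k≤j)) (zeroʳ _)

      -- As g has no constant term, g^j θ g starts beyond degree j, so later terms leave coefficient
      -- k + 1 alone.
      partial-stable : ∀ k d → partial (d ℕ.+ k) (suc k) ≈ partial k (suc k)
      partial-stable k zero    = refl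
      partial-stable k (suc d) = trans (+-cong (partial-stable k d) (term-low (suc d ℕ.+ k) (suc k) (s≤s (ℕ.m≤n+m k d))))
                                       (+-identityʳ _)

      partial-0 : ∀ k → partial k 0 ≈ 0#
      partial-0 zero    = term-low 0 0 z≤n
      partial-0 (suc k) = trans (+-cong (partial-0 k) (term-low (suc k) 0 z≤n)) (+-identityʳ _)

      θlog : ∀ n → θ (log f) (suc n) ≈ partial n (suc n)
      θlog n = begin
          nat (suc n) * log f (suc n)
            ≈⟨ sum-*ˡ (nat (suc n)) n _ ⟩
          sum n (λ j → nat (suc n) * (((- 1#) ^ j * recip j) * (g ST.^ suc j) (suc n)))
            ≈⟨ sum-cong n (λ j → begin
                 nat (suc n) * (((- 1#) ^ j * recip j) * (g ST.^ suc j) (suc n))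
                   ≈⟨ solve 4 (λ k s r x → k :* ((s :* r) :* x) := (s :* r) :* (k :* x)) refl (nat (suc n)) ((- 1#) ^ j) (recip j) ((g ST.^ suc j) (suc n)) ⟩
                 ((- 1#) ^ j * recip j) * θ (g ST.^ suc j) (suc n)
                   ≈⟨ *-congˡ (θ-power g j (suc n)) ⟩
                 ((- 1#) ^ j * recip j) * (nat (suc j) * (g ST.^ j ⊗ θ g) (suc n))
                   ≈⟨ solve 4 (λ s r k x → (s :* r) :* (k :* x) := s :* (k :* r) :* x) refl ((- 1#) ^ j) (recip j) (nat (suc j)) ((g ST.^ j ⊗ θ g) (suc n)) ⟩
                 (- 1#) ^ j * (nat (suc j) * recip j) * (g ST.^ j ⊗ θ g) (suc n)
                   ≈⟨ *-congʳ (trans (*-congˡ (recip-inverse j)) (*-identityʳ _)) ⟩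
                 term j (suc n) ∎) ⟩
          sum n (λ j → term j (suc n))
            ≈⟨ partial-sum n (suc n) ⟩
          partial n (suc n) ∎
        where open SetoidReasoning setoid

      θlog≈partial : ∀ n {k} → k ℕ.≤ n → θ (log f) k ≈ partial n k
      θlog≈partial n {zero}  _   = trans (zeroˡ _) (sym (partial-0 n))
      θlog≈partial n {suc k} k<n = trans (θlog k) (trans (sym (partial-stable k (n ℕ.∸ k)))
        (reflexive (≡.cong (λ i → partial i (suc k)) (ℕ.m∸n+n≡m (ℕ.<⇒≤ k<n)))))

      -- The finite geometric series in -g, multiplied by θ g. The remainder has no coefficient of
      -- degree at most k + 1.
      telescope : ∀ k → (one ⊕ g) ⊗ partial k ≋ θ g ⊕ (- 1#) ^ k · (g ST.^ suc k ⊗ θ g)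
      telescope zero    = coeffs λ n → begin
          ((one ⊕ g) ⊗ term 0) n ≈⟨ ⊗-cong-≤ n (λ _ → refl) (λ {i} _ → trans (*-identityˡ _) (⊗-identityˡ (θ g) i)) ⟩
          ((one ⊕ g) ⊗ θ g) n ≈⟨ ⊗-distribʳ (θ g) one g n ⟩
          (one ⊗ θ g) n + (g ⊗ θ g) n ≈⟨ +-cong (⊗-identityˡ (θ g) n) (trans (at (⊗-cong (S.sym (S.*-identityʳ g)) (S.refl {θ g})) n) (sym (*-identityˡ _))) ⟩
          θ g n + 1# * (g ST.^ 1 ⊗ θ g) n ∎
        where open SetoidReasoning setoid
      telescope (suc k) = coeffs λ n → begin
          ((one ⊕ g) ⊗ (partial k ⊕ term (suc k))) n
            ≈⟨ at (S.distribˡ (one ⊕ g) (partial k) (term (suc k))) n ⟩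
          ((one ⊕ g) ⊗ partial k) n + ((one ⊕ g) ⊗ term (suc k)) n
            ≈⟨ +-cong (at (telescope k) n) (trans (⊗-comm (one ⊕ g) (term (suc k)) n) (trans (·-⊗ ((- 1#) ^ suc k) (g ST.^ suc k ⊗ θ g) (one ⊕ g) n) (*-congˡ (at (last-term k) n)))) ⟩
          (θ g n + ε k * X n) + ε (suc k) * (X n + (g ST.^ suc (suc k) ⊗ θ g) n)
            ≈⟨ solve 4 (λ t e x y → (t :+ e :* x) :+ ((:- :1) :* e) :* (x :+ y) := t :+ ((:- :1) :* e) :* y) refl (θ g n) (ε k) (X n) _ ⟩
          θ g n + ε (suc k) * (g ST.^ suc (suc k) ⊗ θ g) n ∎
        where
        open SetoidReasoning setoid
        ε : ℕ → Carrier
        ε j = (- 1#) ^ j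
        X = g ST.^ suc k ⊗ θ g
        last-term : ∀ k → (g ST.^ suc k ⊗ θ g) ⊗ (one ⊕ g) ≋ (g ST.^ suc k ⊗ θ g) ⊕ (g ST.^ suc (suc k) ⊗ θ g)
        last-term k = ST.solve 3 (λ p t g → (p ST.:* t) ST.:* (ST.:1 ST.:+ g) ST.:= p ST.:* t ST.:+ (g ST.:* p) ST.:* t) S.refl (g ST.^ suc k) (θ g) g

    -- θ log f is the sum of (-g)^j θ g with g = f - 1, because the factor j + 1 from θ cancels 1/(j
    -- + 1). `telescope` at k = n then yields the claim in coefficient n.
    log-derivative : IsLogDerivative f (θ (log f))
    log-derivative = coeffs λ n → begin
        (f ⊗ θ (log f)) n ≈⟨ ⊗-cong-≤ n (λ {i} _ → f≈1+g i) (θlog≈partial n) ⟩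
        ((one ⊕ g) ⊗ partial n) n ≈⟨ at (telescope n) n ⟩
        θ g n + (- 1#) ^ n * (g ST.^ suc n ⊗ θ g) n ≈⟨ +-cong (θg≈θf n) (trans (*-congˡ (g^jθg-low (suc n) n (ℕ.n≤1+n n))) (zeroʳ _)) ⟩
        θ f n + 0# ≈⟨ +-identityʳ _ ⟩
        θ f n ∎
      where
      open SetoidReasoning setoid
      f≈1+g : ∀ i → f i ≈ one i + g i
      f≈1+g zero    = trans f₀ (sym (+-identityʳ _))
      f≈1+g (suc i) = sym (+-identityˡ _)
      θg≈θf : ∀ n → θ g n ≈ θ f n
      θg≈θf zero    = trans (zeroˡ _) (sym (zeroˡ _))
      θg≈θf (suc n) = refl

-- From the q-series to the continued fraction

module EulerSeries {c ℓ : Level} (K : CommutativeRing c ℓ) where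
  open CommutativeRing K
  open RingTools K
  open TwoAdic K using (1^)
  open Series K
  open SeriesEquations K
  private
    module S = CommutativeRing seriesRing
    module ST = RingTools seriesRing

  -- Since (Q;Q)_n = (-1)^n Q^(n(n+1)/2) (P;P)_n for P = 1/Q, this is Σ P^(n²) zⁿ / (P;P)_n.
  IsEulerSeries : Carrier → Ser → Set _
  IsEulerSeries Q F = ∀ n → F (suc n) * (Q ^ n * (Q ^ suc n - 1#)) ≈ F n

  module _ {P Q : Carrier} (PQ≈1 : P * Q ≈ 1#) {F : Ser} (F₀ : F 0 ≈ 1#) (isEuler : IsEulerSeries Q F) where

    P^Q^≈1 : ∀ n → P ^ n * Q ^ n ≈ 1#
    P^Q^≈1 n = trans (sym (^-distrib-* P Q n)) (trans (^-congˡ n PQ≈1) (1^ n))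

    -- Multiplying the recurrence by P^(2n+1) and using PQ = 1 gives (1 - P^(n+1)) F_(n+1) =
    -- P^(2n+1) F_n, the claim in coefficient n + 1.
    three-term : F ≋ scale P F ⊕ linear P ⊗ scale (P * P) F
    three-term = coeffs λ where
        zero    → solve 2 (λ x y → x := :1 :* x :+ :0 :* (:1 :* y)) refl (F 0) (F 0)
        (suc n) → begin
          x (suc n)
            ≈⟨ solve 3 (λ x p q → x := x :* (p :* q) :+ (x :- x :* (p :* q))) refl (x (suc n)) (P ^ suc n) (Q ^ suc n) ⟩
          x (suc n) * (P ^ suc n * Q ^ suc n) + (x (suc n) - x (suc n) * (P ^ suc n * Q ^ suc n))
            ≈⟨ +-cong (trans (*-congˡ (P^Q^≈1 (suc n))) (solve 2 (λ x p → x :* :1 := p :* x :- (p :* x :- x)) refl (x (suc n)) (P ^ suc n)))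
                      (trans (+-congˡ (-‿cong (trans (*-congˡ (P^Q^≈1 (suc n))) (*-identityʳ _)))) (-‿inverseʳ _)) ⟩
          (P ^ suc n * x (suc n) - (P ^ suc n * x (suc n) - x (suc n))) + 0#
            ≈⟨ solve 2 (λ p x → (p :* x :- (p :* x :- x)) :+ :0 := p :* x :+ :1 :* (x :- p :* x)) refl (P ^ suc n) (x (suc n)) ⟩
          P ^ suc n * x (suc n) + 1# * (x (suc n) - P ^ suc n * x (suc n))
            ≈⟨ +-congˡ (*-congʳ (sym (P^Q^≈1 n))) ⟩
          P ^ suc n * x (suc n) + P ^ n * Q ^ n * (x (suc n) - P ^ suc n * x (suc n))
            ≈⟨ +-congˡ (*-congˡ (+-congʳ (trans (sym (*-identityʳ _)) (*-congˡ (sym (P^Q^≈1 (suc n))))))) ⟩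
          P ^ suc n * x (suc n) + P ^ n * Q ^ n * (x (suc n) * (P ^ suc n * Q ^ suc n) - P ^ suc n * x (suc n))
            ≈⟨ solve 6 (λ p pn q qn x u → u :+ pn :* qn :* (x :* (p :* pn :* q) :- p :* pn :* x) := u :+ p :* (pn :* pn :* (x :* (qn :* (q :- :1))))) refl P (P ^ n) (Q ^ suc n) (Q ^ n) (x (suc n)) (P ^ suc n * x (suc n)) ⟩
          P ^ suc n * x (suc n) + P * (P ^ n * P ^ n * (x (suc n) * (Q ^ n * (Q ^ suc n - 1#))))
            ≈⟨ +-congˡ (*-congˡ (*-cong (sym (^-distrib-* P P n)) (isEuler n))) ⟩
          P ^ suc n * x (suc n) + P * ((P * P) ^ n * x n)
            ≈⟨ +-congˡ (sym (linear-⊗ P (scale (P * P) F) n)) ⟩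
          P ^ suc n * x (suc n) + (linear P ⊗ scale (P * P) F) (suc n) ∎
      where
      open SetoidReasoning setoid
      x = F

    -- X = F(z)/F(Pz)
    euler-fraction : ∀ {H} → IsLogDerivative F H → Σ Ser λ X → IsFraction P X × IsLogDerivative X (H S.- scale P H)
    euler-fraction {H} isH = X , record { constantTerm = X₀ ; functional = functional-eq } , log-eq
      where
      open SetoidReasoning S.setoid
      F₁ = scale P F
      F₂ = scale (P * P) F
      F₁₀ : F₁ 0 ≈ 1#
      F₁₀ = trans (*-identityˡ _) F₀
      quot = divide F₁ F F₁₀
      X = proj₁ quot
      sX = scale P X
      F₁X : F₁ ⊗ X ≋ F
      F₁X = proj₂ quot
      F₂sX : F₂ ⊗ sX ≋ F₁
      F₂sX = begin
        F₂ ⊗ sX ≈⟨ S.*-congʳ (S.sym (scale-scale P P F)) ⟩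
        scale P F₁ ⊗ sX ≈⟨ S.sym (scale-⊗ P F₁ X) ⟩
        scale P (F₁ ⊗ X) ≈⟨ scale-cong P F₁X ⟩
        F₁ ∎
      X₀ : X 0 ≈ 1#
      X₀ = trans (sym (*-identityˡ _)) (trans (*-congʳ (sym F₁₀)) (trans (at F₁X 0) F₀))
      functional-eq : X ⊗ sX ≋ sX ⊕ linear P
      -- The three-term relation divided by F₂ = F(P²z): X · X(Pz) is F / F₂ and X(Pz) is F₁ / F₂.
      functional-eq = ⊗-cancelˡ F₂ (trans (*-identityˡ _) F₀) (begin
        F₂ ⊗ (X ⊗ sX) ≈⟨ ST.solve 3 (λ f x s → f ST.:* (x ST.:* s) ST.:= (f ST.:* s) ST.:* x) S.refl F₂ X sX ⟩
        (F₂ ⊗ sX) ⊗ X ≈⟨ S.*-congʳ F₂sX ⟩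
        F₁ ⊗ X ≈⟨ F₁X ⟩
        F ≈⟨ three-term ⟩
        F₁ ⊕ linear P ⊗ F₂ ≈⟨ S.+-congʳ (S.sym F₂sX) ⟩
        F₂ ⊗ sX ⊕ linear P ⊗ F₂ ≈⟨ ST.solve 3 (λ f s l → f ST.:* s ST.:+ l ST.:* f ST.:= f ST.:* (s ST.:+ l)) S.refl F₂ sX (linear P) ⟩
        F₂ ⊗ (sX ⊕ linear P) ∎)
      sH = scale P H
      F₁sH : F₁ ⊗ sH ≋ θ F₁
      F₁sH = S.trans (S.sym (scale-⊗ P F H)) (S.trans (scale-cong P isH)
               (coeffs λ n → solve 3 (λ a b x → a :* (b :* x) := b :* (a :* x)) refl _ (nat n) (F n)))
      log-eq : X ⊗ (H S.- sH) ≋ θ X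
      log-eq = ⊗-cancelˡ F₁ F₁₀ (begin
        F₁ ⊗ (X ⊗ (H S.- sH)) ≈⟨ ST.solve 4 (λ f x h s → f ST.:* (x ST.:* (h ST.:- s)) ST.:= (f ST.:* x) ST.:* h ST.:- (f ST.:* s) ST.:* x) S.refl F₁ X H sH ⟩
        (F₁ ⊗ X) ⊗ H S.- (F₁ ⊗ sH) ⊗ X ≈⟨ S.+-cong (S.trans (S.*-congʳ F₁X) isH) (S.-‿cong (S.*-congʳ F₁sH)) ⟩
        θ F S.- θ F₁ ⊗ X ≈⟨ S.+-congʳ (S.trans (θ-cong (S.sym F₁X)) (θ-⊗ F₁ X)) ⟩
        (θ F₁ ⊗ X ⊕ F₁ ⊗ θ X) S.- θ F₁ ⊗ X ≈⟨ ST.solve 2 (λ a b → (a ST.:+ b) ST.:- a ST.:= b) S.refl (θ F₁ ⊗ X) (F₁ ⊗ θ X) ⟩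
        F₁ ⊗ θ X ∎)

module LowCoefficients {c ℓ : Level} (K : CommutativeRing c ℓ) where
  open CommutativeRing K
  open RingTools K
  open Series K
  open SeriesEquations K

  module _ {t G L} (isG : IsFraction t G) (isL : IsLogDerivative G L) where
    open SetoidReasoning setoid

    -- The solver knows no hypotheses, so the goal is written as a coefficient of the functional
    -- equation minus multiples of G₀ - 1. In `fraction-2` a multiple of G₁ - t is subtracted as
    -- well.
    fraction-1 : G 1 ≈ t
    fraction-1 = x-y≈0⇒x≈y (begin
      G 1 - t
        ≈⟨ solve 3 (λ u a t → a :- t := (u :* (t :* :1 :* a) :+ a :* (:1 :* u) :- (t :* :1 :* a :+ t)) :- (u :- :1) :* (t :* a :+ a)) refl (G 0) (G 1) t ⟩
      ((G ⊗ scale t G) 1 - (scale t G ⊕ linear t) 1) - (G 0 - 1#) * (t * G 1 + G 1)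
        ≈⟨ +-cong (x≈y⇒x-y≈0 (at (functional isG) 1)) (-‿cong (*-congʳ (x≈y⇒x-y≈0 (constantTerm isG)))) ⟩
      0# - 0# * (t * G 1 + G 1)
        ≈⟨ solve 1 (λ x → :0 :- :0 :* x := :0) refl _ ⟩
      0# ∎)

    fraction-2 : G 2 ≈ - (t * t * t)
    fraction-2 = x-y≈0⇒x≈y (begin
      G 2 - - (t * t * t)
        ≈⟨ solve 4 (λ u a b t → b :- :- (t :* t :* t) := ((u :* (t :* (t :* :1) :* b) :+ (a :* (t :* :1 :* a) :+ b :* (:1 :* u))) :- (t :* (t :* :1) :* b :+ :0))
              :- ((u :- :1) :* (t :* t :* b :+ b) :+ (a :- t) :* (t :* (a :+ t)))) refl (G 0) (G 1) (G 2) t ⟩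
      ((G ⊗ scale t G) 2 - (scale t G ⊕ linear t) 2) - ((G 0 - 1#) * (t * t * G 2 + G 2) + (G 1 - t) * (t * (G 1 + t)))
        ≈⟨ +-cong (x≈y⇒x-y≈0 (at (functional isG) 2)) (-‿cong (+-cong (*-congʳ (x≈y⇒x-y≈0 (constantTerm isG))) (*-congʳ (x≈y⇒x-y≈0 fraction-1)))) ⟩
      0# - (0# * (t * t * G 2 + G 2) + 0# * (t * (G 1 + t)))
        ≈⟨ solve 2 (λ x y → :0 :- (:0 :* x :+ :0 :* y) := :0) refl _ _ ⟩
      0# ∎)

    log-0 : L 0 ≈ 0#
    log-0 = begin
      L 0 ≈⟨ sym (*-identityˡ _) ⟩
      1# * L 0 ≈⟨ *-congʳ (sym (constantTerm isG)) ⟩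
      G 0 * L 0 ≈⟨ at isL 0 ⟩
      0# * G 0 ≈⟨ zeroˡ _ ⟩
      0# ∎

    log-1 : L 1 ≈ t
    log-1 = begin
      L 1 ≈⟨ solve 2 (λ x y → x := :1 :* x :+ y :* :0) refl (L 1) (G 1) ⟩
      1# * L 1 + G 1 * 0# ≈⟨ +-cong (*-congʳ (sym (constantTerm isG))) (*-congˡ (sym log-0)) ⟩
      G 0 * L 1 + G 1 * L 0 ≈⟨ at isL 1 ⟩
      (1# + 0#) * G 1 ≈⟨ *-congˡ fraction-1 ⟩
      (1# + 0#) * t ≈⟨ solve 1 (λ t → (:1 :+ :0) :* t := t) refl t ⟩
      t ∎

    log-2 : L 2 ≈ - (t * t * (t + t + 1#))
    log-2 = begin
      L 2 ≈⟨ solve 3 (λ x t y → x := (:1 :* x :+ (t :* t :+ y :* :0)) :- t :* t) refl (L 2) t (G 2) ⟩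
      (1# * L 2 + (t * t + G 2 * 0#)) - t * t ≈⟨ +-congʳ (+-cong (*-congʳ (sym (constantTerm isG))) (+-cong (*-cong (sym fraction-1) (sym log-1)) (*-congˡ (sym log-0)))) ⟩
      (G 0 * L 2 + (G 1 * L 1 + G 2 * L 0)) - t * t ≈⟨ +-congʳ (at isL 2) ⟩
      nat 2 * G 2 - t * t ≈⟨ +-congʳ (*-congˡ fraction-2) ⟩
      nat 2 * - (t * t * t) - t * t ≈⟨ solve 1 (λ t → con (+ 2) :* (:- (t :* t :* t)) :- t :* t := :- (t :* t :* (t :+ t :+ :1))) refl t ⟩
      - (t * t * (t + t + 1#)) ∎

-- The universal continued fraction and its specialisations

module UniversalFraction where
  private
    module E = SeriesEquations Polynomial.polyRing
    module R = CommutativeRing Polynomial.polyRing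
    open Polynomial using (Poly; T; polyRing)
    open TwoPowerCyclotomic polyRing T
           (λ {x} → Polynomial.poly-twoRegular {x}) (λ j {x} {y} → Polynomial.Φ-primitive j {x} {y})
      using (logDerivative-factor)
    open Series polyRing using (Ser; σ)

  open TwoPowerCyclotomic polyRing T
           (λ {x} → Polynomial.poly-twoRegular {x}) (λ j {x} {y} → Polynomial.Φ-primitive j {x} {y})
      using (qnumber; qnumber-closed) public

  -- Abstract, so that the fixpoints over ℤ[t] and the polynomial extracted from the divisibility
  -- proof never unfold in later goals. `quotient` supplies the polynomial E of the overview.
  abstract
    fraction : ∀ t → Σ Ser (E.IsFraction t)
    fraction = E.fraction-exists

    logDerivative : ∀ t → Σ Ser (E.IsLogDerivative (proj₁ (fraction t)))
    logDerivative t = E.logDerivative-exists (proj₁ (fraction t)) (E.constantTerm (proj₂ (fraction t)))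

    quotient : ∀ v m → Σ Poly λ e → R._≈_
      (R._-_ (proj₁ (logDerivative T) (2 ℕ.^ v ℕ.* m)) (σ (proj₁ (logDerivative (R._*_ T T))) (2 ℕ.^ v ℕ.* m)))
      (R._*_ (qnumber v) (R._*_ (RingTools._^_ polyRing (TwoAdic.two polyRing) v) e))
    quotient = logDerivative-factor (proj₂ (fraction T)) (proj₂ (fraction (R._*_ T T)))
                                    (proj₂ (logDerivative T)) (proj₂ (logDerivative (R._*_ T T)))

module Specialise {c ℓ : Level} (K : CommutativeRing c ℓ) (b : CommutativeRing.Carrier K) where
  open CommutativeRing K
  open RingTools K
  open TwoAdic K
  open Series K using (σ; at; _≋_; coeffs; σ-cong)
  open SeriesEquations K
  open Evaluation K b
  private
    module R where
      open CommutativeRing Polynomial.polyRing public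
      open RingTools Polynomial.polyRing public using (_^_)
      open TwoAdic Polynomial.polyRing public using (two)
    module U = UniversalFraction
    module M = SeriesMap Polynomial.polyRing K eval eval-isHom
    module Hom = Morphisms.RingMorphisms.IsRingHomomorphism eval-isHom
    T = Polynomial.T

  eval-two^ : ∀ v → eval (R.two R.^ v) ≈ two ^ v
  eval-two^ v = trans (M.φ-^ R.two v) (^-congˡ v (trans (eval-⊞ R.1# R.1#) (+-cong Hom.1#-homo Hom.1#-homo)))

  eval-T^ : ∀ n → eval (T R.^ n) ≈ b ^ n
  eval-T^ n = trans (M.φ-^ T n) (^-congˡ n eval-T)

  eval-minus-1 : ∀ f → eval (f R.- R.1#) ≈ eval f - 1#
  eval-minus-1 f = trans (eval-⊞ f (R.- R.1#)) (+-congˡ (trans (eval-⊟ R.1#) (-‿cong Hom.1#-homo)))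

  qnumber-eval : ∀ v → (b - 1#) * eval (U.qnumber v) ≈ b ^ (2 ℕ.^ v) - 1#
  qnumber-eval v = begin
      (b - 1#) * eval (U.qnumber v) ≈⟨ *-congʳ (sym (trans (eval-minus-1 T) (+-congʳ eval-T))) ⟩
      eval (T R.- R.1#) * eval (U.qnumber v) ≈⟨ sym (eval-⊠ (T R.- R.1#) (U.qnumber v)) ⟩
      eval ((T R.- R.1#) R.* U.qnumber v) ≈⟨ Hom.⟦⟧-cong {(T R.- R.1#) R.* U.qnumber v} {T R.^ (2 ℕ.^ v) R.- R.1#} (U.qnumber-closed v) ⟩
      eval (T R.^ (2 ℕ.^ v) R.- R.1#) ≈⟨ eval-minus-1 (T R.^ (2 ℕ.^ v)) ⟩
      eval (T R.^ (2 ℕ.^ v)) - 1# ≈⟨ +-congʳ (eval-T^ (2 ℕ.^ v)) ⟩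
      b ^ (2 ℕ.^ v) - 1# ∎
    where open SetoidReasoning setoid

  qnumber-at-1 : b ≈ 1# → ∀ v → eval (U.qnumber v) ≈ two ^ v
  qnumber-at-1 b≈1 zero    = Hom.1#-homo
  qnumber-at-1 b≈1 (suc v) = begin
      eval (U.qnumber v R.* (R.1# R.+ T R.^ (2 ℕ.^ v))) ≈⟨ eval-⊠ (U.qnumber v) (R.1# R.+ T R.^ (2 ℕ.^ v)) ⟩
      eval (U.qnumber v) * eval (R.1# R.+ T R.^ (2 ℕ.^ v)) ≈⟨ *-cong (qnumber-at-1 b≈1 v) (eval-⊞ R.1# (T R.^ (2 ℕ.^ v))) ⟩
      two ^ v * (eval R.1# + eval (T R.^ (2 ℕ.^ v))) ≈⟨ *-congˡ (+-cong Hom.1#-homo (trans (eval-T^ (2 ℕ.^ v)) (trans (^-congˡ (2 ℕ.^ v) b≈1) (1^ (2 ℕ.^ v))))) ⟩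
      two ^ v * two ≈⟨ *-comm _ _ ⟩
      two ^ suc v ∎
    where open SetoidReasoning setoid

  module _ {X X′ S S′} (isX : IsFraction b X) (isX′ : IsFraction (b * b) X′)
           (isS : IsLogDerivative X S) (isS′ : IsLogDerivative X′ S′) where
    private
      module _ (t : Polynomial.Poly) where
        G = proj₁ (U.fraction t)
        isG = proj₂ (U.fraction t)
        L = proj₁ (U.logDerivative t)
        isL = proj₂ (U.logDerivative t)

      L≈ : ∀ t {b X S} → eval t ≈ b → IsFraction b X → IsLogDerivative X S → M.map (L t) ≋ S
      L≈ t e isX isS = logDerivative-cong {M.map (G t)} (constantTerm (M.map-fraction (isG t)))
        (fraction-unique e (M.map-fraction (isG t)) isX) (M.map-logDerivative {G t} {L t} (isL t)) isS

      T² = T R.* T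

    -- By uniqueness any continued fraction at b is the image of the universal one, so the
    -- factorisation over ℤ[t] can be evaluated.
    specialised : ∀ v m → S (2 ℕ.^ v ℕ.* m) - σ S′ (2 ℕ.^ v ℕ.* m)
      ≈ eval (U.qnumber v) * (two ^ v * eval (proj₁ (U.quotient v m)))
    specialised v m = begin
        S n - σ S′ n ≈⟨ +-cong (sym (at (L≈ T eval-T isX isS) n)) (-‿cong (at (σ-cong (CommutativeRing.sym (Series.seriesRing K) (L≈ T² (trans (eval-⊠ T T) (*-cong eval-T eval-T)) isX′ isS′))) n)) ⟩
        eval (L T n) - σ (M.map (L T²)) n ≈⟨ +-congˡ (-‿cong (sym (M.map-σ (L T²) n))) ⟩
        eval (L T n) - eval σL′ ≈⟨ +-congˡ (sym (eval-⊟ σL′)) ⟩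
        eval (L T n) + eval (R.- σL′) ≈⟨ sym (eval-⊞ (L T n) (R.- σL′)) ⟩
        eval (L T n R.- σL′) ≈⟨ Hom.⟦⟧-cong {L T n R.- σL′} {U.qnumber v R.* (R.two R.^ v R.* e)} (proj₂ (U.quotient v m)) ⟩
        eval (U.qnumber v R.* (R.two R.^ v R.* e)) ≈⟨ eval-⊠ (U.qnumber v) (R.two R.^ v R.* e) ⟩
        eval (U.qnumber v) * eval (R.two R.^ v R.* e) ≈⟨ *-congˡ (trans (eval-⊠ (R.two R.^ v) e) (*-congʳ (eval-two^ v))) ⟩
        eval (U.qnumber v) * (two ^ v * eval e) ∎
      where
      open SetoidReasoning setoid
      n = 2 ℕ.^ v ℕ.* m
      e = proj₁ (U.quotient v m)
      σL′ = Series.σ Polynomial.polyRing (L T²) n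

-- At t = 1 the parameters t and t² agree, so one series plays both parts, and [2^v] becomes 2^v.
-- Cancelling 2^v twice leaves E(1) against the 2x of `s-congruence`.
quotient-even : ∀ v l → 3 ℕ.≤ 2 ℕ.^ v ℕ.* suc (l ℕ.+ l) →
  Σ ℤ λ x → Evaluation.eval ℤring (+ 1) (proj₁ (UniversalFraction.quotient v (suc (l ℕ.+ l)))) ≡ + 2 ℤ.* x
quotient-even v l 3≤n = x , cancel (begin
    two ^ v * (two ^ v * E) ≡⟨ ≡.cong (_* (two ^ v * E)) (≡.sym (qnumber-at-1 ≡.refl v)) ⟩
    _ ≡⟨ ≡.sym (specialised isH isH isS isS v m) ⟩
    _ ≡⟨ e ⟩
    two ^ v * (two ^ v * (+ 2 * x)) ∎)
  where
  open CommutativeRing ℤring using (_*_; _-_)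
  open RingTools ℤring
  open TwoAdic ℤring
  open SeriesEquations ℤring
  open Specialise ℤring (+ 1)
  open ≡.≡-Reasoning
  m = suc (l ℕ.+ l)
  isH = proj₂ (fraction-exists (+ 1))
  log = logDerivative-exists (proj₁ (fraction-exists (+ 1))) (constantTerm isH)
  isS = proj₂ log
  x = proj₁ (CentralCongruence.s-congruence isH isS v l 3≤n)
  e = proj₂ (CentralCongruence.s-congruence isH isS v l 3≤n)
  E = Evaluation.eval ℤring (+ 1) (proj₁ (UniversalFraction.quotient v m))
  cancel₁ : ∀ {x y} → two ^ v * x ≡ two ^ v * y → x ≡ y
  cancel₁ {x} {y} p = x-y≈0⇒x≈y (two^-regular ℤ-twoRegular v (≡.trans
    (solve 3 (λ a x y → a :* (x :- y) := a :* x :- a :* y) ≡.refl (two ^ v) x y) (x≈y⇒x-y≈0 p)))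
  cancel : ∀ {x y} → two ^ v * (two ^ v * x) ≡ two ^ v * (two ^ v * y) → x ≡ y
  cancel p = cancel₁ (cancel₁ p)

-- Rationals with odd denominator

module Parity {c ℓ : Level} (K : CommutativeRing c ℓ) where
  open CommutativeRing K
  open RingTools K
  open CentralCongruence using (Odd; odd-*; nat≡+)
  private
    module Z = RingTools ℤring

  infix 4 _IsMod2_

  -- x is the image of a rational with odd denominator congruent to a modulo 2.
  record _IsMod2_ (x : Carrier) (a : ℤ) : Set ℓ where
    constructor mod2
    field
      denominator : ℤ
      isOdd       : Odd denominator
      half        : ℤ
      equation    : int denominator * x ≈ int (a ℤ.+ (half ℤ.+ half))
  open _IsMod2_ public

  int-mod2 : ∀ a → int a IsMod2 a
  int-mod2 a = mod2 (+ 1) (+ 0 , ≡.refl) (+ 0)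
    (trans (solve 1 (λ x → (:1 :+ :0) :* x := x) refl (int a)) (reflexive (≡.cong int (≡.sym (ℤ.+-identityʳ a)))))

  +-mod2 : ∀ {x y a b} → x IsMod2 a → y IsMod2 b → (x + y) IsMod2 (a ℤ.+ b)
  +-mod2 {x} {y} {a} {b} p@(mod2 d od@(k , d≡) h e) q@(mod2 d′ od′@(k′ , d′≡) h′ e′) =
    mod2 (d ℤ.* d′) (odd-* od od′) C (begin
      int (d ℤ.* d′) * (x + y) ≈⟨ *-congʳ (int-* d d′) ⟩
      int d * int d′ * (x + y) ≈⟨ solve 4 (λ d e x y → d :* e :* (x :+ y) := e :* (d :* x) :+ d :* (e :* y)) refl (int d) (int d′) x y ⟩
      int d′ * (int d * x) + int d * (int d′ * y) ≈⟨ +-cong (*-congˡ e) (*-congˡ e′) ⟩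
      int d′ * int A + int d * int B ≈⟨ sym (trans (int-+ (d′ ℤ.* A) (d ℤ.* B)) (+-cong (int-* d′ A) (int-* d B))) ⟩
      int (d′ ℤ.* A ℤ.+ d ℤ.* B) ≡⟨ ≡.cong int (≡.trans (≡.cong₂ (λ u v → u ℤ.* A ℤ.+ v ℤ.* B) d′≡ d≡)
          (Z.solve 6 (λ k k′ a b h h′ → (Z.:1 Z.:+ (k′ Z.:+ k′)) Z.:* (a Z.:+ (h Z.:+ h)) Z.:+ (Z.:1 Z.:+ (k Z.:+ k)) Z.:* (b Z.:+ (h′ Z.:+ h′))
             Z.:= (a Z.:+ b) Z.:+ ((h Z.:+ h′ Z.:+ k′ Z.:* (a Z.:+ (h Z.:+ h)) Z.:+ k Z.:* (b Z.:+ (h′ Z.:+ h′))) Z.:+ (h Z.:+ h′ Z.:+ k′ Z.:* (a Z.:+ (h Z.:+ h)) Z.:+ k Z.:* (b Z.:+ (h′ Z.:+ h′))))) ≡.refl k k′ a b h h′)) ⟩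
      int ((a ℤ.+ b) ℤ.+ (C ℤ.+ C)) ∎)
    where
    open SetoidReasoning setoid
    A = a ℤ.+ (h ℤ.+ h)
    B = b ℤ.+ (h′ ℤ.+ h′)
    C = h ℤ.+ h′ ℤ.+ k′ ℤ.* A ℤ.+ k ℤ.* B

  *-mod2 : ∀ {x y a b} → x IsMod2 a → y IsMod2 b → (x * y) IsMod2 (a ℤ.* b)
  *-mod2 {x} {y} {a} {b} (mod2 d od h e) (mod2 d′ od′ h′ e′) =
    mod2 (d ℤ.* d′) (odd-* od od′) (a ℤ.* h′ ℤ.+ h ℤ.* b ℤ.+ (h ℤ.* h′ ℤ.+ h ℤ.* h′)) (begin
      int (d ℤ.* d′) * (x * y) ≈⟨ *-congʳ (int-* d d′) ⟩
      int d * int d′ * (x * y) ≈⟨ solve 4 (λ d e x y → d :* e :* (x :* y) := (d :* x) :* (e :* y)) refl (int d) (int d′) x y ⟩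
      (int d * x) * (int d′ * y) ≈⟨ *-cong e e′ ⟩
      int A * int B ≈⟨ sym (int-* A B) ⟩
      int (A ℤ.* B) ≡⟨ ≡.cong int
          (Z.solve 4 (λ a b h h′ → (a Z.:+ (h Z.:+ h)) Z.:* (b Z.:+ (h′ Z.:+ h′))
             Z.:= (a Z.:* b) Z.:+ ((a Z.:* h′ Z.:+ h Z.:* b Z.:+ (h Z.:* h′ Z.:+ h Z.:* h′)) Z.:+ (a Z.:* h′ Z.:+ h Z.:* b Z.:+ (h Z.:* h′ Z.:+ h Z.:* h′)))) ≡.refl a b h h′) ⟩
      _ ∎)
    where
    open SetoidReasoning setoid
    A = a ℤ.+ (h ℤ.+ h)
    B = b ℤ.+ (h′ ℤ.+ h′)

  ^-mod2 : ∀ {x} → x IsMod2 + 1 → ∀ n → (x ^ n) IsMod2 + 1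
  ^-mod2 p zero    = mod2 (+ 1) (+ 0 , ≡.refl) (+ 0) (*-identityʳ _)
  ^-mod2 p (suc n) = *-mod2 p (^-mod2 p n)

  -- The sum 1 + y + ... + y^(m-1). For y = p^(2^v) it stands for (1 - p^n) / (1 - p^(2^v)) without
  -- a division.
  geometric : ℕ → Carrier → Carrier
  geometric zero    y = 0#
  geometric (suc m) y = 1# + y * geometric m y

  geometric-closed : ∀ m y → (1# - y) * geometric m y ≈ 1# - y ^ m
  geometric-closed zero    y = solve 1 (λ y → (:1 :- y) :* :0 := :1 :- :1) refl y
  geometric-closed (suc m) y = begin
      (1# - y) * (1# + y * geometric m y) ≈⟨ solve 2 (λ y g → (:1 :- y) :* (:1 :+ y :* g) := :1 :- y :+ y :* ((:1 :- y) :* g)) refl y _ ⟩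
      1# - y + y * ((1# - y) * geometric m y) ≈⟨ +-congˡ (*-congˡ (geometric-closed m y)) ⟩
      1# - y + y * (1# - y ^ m) ≈⟨ solve 2 (λ y p → :1 :- y :+ y :* (:1 :- p) := :1 :- y :* p) refl y (y ^ m) ⟩
      1# - y * y ^ m ∎
    where open SetoidReasoning setoid

  geometric-mod2 : ∀ m {y} → y IsMod2 + 1 → geometric m y IsMod2 + m
  geometric-mod2 zero    p = int-mod2 (+ 0)
  geometric-mod2 (suc m) p = ≡.subst (λ z → (1# + _ * geometric m _) IsMod2 z) (≡.cong (λ k → + 1 ℤ.+ k) (ℤ.*-identityˡ (+ m)))
    (+-mod2 (^-mod2 p 0) (*-mod2 p (geometric-mod2 m p)))

  module _ (b : Carrier) (b-mod2 : b IsMod2 + 1) where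
    open Evaluation K b using (eval)
    open Evaluation ℤring (+ 1) using () renaming (eval to eval₁)

    int-ℤ : ∀ a → RingTools.int ℤring a ≡ a
    int-ℤ (+ n)      = nat≡+ n
    int-ℤ -[1+ n ]   = ≡.cong ℤ.-_ (nat≡+ (suc n))

    -- All powers of b are 1 modulo 2, so f(b) and f(1) agree there.
    eval-mod2 : ∀ f → eval f IsMod2 eval₁ f
    eval-mod2 []      = int-mod2 (+ 0)
    eval-mod2 (a ∷ f) = ≡.subst (λ z → (int a + b * eval f) IsMod2 (z ℤ.+ + 1 ℤ.* eval₁ f)) (≡.sym (int-ℤ a))
      (+-mod2 (int-mod2 a) (*-mod2 b-mod2 (eval-mod2 f)))

  -- In u x = e the factor u is odd and e is even. Clearing the odd denominators of u and e
  -- therefore makes an odd multiple of x/2 an integer.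
  halve-mod2 : ∀ {half u x e a c} → half * (1# + 1#) ≈ 1# → u IsMod2 (+ 1 ℤ.+ (a ℤ.+ a)) → e IsMod2 (+ 2 ℤ.* c) → u * x ≈ e →
    Σ ℤ λ o → Odd o × Σ ℤ λ k → int o * (half * x) ≈ int k
  halve-mod2 {½} {u} {x} {e} {a} {c} half-two (mod2 d od h p) (mod2 d′ od′ h′ p′) ux≈e =
    d′ ℤ.* U , odd-* od′ (a ℤ.+ h , Z.solve 2 (λ a h → Z.:1 Z.:+ (a Z.:+ a) Z.:+ (h Z.:+ h) Z.:= Z.:1 Z.:+ ((a Z.:+ h) Z.:+ (a Z.:+ h))) ≡.refl a h)
    , d ℤ.* (c ℤ.+ h′) , (begin
      int (d′ ℤ.* U) * (½ * x) ≈⟨ *-congʳ (trans (int-* d′ U) (*-congˡ (sym p))) ⟩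
      int d′ * (int d * u) * (½ * x) ≈⟨ solve 5 (λ e d u h x → e :* (d :* u) :* (h :* x) := h :* (d :* (e :* (u :* x)))) refl (int d′) (int d) u ½ x ⟩
      ½ * (int d * (int d′ * (u * x))) ≈⟨ *-congˡ (*-congˡ (trans (*-congˡ ux≈e) (trans p′ (reflexive (≡.cong int
           (Z.solve 2 (λ c h → Z.con (+ 2) Z.:* c Z.:+ (h Z.:+ h) Z.:= (c Z.:+ h) Z.:+ (c Z.:+ h)) ≡.refl c h′)))))) ⟩
      ½ * (int d * int (w ℤ.+ w)) ≈⟨ *-congˡ (*-congˡ (int-+ w w)) ⟩
      ½ * (int d * (int w + int w)) ≈⟨ solve 3 (λ h d w → h :* (d :* (w :+ w)) := h :* (:1 :+ :1) :* (d :* w)) refl ½ (int d) (int w) ⟩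
      ½ * (1# + 1#) * (int d * int w) ≈⟨ trans (*-congʳ half-two) (*-identityˡ _) ⟩
      int d * int w ≈⟨ sym (int-* d w) ⟩
      int (d ℤ.* w) ∎)
    where
    open SetoidReasoning setoid
    U = + 1 ℤ.+ (a ℤ.+ a) ℤ.+ (h ℤ.+ h)
    w = c ℤ.+ h′

-- The coefficients of the combined logarithm

module EulerLogarithm {c ℓ : Level} (K : CommutativeRing c ℓ) (recip : ℕ → CommutativeRing.Carrier K)
  (recip-inverse : ∀ j → CommutativeRing._≈_ K (CommutativeRing._*_ K (RingTools.nat K (suc j)) (recip j)) (CommutativeRing.1# K)) where
  open CommutativeRing K
  open RingTools K
  open TwoAdic K
  open Series K
  open SeriesEquations K
  open EulerSeries K
  open FormalLogarithm K recip recip-inverse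
  open Parity K
  private
    module S = CommutativeRing seriesRing

  Regular : Carrier → Set _
  Regular x = ∀ {y} → x * y ≈ 0# → y ≈ 0#

  regular-cancel : ∀ {x y z} → Regular x → x * y ≈ x * z → y ≈ z
  regular-cancel {x} {y} {z} reg e = x-y≈0⇒x≈y (reg (trans (solve 3 (λ x y z → x :* (y :- z) := x :* y :- x :* z) refl x y z) (x≈y⇒x-y≈0 e)))

  module Combination {P Q half : Carrier} (PQ≈1 : P * Q ≈ 1#) (half-two : half * (1# + 1#) ≈ 1#)
           {F F′ : Ser} (F₀ : F 0 ≈ 1#) (F′₀ : F′ 0 ≈ 1#)
           (isEuler : IsEulerSeries Q F) (isEuler′ : IsEulerSeries (Q * Q) F′) where

    lhs : Ser
    lhs n = (Q - 1#) * (log F n - half * σ (log F′) n)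

    private
      P²Q²≈1 : (P * P) * (Q * Q) ≈ 1#
      P²Q²≈1 = trans (solve 2 (λ p q → (p :* p) :* (q :* q) := (p :* q) :* (p :* q)) refl P Q) (trans (*-cong PQ≈1 PQ≈1) (*-identityˡ 1#))
      H = θ (log F)
      H′ = θ (log F′)
      fractionF = euler-fraction PQ≈1 F₀ isEuler (log-derivative F F₀)
      fractionF′ = euler-fraction P²Q²≈1 F′₀ isEuler′ (log-derivative F′ F′₀)
      isX = proj₁ (proj₂ fractionF)
      isX′ = proj₁ (proj₂ fractionF′)
      isS = proj₂ (proj₂ fractionF)
      isS′ = proj₂ (proj₂ fractionF′)
      S = H S.- scale P H
      S′ = H′ S.- scale (P * P) H′

      σ-minus : ∀ f g n → σ (f S.- g) n ≈ σ f n - σ g n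
      σ-minus f g zero          = refl
      σ-minus f g (suc zero)    = sym (-‿inverseʳ 0#)
      σ-minus f g (suc (suc n)) = σ-minus (tail f) (tail g) n

    -- θ brings the factor n, and 1 - P^n turns θ log F into θ log of F(z)/F(Pz). In the second term
    -- θσ = 2σθ absorbs `half`, and z ↦ Pz acts under `σ` as z ↦ P²z.
    key : ∀ n → (1# - P ^ n) * (nat n * lhs n) ≈ (Q - 1#) * (S n - σ S′ n)
    key n = begin
        (1# - P ^ n) * (nat n * ((Q - 1#) * (log F n - half * σ (log F′) n)))
          ≈⟨ solve 6 (λ p k q a h b → (:1 :- p) :* (k :* ((q :- :1) :* (a :- h :* b))) :=
                (q :- :1) :* ((k :* a :- p :* (k :* a)) :- h :* ((:1 :- p) :* (k :* b)))) refl (P ^ n) (nat n) Q (log F n) half (σ (log F′) n) ⟩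
        (Q - 1#) * (S n - half * ((1# - P ^ n) * θ (σ (log F′)) n))
          ≈⟨ *-congˡ (+-congˡ (-‿cong (*-congˡ (*-congˡ (at (θ-σ (log F′)) n))))) ⟩
        (Q - 1#) * (S n - half * ((1# - P ^ n) * (σ H′ n + σ H′ n)))
          ≈⟨ *-congˡ (+-congˡ (-‿cong (solve 3 (λ h p c → h :* ((:1 :- p) :* (c :+ c)) := h :* (:1 :+ :1) :* (c :- p :* c)) refl half (P ^ n) (σ H′ n)))) ⟩
        (Q - 1#) * (S n - half * (1# + 1#) * (σ H′ n - P ^ n * σ H′ n))
          ≈⟨ *-congˡ (+-congˡ (-‿cong (trans (*-congʳ half-two) (*-identityˡ _)))) ⟩
        (Q - 1#) * (S n - (σ H′ n - P ^ n * σ H′ n))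
          ≈⟨ *-congˡ (+-congˡ (-‿cong (trans (+-congˡ (-‿cong (at (Frobenius.scale-σ K P H′) n))) (sym (σ-minus H′ (scale (P * P) H′) n))))) ⟩
        (Q - 1#) * (S n - σ S′ n) ∎
      where open SetoidReasoning setoid

    private
      -- Trades Q - 1 for 1 - P, which can be cancelled against 1 - P^n.
      P[Q-1] : P * (Q - 1#) ≈ 1# - P
      P[Q-1] = trans (solve 2 (λ p q → p :* (q :- :1) := p :* q :- p) refl P Q) (+-congʳ PQ≈1)
      open LowCoefficients K

    lhs-0 : lhs 0 ≈ 0#
    lhs-0 = solve 2 (λ q h → (q :- :1) :* (:0 :- h :* :0) := :0) refl Q half

    module _ (regular : ∀ n → Regular (1# - P ^ suc n)) (P-regular : Regular P) (two-regular : Regular two) where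

      lhs-1 : lhs 1 ≈ 1#
      lhs-1 = regular-cancel P-regular (regular-cancel (regular 0) (begin
          (1# - P ^ 1) * (P * lhs 1) ≈⟨ solve 3 (λ y p x → y :* (p :* x) := p :* (y :* ((:1 :+ :0) :* x))) refl (1# - P ^ 1) P (lhs 1) ⟩
          P * ((1# - P ^ 1) * (nat 1 * lhs 1)) ≈⟨ *-congˡ (key 1) ⟩
          P * ((Q - 1#) * (S 1 - 0#)) ≈⟨ solve 3 (λ p q s → p :* (q :* (s :- :0)) := p :* q :* s) refl P (Q - 1#) (S 1) ⟩
          P * (Q - 1#) * S 1 ≈⟨ *-cong P[Q-1] (log-1 isX isS) ⟩
          (1# - P) * P ≈⟨ solve 1 (λ p → (:1 :- p) :* p := (:1 :- p :* :1) :* (p :* :1)) refl P ⟩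
          (1# - P ^ 1) * (P * 1#) ∎))
        where open SetoidReasoning setoid

      -- Here D = -P² (2P + 1) - P² = -2P² (1 + P), and (1 - P)(1 + P) cancels 1 - P².
      lhs-2 : lhs 2 ≈ - P
      lhs-2 = regular-cancel P-regular (regular-cancel two-regular (regular-cancel (regular 1) (begin
          (1# - P ^ 2) * (two * (P * lhs 2)) ≈⟨ solve 3 (λ y p x → y :* ((:1 :+ :1) :* (p :* x)) := p :* (y :* (con (+ 2) :* x))) refl (1# - P ^ 2) P (lhs 2) ⟩
          P * ((1# - P ^ 2) * (nat 2 * lhs 2)) ≈⟨ *-congˡ (key 2) ⟩
          P * ((Q - 1#) * (S 2 - S′ 1)) ≈⟨ sym (*-assoc _ _ _) ⟩
          P * (Q - 1#) * (S 2 - S′ 1) ≈⟨ *-cong P[Q-1] (+-cong (log-2 isX isS) (-‿cong (log-1 isX′ isS′))) ⟩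
          (1# - P) * (- (P * P * (P + P + 1#)) - P * P)
            ≈⟨ solve 1 (λ p → (:1 :- p) :* (:- (p :* p :* (p :+ p :+ :1)) :- p :* p) := (:1 :- p :* (p :* :1)) :* ((:1 :+ :1) :* (p :* (:- p)))) refl P ⟩
          (1# - P ^ 2) * (two * (P * - P)) ∎)))
        where open SetoidReasoning setoid

      module _ (v m : ℕ) where
        open Evaluation K P using (eval)

        private
          n = 2 ℕ.^ v ℕ.* m
          y = P ^ (2 ℕ.^ v)
          e = eval (proj₁ (UniversalFraction.quotient v m))
          qn = eval (UniversalFraction.qnumber v)

          two^-reg : ∀ w → Regular (two ^ w)
          two^-reg zero    r = trans (sym (*-identityˡ _)) r
          two^-reg (suc w) r = two^-reg w (two-regular (trans (sym (*-assoc _ _ _)) r))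

          1-y-regular : Regular (1# - y)
          1-y-regular = go (2 ℕ.^ v) {{ℕ.m^n≢0 2 v}}
            where
            go : ∀ k .{{_ : ℕ.NonZero k}} → Regular (1# - P ^ k)
            go (suc k) = regular k

        -- Multiply `key` by P. Then P (Q - 1) [2^v] = 1 - y cancels against 1 - P^n = (1 - y) ·
        -- `geometric m y`, and the 2^v of n = 2^v m against the 2^v in D.
        lhs-multiple : (P * geometric m y * nat m) * lhs n ≈ e
        lhs-multiple = regular-cancel (two^-reg v) (regular-cancel 1-y-regular (begin
            (1# - y) * (two ^ v * ((P * geometric m y * nat m) * lhs n))
              ≈⟨ solve 6 (λ y t p g k x → y :* (t :* (p :* g :* k :* x)) := p :* (y :* g :* (t :* k :* x))) refl (1# - y) (two ^ v) P (geometric m y) (nat m) (lhs n) ⟩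
            P * ((1# - y) * geometric m y * (two ^ v * nat m * lhs n))
              ≈⟨ *-congˡ (*-cong (trans (geometric-closed m y) (+-congˡ (-‿cong (^-assocʳ P (2 ℕ.^ v) m))))
                                 (*-congʳ (sym (trans (nat-* (2 ℕ.^ v) m) (*-congʳ (nat-2^ v)))))) ⟩
            P * ((1# - P ^ n) * (nat n * lhs n))
              ≈⟨ *-congˡ (key n) ⟩
            P * ((Q - 1#) * (S n - σ S′ n))
              ≈⟨ trans (sym (*-assoc _ _ _)) (*-cong P[Q-1] (Specialise.specialised K P isX isX′ isS isS′ v m)) ⟩
            (1# - P) * (qn * (two ^ v * e))
              ≈⟨ solve 4 (λ p q t e → (:1 :- p) :* (q :* (t :* e)) := (:- ((p :- :1) :* q)) :* (t :* e)) refl P qn (two ^ v) e ⟩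
            (- ((P - 1#) * qn)) * (two ^ v * e)
              ≈⟨ *-congʳ (-‿cong (Specialise.qnumber-eval K P v)) ⟩
            (- (y - 1#)) * (two ^ v * e)
              ≈⟨ *-congʳ (solve 1 (λ y → :- (y :- :1) := :1 :- y) refl y) ⟩
            (1# - y) * (two ^ v * e) ∎))
          where open SetoidReasoning setoid

      lhs-even : P IsMod2 + 1 → ∀ v l → 3 ℕ.≤ 2 ℕ.^ v ℕ.* suc (l ℕ.+ l) →
        Σ ℤ λ o → CentralCongruence.Odd o × Σ ℤ λ k → int o * (half * lhs (2 ℕ.^ v ℕ.* suc (l ℕ.+ l))) ≈ int k
      lhs-even P-mod2 v l 3≤n = halve-mod2 {a = proj₁ odd} {c = proj₁ (quotient-even v l 3≤n)} half-two unit even (lhs-multiple v m)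
        where
        m = suc (l ℕ.+ l)
        u = P * geometric m (P ^ (2 ℕ.^ v)) * nat m
        e = Evaluation.eval K P (proj₁ (UniversalFraction.quotient v m))
        -- Modulo 2 the multiplier is 1 · m · m, the factors coming from P, the geometric sum and
        -- `nat m`.
        odd : CentralCongruence.Odd (+ 1 ℤ.* + m ℤ.* + m)
        odd = CentralCongruence.odd-* {+ 1 ℤ.* + m} {+ m} (CentralCongruence.odd-* {+ 1} {+ m} (+ 0 , ≡.refl) (+ l , ≡.refl)) (+ l , ≡.refl)
        unit : u IsMod2 (+ 1 ℤ.+ (proj₁ odd ℤ.+ proj₁ odd))
        unit = ≡.subst (λ z → u IsMod2 z) (proj₂ odd)
          (*-mod2 (*-mod2 P-mod2 (geometric-mod2 m (^-mod2 P-mod2 (2 ℕ.^ v)))) (int-mod2 (+ m)))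
        even : e IsMod2 (+ 2 ℤ.* proj₁ (quotient-even v l 3≤n))
        even = ≡.subst (λ z → e IsMod2 z) (proj₂ (quotient-even v l 3≤n)) (eval-mod2 P P-mod2 (proj₁ (UniversalFraction.quotient v m)))

-- Rational numbers and the given definitions

open import Defs
open import Data.Rational as ℚ using (ℚ; mkℚ; _*_; -_; _/_; 0ℚ; 1ℚ; ½)
import Data.Rational.Properties as ℚ
open import Data.Rational.Unnormalised as ℚᵘ using (mkℚᵘ; *≡*)
import Data.Rational.Unnormalised.Properties as ℚᵘ
open import Data.Nat.Combinatorics using (_C_; nC1≡n; nCk+nC[k+1]≡[n+1]C[k+1])
open import Data.Nat.Divisibility using (_∣_; divides)
open import Data.Nat.Primality using (prime⇒nonTrivial)

ℚring : CommutativeRing _ _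
ℚring = ℚ.+-*-commutativeRing

private
  module ℤS = RingTools ℤring

module Rationals where
  open CommutativeRing ℚring using () renaming (_+_ to _+ℚ_; _-_ to _-ℚ_)
  open RingTools ℚring
  open TwoAdic ℚring using (two; 1^)
  open Series ℚring using (Ser; tail; _⊗_; σ; ⊗-cong-≤)
  open EulerSeries ℚring using (IsEulerSeries)
  open ≡.≡-Reasoning

  toℚᵘ-nat : ∀ n → ℚ.toℚᵘ (nat n) ℚᵘ.≃ mkℚᵘ (+ n) 0
  toℚᵘ-nat zero    = *≡* ≡.refl
  toℚᵘ-nat (suc n) = ℚᵘ.≃-trans (ℚ.toℚᵘ-homo-+ 1ℚ (nat n)) (ℚᵘ.≃-trans (ℚᵘ.+-congʳ (mkℚᵘ (+ 1) 0) (toℚᵘ-nat n))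
    (*≡* (≡.cong (ℤ._* + 1) (≡.cong (λ k → + 1 ℤ.+ k) (ℤ.*-identityʳ (+ n))))))

  toℚᵘ-int : ∀ k → ℚ.toℚᵘ (int k) ℚᵘ.≃ mkℚᵘ k 0
  toℚᵘ-int (+ n)    = toℚᵘ-nat n
  toℚᵘ-int -[1+ n ] = ℚᵘ.≃-trans (ℚ.toℚᵘ-homo‿- (nat (suc n))) (ℚᵘ.-‿cong (toℚᵘ-nat (suc n)))

  int≡/1 : ∀ k → int k ≡ k / 1
  int≡/1 k = ℚ.toℚᵘ-injective (ℚᵘ.≃-trans (toℚᵘ-int k) (ℚᵘ.≃-sym (ℚ.toℚᵘ-fromℚᵘ (mkℚᵘ k 0))))

  int-injective : ∀ {a b} → int a ≡ int b → a ≡ b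
  int-injective {a} {b} e with ℚᵘ.≃-trans (ℚᵘ.≃-sym (toℚᵘ-int a)) (ℚᵘ.≃-trans (ℚ.toℚᵘ-cong e) (toℚᵘ-int b))
  ... | *≡* p = ≡.trans (≡.sym (ℤ.*-identityʳ a)) (≡.trans p (ℤ.*-identityʳ b))

  denominator-* : ∀ r → int (ℚ.↧ r) * r ≡ int (ℚ.↥ r)
  denominator-* r@(mkℚ n d _) = ℚ.toℚᵘ-injective (ℚᵘ.≃-trans (ℚ.toℚᵘ-homo-* (int (ℚ.↧ r)) r)
    (ℚᵘ.≃-trans (ℚᵘ.*-congʳ {mkℚᵘ n d} (toℚᵘ-int (ℚ.↧ r)))
    (ℚᵘ.≃-trans (*≡* (ℤS.solve 2 (λ d n → d ℤS.:* n ℤS.:* ℤS.:1 ℤS.:= n ℤS.:* (ℤS.:1 ℤS.:* d)) ≡.refl (+ suc d) n))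
      (ℚᵘ.≃-sym (toℚᵘ-int n)))))

  recip : ℕ → ℚ
  recip j = + 1 / suc j

  recip-inverse : ∀ j → nat (suc j) * recip j ≡ 1ℚ
  recip-inverse j = ℚ.toℚᵘ-injective (ℚᵘ.≃-trans (ℚ.toℚᵘ-homo-* (nat (suc j)) (recip j))
    (ℚᵘ.≃-trans (ℚᵘ.*-cong (toℚᵘ-nat (suc j)) (ℚ.toℚᵘ-fromℚᵘ (mkℚᵘ (+ 1) j)))
      (*≡* (ℤS.solve 1 (λ k → k ℤS.:* ℤS.:1 ℤS.:* ℤS.:1 ℤS.:= ℤS.:1 ℤS.:* (ℤS.:1 ℤS.:* k)) ≡.refl (+ suc j)))))

  inv-inverseˡ : ∀ {x} → ¬ x ≡ 0ℚ → inv x * x ≡ 1ℚ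
  inv-inverseˡ {p@(mkℚ ℤ.+[1+ n ] d c)} x≢0 = ℚ.*-inverseˡ p
  inv-inverseˡ {p@(mkℚ -[1+ n ] d c)} x≢0 = ℚ.*-inverseˡ p
  inv-inverseˡ {p@(mkℚ ℤ.+0 d c)} x≢0 = ⊥-elim (x≢0 (ℚ.↥p≡0⇒p≡0 p ≡.refl))

  nonzero-regular : ∀ {x} → ¬ x ≡ 0ℚ → ∀ {y} → x * y ≡ 0ℚ → y ≡ 0ℚ
  nonzero-regular {x} x≢0 {y} e = begin
    y ≡⟨ ≡.sym (ℚ.*-identityˡ y) ⟩
    1ℚ * y ≡⟨ ≡.cong (_* y) (≡.sym (inv-inverseˡ x≢0)) ⟩
    inv x * x * y ≡⟨ ℚ.*-assoc (inv x) x y ⟩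
    inv x * (x * y) ≡⟨ ≡.cong (inv x *_) e ⟩
    inv x * 0ℚ ≡⟨ ℚ.*-zeroʳ (inv x) ⟩
    0ℚ ∎

  -- For r = n/d, an even d would make o n = d k even and hence n even, against lowest terms.
  inZ₂ : ∀ {o k r} → CentralCongruence.Odd o → int o * r ≡ int k → InZ₂ r
  inZ₂ {o} {k} {r@(mkℚ n d coprime)} odd e (divides c den≡) = not-coprime
    where
    num-eq : o ℤ.* n ≡ + 2 ℤ.* (+ c ℤ.* k)
    num-eq = begin
      o ℤ.* n ≡⟨ int-injective (begin
          int (o ℤ.* n) ≡⟨ int-* o n ⟩
          int o * int n ≡⟨ ≡.cong (int o *_) (≡.sym (denominator-* r)) ⟩
          int o * (int (ℚ.↧ r) * r) ≡⟨ solve 3 (λ o d r → o :* (d :* r) := d :* (o :* r)) ≡.refl (int o) (int (ℚ.↧ r)) r ⟩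
          int (ℚ.↧ r) * (int o * r) ≡⟨ ≡.cong (int (ℚ.↧ r) *_) e ⟩
          int (ℚ.↧ r) * int k ≡⟨ ≡.sym (int-* (ℚ.↧ r) k) ⟩
          int (ℚ.↧ r ℤ.* k) ∎) ⟩
      ℚ.↧ r ℤ.* k ≡⟨ ≡.cong (λ z → + z ℤ.* k) den≡ ⟩
      + (c ℕ.* 2) ℤ.* k ≡⟨ ≡.cong (ℤ._* k) (ℤ.pos-* c 2) ⟩
      + c ℤ.* + 2 ℤ.* k ≡⟨ ℤS.solve 2 (λ c k → c ℤS.:* ℤS.con (+ 2) ℤS.:* k ℤS.:= ℤS.con (+ 2) ℤS.:* (c ℤS.:* k)) ≡.refl (+ c) k ⟩
      + 2 ℤ.* (+ c ℤ.* k) ∎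
    half = CentralCongruence.2^∣-odd-cancel 1 {y = + c ℤ.* k} odd num-eq
    2∣n : 2 ∣ ℤ.∣ n ∣
    2∣n = divides ℤ.∣ proj₁ half ∣ (≡.trans (≡.cong ℤ.∣_∣ (proj₂ half)) (≡.trans (ℤ.abs-* (+ 2) (proj₁ half)) (ℕ.*-comm 2 ℤ.∣ proj₁ half ∣)))
    not-coprime : ⊥
    -- The coprimality field of `mkℚ` is irrelevant, so the contradiction goes through irrelevant
    -- elimination.
    not-coprime = ⊥-elim-irr (absurd (coprime (2∣n , divides c den≡)))
      where
      absurd : 2 ≡ 1 → ⊥
      absurd ()

  ^ℚ≡^ : ∀ x n → x ^ℚ n ≡ x ^ n
  ^ℚ≡^ x zero    = ≡.refl
  ^ℚ≡^ x (suc n) = ≡.cong (x *_) (^ℚ≡^ x n)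

  sumTo-front : ∀ n f → sumTo (suc n) f ≡ f 0 +ℚ sumTo n (λ i → f (suc i))
  sumTo-front zero    f = ≡.refl
  sumTo-front (suc n) f = ≡.trans (≡.cong (_+ℚ f (suc (suc n))) (sumTo-front n f)) (ℚ.+-assoc (f 0) (sumTo n (λ i → f (suc i))) (f (suc (suc n))))

  ⊛≡⊗ : ∀ f g n → (f ⊛ g) n ≡ (f ⊗ g) n
  ⊛≡⊗ f g zero    = ≡.refl
  ⊛≡⊗ f g (suc n) = ≡.trans (sumTo-front n (λ i → f i * g (suc n ℕ.∸ i))) (≡.cong (f 0 * g (suc n) +ℚ_) (⊛≡⊗ (tail f) g n))

  -- Takes pointwise agreement as a premise, because `logPS` and `log` are identified only
  -- coefficient by coefficient.
  subSq≡σ : ∀ {f g} → (∀ n → f n ≡ g n) → ∀ n → subSq f n ≡ σ g n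
  subSq≡σ e zero          = e 0
  subSq≡σ e (suc zero)    = ≡.refl
  subSq≡σ e (suc (suc n)) = subSq≡σ (λ k → e (suc k)) n

  open FormalLogarithm ℚring recip recip-inverse using (sum; dropHead; log)
  private
    module ST = RingTools (Series.seriesRing ℚring)

  sumTo≡sum : ∀ n {a b : ℕ → ℚ} → (∀ j → a j ≡ b j) → sumTo n a ≡ sum n b
  sumTo≡sum zero    e = e 0
  sumTo≡sum (suc n) e = ≡.cong₂ _+ℚ_ (sumTo≡sum n e) (e (suc n))

  dropConst≡dropHead : ∀ f n → dropConst f n ≡ dropHead f n
  dropConst≡dropHead f zero    = ≡.refl
  dropConst≡dropHead f (suc n) = ≡.refl

  powPS≡^ : ∀ {f g} → (∀ n → f n ≡ g n) → ∀ k n → powPS f k n ≡ (g ST.^ k) n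
  powPS≡^ e zero    zero    = ≡.refl
  powPS≡^ e zero    (suc n) = ≡.refl
  powPS≡^ {f} {g} e (suc k) n = ≡.trans (⊛≡⊗ f (powPS f k) n)
    (⊗-cong-≤ n (λ {i} _ → e i) (λ {i} _ → powPS≡^ e k i))

  logPS≡log : ∀ f n → logPS f n ≡ log f n
  logPS≡log f zero    = ≡.refl
  logPS≡log f (suc n) = sumTo≡sum n (λ j → ≡.cong₂ _*_ (≡.cong (_* recip j) (^ℚ≡^ (- 1ℚ) j))
    (powPS≡^ {dropConst f} {dropHead f} (dropConst≡dropHead f) (suc j) (suc n)))

  module _ (Q : ℚ) (Q≢0 : ¬ Q ≡ 0ℚ) (Q^≢1 : ∀ n → ¬ Q ^ suc n ≡ 1ℚ) where

    private
      A : ℕ → ℚ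
      A n = (Q ^ℚ (n C 2)) * qPoch Q n

      x : ℕ → ℚ
      x n = Q ^ n * (1ℚ -ℚ Q ^ suc n)

      -- Pascal's rule C(n + 1, 2) = n + C(n, 2) accounts for the factor Q^n.
      A-suc : ∀ n → A (suc n) ≡ A n * x n
      A-suc n = begin
        (Q ^ℚ (suc n C 2)) * (qPoch Q n * (1ℚ -ℚ Q ^ℚ suc n))
          ≡⟨ ≡.cong₂ (λ u v → u * (qPoch Q n * (1ℚ -ℚ v))) power (^ℚ≡^ Q (suc n)) ⟩
        Q ^ n * (Q ^ℚ (n C 2)) * (qPoch Q n * (1ℚ -ℚ Q ^ suc n))
          ≡⟨ solve 4 (λ a b c d → a :* b :* (c :* d) := b :* c :* (a :* d)) ≡.refl (Q ^ n) (Q ^ℚ (n C 2)) (qPoch Q n) (1ℚ -ℚ Q ^ suc n) ⟩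
        A n * x n ∎
        where
        power : Q ^ℚ (suc n C 2) ≡ Q ^ n * (Q ^ℚ (n C 2))
        power = begin
          Q ^ℚ (suc n C 2) ≡⟨ ^ℚ≡^ Q (suc n C 2) ⟩
          Q ^ (suc n C 2) ≡⟨ ≡.cong (Q ^_) (≡.trans (≡.sym (nCk+nC[k+1]≡[n+1]C[k+1] n 1)) (≡.cong (ℕ._+ n C 2) (nC1≡n n))) ⟩
          Q ^ (n ℕ.+ n C 2) ≡⟨ ^-homo-* Q n (n C 2) ⟩
          Q ^ n * Q ^ (n C 2) ≡⟨ ≡.cong (Q ^ n *_) (≡.sym (^ℚ≡^ Q (n C 2))) ⟩
          Q ^ n * (Q ^ℚ (n C 2)) ∎

      Q^≢0 : ∀ n → ¬ Q ^ n ≡ 0ℚ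
      Q^≢0 zero    ()
      Q^≢0 (suc n) e = Q^≢0 n (nonzero-regular Q≢0 e)

      x≢0 : ∀ n → ¬ x n ≡ 0ℚ
      x≢0 n e = Q^≢1 n (≡.sym (x-y≈0⇒x≈y {1ℚ} {Q ^ suc n} (nonzero-regular (Q^≢0 n) e)))

      A≢0 : ∀ n → ¬ A n ≡ 0ℚ
      A≢0 zero    ()
      A≢0 (suc n) e = x≢0 n (nonzero-regular (A≢0 n) (≡.trans (≡.sym (A-suc n)) e))

    -- The sign (-1)^n accounts for the change from 1 - Q^(n+1) to Q^(n+1) - 1. The rest is `A-suc`
    -- together with the fact that no denominator vanishes, so that `inv` is a true inverse.
    fSeries-isEuler : IsEulerSeries Q (fSeries Q)
    fSeries-isEuler n = begin
        - 1ℚ * ε * inv (A (suc n)) * (Q ^ n * (Q ^ suc n -ℚ 1ℚ))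
          ≡⟨ solve 4 (λ e i a b → (:- :1) :* e :* i :* (a :* (b :- :1)) := e :* (i :* (a :* (:1 :- b)))) ≡.refl ε (inv (A (suc n))) (Q ^ n) (Q ^ suc n) ⟩
        ε * (inv (A (suc n)) * x n)
          ≡⟨ ≡.cong (ε *_) (≡.sym (ℚ.*-identityʳ _)) ⟩
        ε * (inv (A (suc n)) * x n * 1ℚ)
          ≡⟨ ≡.cong (λ u → ε * (inv (A (suc n)) * x n * u)) (≡.sym (inv-inverseˡ (A≢0 n))) ⟩
        ε * (inv (A (suc n)) * x n * (inv (A n) * A n))
          ≡⟨ solve 5 (λ e i x j a → e :* (i :* x :* (j :* a)) := e :* j :* (i :* (a :* x))) ≡.refl ε (inv (A (suc n))) (x n) (inv (A n)) (A n) ⟩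
        ε * inv (A n) * (inv (A (suc n)) * (A n * x n))
          ≡⟨ ≡.cong (λ u → ε * inv (A n) * (inv (A (suc n)) * u)) (≡.sym (A-suc n)) ⟩
        ε * inv (A n) * (inv (A (suc n)) * A (suc n))
          ≡⟨ ≡.cong (ε * inv (A n) *_) (inv-inverseˡ (A≢0 (suc n))) ⟩
        ε * inv (A n) * 1ℚ
          ≡⟨ ℚ.*-identityʳ _ ⟩
        ε * inv (A n) ∎
      where ε = (- 1ℚ) ^ℚ n

  nat-^ : ∀ a n → nat (a ℕ.^ n) ≡ nat a ^ n
  nat-^ a zero    = ≡.refl
  nat-^ a (suc n) = ≡.trans (nat-* a (a ℕ.^ n)) (≡.cong (nat a *_) (nat-^ a n))

  nat-injective : ∀ {a b} → nat a ≡ nat b → a ≡ b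
  nat-injective {a} {b} e = ℤ.+-injective (int-injective {+ a} {+ b} e)

  nat^≢1 : ∀ {a} → 1 ℕ.< a → ∀ n → ¬ nat a ^ suc n ≡ 1ℚ
  nat^≢1 {a} 1<a n e with ℕ.m^n≡1⇒n≡0∨m≡1 a (suc n) (nat-injective {a ℕ.^ suc n} {1} (≡.trans (nat-^ a (suc n)) e))
  ... | inj₂ ≡.refl = ℕ.<-irrefl ≡.refl 1<a

  nat≢0 : ∀ {a} → 1 ℕ.< a → ¬ nat a ≡ 0ℚ
  nat≢0 {a} 1<a e with nat-injective {a} {0} e
  nat≢0 () _ | ≡.refl

-- Odd prime powers and the theorem

module _ where
  open CentralCongruence using (Odd; odd-*)

  odd-power : ∀ p → Odd (+ p) → ∀ k → Odd (+ (p ℕ.^ k))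
  odd-power p o zero    = + 0 , ≡.refl
  odd-power p o (suc k) = ≡.subst Odd (≡.sym (ℤ.pos-* p (p ℕ.^ k))) (odd-* o (odd-power p o k))

  oddPrimePower-odd : ∀ {q} → IsOddPrimePower q → Odd (+ q)
  oddPrimePower-odd (p , k , _ , 2∤p , _ , ≡.refl) with parity p
  ... | m , inj₁ e = ⊥-elim (2∤p (divides m (≡.trans e (ℕS.solve 1 (λ m → m ℕS.:+ m ℕS.:= m ℕS.:* ℕS.con 2) ≡.refl m))))
  ... | m , inj₂ e = odd-power p (+ m , ≡.cong +_ e) k

oddPrimePower>1 : ∀ {q} → IsOddPrimePower q → 1 ℕ.< q
oddPrimePower>1 (p , suc k , isPrime , _ , _ , ≡.refl) =
  ℕ.<-≤-trans (ℕ.nonTrivial⇒n>1 p {{prime⇒nonTrivial isPrime}}) (ℕ.m≤m*n p (p ℕ.^ k) {{ℕ.m^n≢0 p k {{ℕ.nonTrivial⇒nonZero p {{prime⇒nonTrivial isPrime}}}}}})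

odd-part : ∀ n → 0 ℕ.< n → Σ ℕ λ v → Σ ℕ λ l → n ≡ 2 ℕ.^ v ℕ.* suc (l ℕ.+ l)
odd-part n 0<n = go n n ℕ.≤-refl 0<n
  where
  -- The fuel bounds n and makes the recursion on n/2 structural.
  go : ∀ fuel n → n ℕ.≤ fuel → 0 ℕ.< n → Σ ℕ λ v → Σ ℕ λ l → n ≡ 2 ℕ.^ v ℕ.* suc (l ℕ.+ l)
  go fuel       n n≤ 0<n with parity n
  go fuel       n n≤ 0<n | l , inj₂ e = 0 , l , ≡.trans e (≡.sym (ℕ.+-identityʳ _))
  go fuel       n n≤ ()  | zero , inj₁ ≡.refl
  go (suc fuel) n n≤ 0<n | suc m , inj₁ ≡.refl with go fuel (suc m) (ℕ.≤-trans (ℕ.m≤n+m (suc m) m) (ℕ.≤-pred n≤)) (s≤s z≤n)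
  ... | v , l , e = suc v , l , ≡.trans (≡.cong₂ ℕ._+_ e e)
    (ℕS.solve 2 (λ p o → p ℕS.:* o ℕS.:+ p ℕS.:* o ℕS.:= (ℕS.con 2 ℕS.:* p) ℕS.:* o) ≡.refl (2 ℕ.^ v) (suc (l ℕ.+ l)))

theorem2p9 : (q : ℕ) → IsOddPrimePower q →
    (lhsSeries q 0 ≡ 0ℚ) × (lhsSeries q 1 ≡ 1ℚ) × (lhsSeries q 2 ≡ - inv (+ q / 1)) ×
    ((n : ℕ) → 3 ℕ.≤ n → InZ₂ (½ * lhsSeries q n))
theorem2p9 q isOddPrimePower =
    ≡.trans (lhsSeries≡lhs 0) C.lhs-0
  , ≡.trans (lhsSeries≡lhs 1) (C.lhs-1 regular P-regular two-regular)
  , ≡.trans (lhsSeries≡lhs 2) (C.lhs-2 regular P-regular two-regular)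
  , even
  where
  open RingTools ℚring
  open TwoAdic ℚring using (two; 1^)
  open Rationals
  open Parity ℚring using (_IsMod2_; mod2)
  module L = EulerLogarithm ℚring recip recip-inverse

  Q = + q / 1
  P = inv Q

  q-odd = oddPrimePower-odd isOddPrimePower
  1<q = oddPrimePower>1 isOddPrimePower

  nat-q : nat q ≡ Q
  nat-q = int≡/1 (+ q)

  nat-q² : nat (q ℕ.* q) ≡ Q * Q
  nat-q² = ≡.trans (nat-* q q) (≡.cong₂ _*_ nat-q nat-q)

  1<q² : 1 ℕ.< q ℕ.* q
  1<q² = ℕ.<-trans 1<q (ℕ.m<m*n q q {{ℕ.>-nonZero (ℕ.<-trans (s≤s z≤n) 1<q)}} 1<q)

  Q≢0 : ¬ Q ≡ 0ℚ
  Q≢0 = ≡.subst (λ x → ¬ x ≡ 0ℚ) nat-q (nat≢0 1<q)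

  Q^≢1 : ∀ n → ¬ Q ^ suc n ≡ 1ℚ
  Q^≢1 = ≡.subst (λ x → ∀ n → ¬ x ^ suc n ≡ 1ℚ) nat-q (nat^≢1 1<q)

  isEuler = fSeries-isEuler Q Q≢0 Q^≢1
  isEuler² = fSeries-isEuler (Q * Q) (≡.subst (λ x → ¬ x ≡ 0ℚ) nat-q² (nat≢0 1<q²))
               (≡.subst (λ x → ∀ n → ¬ x ^ suc n ≡ 1ℚ) nat-q² (nat^≢1 1<q²))

  PQ≡1 : P * Q ≡ 1ℚ
  PQ≡1 = inv-inverseˡ Q≢0

  P≢0 : ¬ P ≡ 0ℚ
  P≢0 e with ≡.trans (≡.sym PQ≡1) (≡.trans (≡.cong (_* Q) e) (ℚ.*-zeroˡ Q))
  ... | ()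

  1-P^≢0 : ∀ n → ¬ CommutativeRing._-_ ℚring 1ℚ (P ^ suc n) ≡ 0ℚ
  1-P^≢0 n e = Q^≢1 n (begin
      Q ^ suc n ≡⟨ ≡.sym (ℚ.*-identityˡ (Q ^ suc n)) ⟩
      1ℚ * Q ^ suc n ≡⟨ ≡.cong (_* Q ^ suc n) (x-y≈0⇒x≈y {1ℚ} {P ^ suc n} e) ⟩
      P ^ suc n * Q ^ suc n ≡⟨ ≡.sym (^-distrib-* P Q (suc n)) ⟩
      (P * Q) ^ suc n ≡⟨ ≡.cong (_^ suc n) PQ≡1 ⟩
      1ℚ ^ suc n ≡⟨ 1^ (suc n) ⟩
      1ℚ ∎)
    where open ≡.≡-Reasoning

  two≢0 : ¬ two ≡ 0ℚ
  two≢0 ()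

  regular : ∀ n → L.Regular (CommutativeRing._-_ ℚring 1ℚ (P ^ suc n))
  regular n = nonzero-regular (1-P^≢0 n)

  P-regular : L.Regular P
  P-regular = nonzero-regular P≢0

  two-regular : L.Regular two
  two-regular = nonzero-regular two≢0

  -- The parity of q enters here: q is an odd denominator for P, as q P = 1.
  P-mod2 : P IsMod2 (+ 1)
  P-mod2 = mod2 (+ q) q-odd (+ 0) (≡.trans (≡.cong (_* P) nat-q) (≡.trans (ℚ.*-comm Q P) PQ≡1))

  -- The three `refl` hold by computation: ½ · 2 = 1, and both series have constant term 1.
  module C = L.Combination {P} {Q} {½} PQ≡1 ≡.refl {fSeries Q} {fSeries (Q * Q)} ≡.refl ≡.refl isEuler isEuler²

  lhsSeries≡lhs : ∀ n → lhsSeries q n ≡ C.lhs n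
  lhsSeries≡lhs n = ≡.cong₂ (λ a b → (Q ℚ.- 1ℚ) * (a ℚ.- ½ * b)) (logPS≡log (fSeries Q) n)
                      (subSq≡σ (logPS≡log (fSeries (Q * Q))) n)

  even : ∀ n → 3 ℕ.≤ n → InZ₂ (½ * lhsSeries q n)
  even n 3≤n with odd-part n (ℕ.<-≤-trans (s≤s z≤n) 3≤n)
  ... | v , l , ≡.refl = ≡.subst (λ x → InZ₂ (½ * x)) (≡.sym (lhsSeries≡lhs n))
    (inZ₂ {proj₁ result} {proj₁ (proj₂ (proj₂ result))} (proj₁ (proj₂ result)) (proj₂ (proj₂ (proj₂ result))))
    where
    result = C.lhs-even regular P-regular two-regular P-mod2 v l 3≤n
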